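{- Let $T$ be the set of the three vertices of a (non-degenerate) triangle in the Euclidean plane that has an angle larger than $135^\circ$. Then $T$ is not diameter-Ramsey.
   Context: $\mathbb{N}$ denotes the positive integers and $\|\cdot\|$ the Euclidean norm. The diameter of a set $P \subset \mathbb{R}^d$ is $\mathrm{diam}(P) := \sup\{\|x-y\| : x,y \in P\}$. Two sets, possibly in Euclidean spaces of different dimensions, are congruent if there is a distance-preserving bijection between them. A finite set $A \subset \mathbb{R}^d$ is called diameter-Ramsey if for every $r \in \mathbb{N}$ there exist $n \in \mathbb{N}$ and a finite set $B \subset \mathbb{R}^n$ with $\mathrm{diam}(B) = \mathrm{diam}(A)$ such that whenever the points of $B$ are coloured with $r$ colours, there is a monochromatic set $A' \subset B$ (all points of $A'$ have the same colour) which is congruent to $A$. -}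

module Defs where

open import Data.Bool.Base using (if_then_else_)
open import Data.Fin.Base using (Fin)
open import Data.Fin.Subset using (Subset; _∈_)
open import Data.Integer.Base as ℤ using (ℤ; +_; -[1+_]; 1ℤ)
import Data.Integer.Properties as ℤ
open import Data.Nat.Base as ℕ using (ℕ; zero; suc; _!)
import Data.Nat.Properties as ℕ
open import Data.Product.Base using (Σ; Σ-syntax; ∃; ∃-syntax; _×_; _,_; proj₁; proj₂)
open import Data.Rational as ℚ using (ℚ; mkℚ; 0ℚ; 1ℚ; ½; _/_; ↥_; ↧ₙ_; *≤*; *<*)
import Data.Rational.Properties as ℚ
import Data.Rational.Unnormalised.Base as ℚᵘ
import Data.Rational.Unnormalised.Properties as ℚᵘ
open import Data.Rational.Solver using (module +-*-Solver)
open import Data.Sum.Base using (_⊎_; inj₁; inj₂)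
open import Data.Vec.Functional using (Vector; foldr; map; zipWith)
open import Function.Bundles using (_⤖_; module Bijection)
open import Function.Definitions using (Injective)
open import Relation.Binary.PropositionalEquality
open import Relation.Nullary using (¬_; Dec; does; yes; no; contradiction)

------------------------------------------------------------------------
-- The real numbers: Cauchy sequences of rationals, with the setoid
-- equality _≈_ below.

IsCauchy : (ℕ → ℚ) → Set
IsCauchy x = ∀ ε → 0ℚ ℚ.< ε →
  ∃[ N ] ∀ m n → N ℕ.≤ m → N ℕ.≤ n → ℚ.∣ x m ℚ.- x n ∣ ℚ.< ε

record ℝ : Set where
  constructor mkℝ
  field
    seq    : ℕ → ℚ
    cauchy : IsCauchy seq

open ℝ public

infix 4 _≈_ _<_ _≤_

_≈_ : ℝ → ℝ → Set
x ≈ y = ∀ ε → 0ℚ ℚ.< ε →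
  ∃[ N ] ∀ n → N ℕ.≤ n → ℚ.∣ seq x n ℚ.- seq y n ∣ ℚ.< ε

_<_ : ℝ → ℝ → Set
x < y = ∃[ ε ] 0ℚ ℚ.< ε ×
  (∃[ N ] ∀ n → N ℕ.≤ n → seq x n ℚ.+ ε ℚ.≤ seq y n)

_≤_ : ℝ → ℝ → Set
x ≤ y = ∀ ε → 0ℚ ℚ.< ε →
  ∃[ N ] ∀ n → N ℕ.≤ n → seq x n ℚ.≤ seq y n ℚ.+ ε

module _ where
  open +-*-Solver

  halves : ∀ ε → ½ ℚ.* ε ℚ.+ ½ ℚ.* ε ≡ ε
  halves = solve 1 (λ e → con ½ :* e :+ con ½ :* e := e) refl

  +-rearrange : ∀ a b c d →
    (a ℚ.+ b) ℚ.- (c ℚ.+ d) ≡ (a ℚ.- c) ℚ.+ (b ℚ.- d)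
  +-rearrange = solve 4 (λ a b c d →
    (a :+ b) :- (c :+ d) := (a :- c) :+ (b :- d)) refl

  neg-rearrange : ∀ a b → (ℚ.- a) ℚ.- (ℚ.- b) ≡ ℚ.- (a ℚ.- b)
  neg-rearrange = solve 2 (λ a b → (:- a) :- (:- b) := :- (a :- b)) refl

  *-rearrange : ∀ a b c d →
    a ℚ.* b ℚ.- c ℚ.* d ≡ a ℚ.* (b ℚ.- d) ℚ.+ d ℚ.* (a ℚ.- c)
  *-rearrange = solve 4 (λ a b c d →
    a :* b :- c :* d := a :* (b :- d) :+ d :* (a :- c)) refl

  split : ∀ a b → a ≡ (a ℚ.- b) ℚ.+ b
  split = solve 2 (λ a b → a := (a :- b) :+ b) refl

  flip- : ∀ a b → b ℚ.- a ≡ ℚ.- (a ℚ.- b)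
  flip- = solve 2 (λ a b → b :- a := :- (a :- b)) refl

  square-gap : ∀ s e →
    (s ℚ.+ (e ℚ.+ e)) ℚ.* (s ℚ.+ (e ℚ.+ e)) ≡
    ((s ℚ.+ e) ℚ.* (s ℚ.+ e) ℚ.+ e ℚ.* e) ℚ.+ (e ℚ.+ e) ℚ.* (s ℚ.+ e)
  square-gap = solve 2 (λ s e →
    (s :+ (e :+ e)) :* (s :+ (e :+ e)) :=
    ((s :+ e) :* (s :+ e) :+ e :* e) :+ (e :+ e) :* (s :+ e)) refl

half-pos : ∀ {ε} → 0ℚ ℚ.< ε → 0ℚ ℚ.< ½ ℚ.* ε
half-pos {ε} 0<ε =
  subst (ℚ._< ½ ℚ.* ε) (ℚ.*-zeroʳ ½) (ℚ.*-monoʳ-<-pos ½ 0<ε)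

≤-by-pos : ∀ {p q} → 0ℚ ℚ.≤ q → p ℚ.≤ p ℚ.+ q
≤-by-pos {p} {q} 0≤q =
  subst (ℚ._≤ p ℚ.+ q) (ℚ.+-identityʳ p) (ℚ.+-monoʳ-≤ p 0≤q)

*-mono-≤ : ∀ {p q r s} → 0ℚ ℚ.≤ p → 0ℚ ℚ.≤ s → p ℚ.≤ q → r ℚ.≤ s →
           p ℚ.* r ℚ.≤ q ℚ.* s
*-mono-≤ {p} {q} {r} {s} 0≤p 0≤s p≤q r≤s =
  ℚ.≤-trans (ℚ.*-monoˡ-≤-nonNeg p {{ℚ.nonNegative 0≤p}} r≤s)
            (ℚ.*-monoʳ-≤-nonNeg s {{ℚ.nonNegative 0≤s}} p≤q)

*-nonNeg : ∀ {p q} → 0ℚ ℚ.≤ p → 0ℚ ℚ.≤ q → 0ℚ ℚ.≤ p ℚ.* q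
*-nonNeg {p} {q} 0≤p 0≤q =
  subst (ℚ._≤ p ℚ.* q) (ℚ.*-zeroˡ 0ℚ) (*-mono-≤ ℚ.≤-refl 0≤q 0≤p 0≤q)

bounded : ∀ x → IsCauchy x →
  ∃[ M ] 0ℚ ℚ.< M × (∃[ N ] ∀ n → N ℕ.≤ n → ℚ.∣ x n ∣ ℚ.≤ M)
bounded x x-cauchy with x-cauchy 1ℚ (ℚ.positive⁻¹ 1ℚ)
... | N , close = 1ℚ ℚ.+ ℚ.∣ x N ∣ , pos , N , bound
  where
  pos : 0ℚ ℚ.< 1ℚ ℚ.+ ℚ.∣ x N ∣
  pos = ℚ.<-≤-trans (ℚ.positive⁻¹ 1ℚ) (≤-by-pos (ℚ.0≤∣p∣ (x N)))

  bound : ∀ n → N ℕ.≤ n → ℚ.∣ x n ∣ ℚ.≤ 1ℚ ℚ.+ ℚ.∣ x N ∣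
  bound n N≤n = begin
    ℚ.∣ x n ∣                        ≡⟨ cong ℚ.∣_∣ (split (x n) (x N)) ⟩
    ℚ.∣ (x n ℚ.- x N) ℚ.+ x N ∣      ≤⟨ ℚ.∣p+q∣≤∣p∣+∣q∣ (x n ℚ.- x N) (x N) ⟩
    ℚ.∣ x n ℚ.- x N ∣ ℚ.+ ℚ.∣ x N ∣  ≤⟨ ℚ.+-monoˡ-≤ ℚ.∣ x N ∣
                                          (ℚ.<⇒≤ (close n N N≤n ℕ.≤-refl)) ⟩
    1ℚ ℚ.+ ℚ.∣ x N ∣                 ∎
    where open ℚ.≤-Reasoning

const-cauchy : ∀ q → IsCauchy (λ _ → q)
const-cauchy q ε 0<ε = 0 , λ _ _ _ _ →
  subst (ℚ._< ε) (sym (cong ℚ.∣_∣ (ℚ.+-inverseʳ q))) 0<ε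

+-cauchy : ∀ x y → IsCauchy x → IsCauchy y → IsCauchy (λ n → x n ℚ.+ y n)
+-cauchy x y cx cy ε 0<ε
  with cx (½ ℚ.* ε) (half-pos 0<ε) | cy (½ ℚ.* ε) (half-pos 0<ε)
... | M , closeˣ | N , closeʸ = M ℕ.⊔ N , λ m n M⊔N≤m M⊔N≤n → begin-strict
    ℚ.∣ (x m ℚ.+ y m) ℚ.- (x n ℚ.+ y n) ∣
      ≡⟨ cong ℚ.∣_∣ (+-rearrange (x m) (y m) (x n) (y n)) ⟩
    ℚ.∣ (x m ℚ.- x n) ℚ.+ (y m ℚ.- y n) ∣
      ≤⟨ ℚ.∣p+q∣≤∣p∣+∣q∣ (x m ℚ.- x n) (y m ℚ.- y n) ⟩
    ℚ.∣ x m ℚ.- x n ∣ ℚ.+ ℚ.∣ y m ℚ.- y n ∣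
      <⟨ ℚ.+-mono-<
           (closeˣ m n (ℕ.m⊔n≤o⇒m≤o M N M⊔N≤m) (ℕ.m⊔n≤o⇒m≤o M N M⊔N≤n))
           (closeʸ m n (ℕ.m⊔n≤o⇒n≤o M N M⊔N≤m) (ℕ.m⊔n≤o⇒n≤o M N M⊔N≤n)) ⟩
    ½ ℚ.* ε ℚ.+ ½ ℚ.* ε  ≡⟨ halves ε ⟩
    ε                    ∎
  where open ℚ.≤-Reasoning

neg-cauchy : ∀ x → IsCauchy x → IsCauchy (λ n → ℚ.- x n)
neg-cauchy x cx ε 0<ε with cx ε 0<ε
... | N , close = N , λ m n N≤m N≤n →
  subst (ℚ._< ε)
    (sym (trans (cong ℚ.∣_∣ (neg-rearrange (x m) (x n)))
                (ℚ.∣-p∣≡∣p∣ (x m ℚ.- x n))))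
    (close m n N≤m N≤n)

scale : ∀ {M ε} → 0ℚ ℚ.< M → 0ℚ ℚ.< ε →
        ∃[ δ ] 0ℚ ℚ.< δ × M ℚ.* δ ≡ ε
scale {M} {ε} 0<M 0<ε = (1/M) ℚ.* ε , δ-pos , Mδ≡ε
  where
  instance
    M-pos : ℚ.Positive M
    M-pos = ℚ.positive 0<M
    M-nonZero : ℚ.NonZero M
    M-nonZero = ℚ.pos⇒nonZero M
    1/M-pos : ℚ.Positive (ℚ.1/ M)
    1/M-pos = ℚ.1/pos⇒pos M
  1/M = ℚ.1/ M
  δ-pos : 0ℚ ℚ.< 1/M ℚ.* ε
  δ-pos = subst (ℚ._< 1/M ℚ.* ε) (ℚ.*-zeroʳ 1/M) (ℚ.*-monoʳ-<-pos 1/M 0<ε)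
  Mδ≡ε : M ℚ.* (1/M ℚ.* ε) ≡ ε
  Mδ≡ε = trans (sym (ℚ.*-assoc M 1/M ε))
           (trans (cong (ℚ._* ε) (ℚ.*-inverseʳ M)) (ℚ.*-identityˡ ε))

*-small : ∀ {M δ η} a b → 0ℚ ℚ.< M → M ℚ.* δ ≡ η →
          ℚ.∣ a ∣ ℚ.≤ M → ℚ.∣ b ∣ ℚ.< δ → ℚ.∣ a ℚ.* b ∣ ℚ.< η
*-small {M} {δ} {η} a b 0<M Mδ≡η ∣a∣≤M ∣b∣<δ = begin-strict
  ℚ.∣ a ℚ.* b ∣        ≡⟨ ℚ.∣p*q∣≡∣p∣*∣q∣ a b ⟩
  ℚ.∣ a ∣ ℚ.* ℚ.∣ b ∣  ≤⟨ ℚ.*-monoʳ-≤-nonNeg ℚ.∣ b ∣ {{ℚ.∣-∣-nonNeg b}} ∣a∣≤M ⟩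
  M ℚ.* ℚ.∣ b ∣        <⟨ ℚ.*-monoʳ-<-pos M {{ℚ.positive 0<M}} ∣b∣<δ ⟩
  M ℚ.* δ              ≡⟨ Mδ≡η ⟩
  η                    ∎
  where open ℚ.≤-Reasoning

*-close : ∀ {A B δ η θ} a b c d → 0ℚ ℚ.< A → 0ℚ ℚ.< B →
          A ℚ.* δ ≡ θ → B ℚ.* η ≡ θ → ℚ.∣ a ∣ ℚ.≤ A → ℚ.∣ d ∣ ℚ.≤ B →
          ℚ.∣ b ℚ.- d ∣ ℚ.< δ → ℚ.∣ a ℚ.- c ∣ ℚ.< η →
          ℚ.∣ a ℚ.* b ℚ.- c ℚ.* d ∣ ℚ.< θ ℚ.+ θ
*-close {θ = θ} a b c d 0<A 0<B Aδ≡θ Bη≡θ ∣a∣≤A ∣d∣≤B b-d a-c = begin-strict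
  ℚ.∣ a ℚ.* b ℚ.- c ℚ.* d ∣
    ≡⟨ cong ℚ.∣_∣ (*-rearrange a b c d) ⟩
  ℚ.∣ a ℚ.* (b ℚ.- d) ℚ.+ d ℚ.* (a ℚ.- c) ∣
    ≤⟨ ℚ.∣p+q∣≤∣p∣+∣q∣ (a ℚ.* (b ℚ.- d)) (d ℚ.* (a ℚ.- c)) ⟩
  ℚ.∣ a ℚ.* (b ℚ.- d) ∣ ℚ.+ ℚ.∣ d ℚ.* (a ℚ.- c) ∣
    <⟨ ℚ.+-mono-< (*-small a (b ℚ.- d) 0<A Aδ≡θ ∣a∣≤A b-d)
                  (*-small d (a ℚ.- c) 0<B Bη≡θ ∣d∣≤B a-c) ⟩
  θ ℚ.+ θ ∎
  where open ℚ.≤-Reasoning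

*-cauchy : ∀ x y → IsCauchy x → IsCauchy y → IsCauchy (λ n → x n ℚ.* y n)
*-cauchy x y cx cy ε 0<ε =
  combine (bounded x cx) (bounded y cy)
  where
  θ = ½ ℚ.* ε
  combine : ∃[ A ] 0ℚ ℚ.< A × (∃[ N ] ∀ n → N ℕ.≤ n → ℚ.∣ x n ∣ ℚ.≤ A) →
            ∃[ B ] 0ℚ ℚ.< B × (∃[ N ] ∀ n → N ℕ.≤ n → ℚ.∣ y n ∣ ℚ.≤ B) →
            ∃[ N ] ∀ m n → N ℕ.≤ m → N ℕ.≤ n →
              ℚ.∣ x m ℚ.* y m ℚ.- x n ℚ.* y n ∣ ℚ.< ε
  combine (A , 0<A , N₁ , boundˣ) (B , 0<B , N₂ , boundʸ) =
    (N₁ ℕ.⊔ N₂) ℕ.⊔ (N₃ ℕ.⊔ N₄) , close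
    where
    δ-scale = scale 0<A (half-pos 0<ε)
    η-scale = scale 0<B (half-pos 0<ε)
    closeʸ = cy (proj₁ δ-scale) (proj₁ (proj₂ δ-scale))
    closeˣ = cx (proj₁ η-scale) (proj₁ (proj₂ η-scale))
    N₃ = proj₁ closeʸ
    N₄ = proj₁ closeˣ
    close : ∀ m n → (N₁ ℕ.⊔ N₂) ℕ.⊔ (N₃ ℕ.⊔ N₄) ℕ.≤ m →
            (N₁ ℕ.⊔ N₂) ℕ.⊔ (N₃ ℕ.⊔ N₄) ℕ.≤ n →
            ℚ.∣ x m ℚ.* y m ℚ.- x n ℚ.* y n ∣ ℚ.< ε
    close m n lm ln =
      subst (ℚ.∣ x m ℚ.* y m ℚ.- x n ℚ.* y n ∣ ℚ.<_) (halves ε)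
        (*-close (x m) (y m) (x n) (y n) 0<A 0<B
          (proj₂ (proj₂ δ-scale)) (proj₂ (proj₂ η-scale))
          (boundˣ m (ℕ.m⊔n≤o⇒m≤o N₁ N₂ m₁₂)) (boundʸ n (ℕ.m⊔n≤o⇒n≤o N₁ N₂ n₁₂))
          (proj₂ closeʸ m n (ℕ.m⊔n≤o⇒m≤o N₃ N₄ m₃₄) (ℕ.m⊔n≤o⇒m≤o N₃ N₄ n₃₄))
          (proj₂ closeˣ m n (ℕ.m⊔n≤o⇒n≤o N₃ N₄ m₃₄) (ℕ.m⊔n≤o⇒n≤o N₃ N₄ n₃₄)))
      where
      m₁₂ = ℕ.m⊔n≤o⇒m≤o (N₁ ℕ.⊔ N₂) (N₃ ℕ.⊔ N₄) lm
      m₃₄ = ℕ.m⊔n≤o⇒n≤o (N₁ ℕ.⊔ N₂) (N₃ ℕ.⊔ N₄) lm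
      n₁₂ = ℕ.m⊔n≤o⇒m≤o (N₁ ℕ.⊔ N₂) (N₃ ℕ.⊔ N₄) ln
      n₃₄ = ℕ.m⊔n≤o⇒n≤o (N₁ ℕ.⊔ N₂) (N₃ ℕ.⊔ N₄) ln

fromℚ : ℚ → ℝ
fromℚ q = mkℝ (λ _ → q) (const-cauchy q)

0ℝ 1ℝ : ℝ
0ℝ = fromℚ 0ℚ
1ℝ = fromℚ 1ℚ

infix  8 -_
infixl 7 _*_
infixl 6 _+_ _-_
infixr 8 _^_

_+_ : ℝ → ℝ → ℝ
x + y = mkℝ (λ n → seq x n ℚ.+ seq y n)
            (+-cauchy (seq x) (seq y) (cauchy x) (cauchy y))

-_ : ℝ → ℝ
- x = mkℝ (λ n → ℚ.- seq x n) (neg-cauchy (seq x) (cauchy x))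

_-_ : ℝ → ℝ → ℝ
x - y = x + (- y)

_*_ : ℝ → ℝ → ℝ
x * y = mkℝ (λ n → seq x n ℚ.* seq y n)
            (*-cauchy (seq x) (seq y) (cauchy x) (cauchy y))

_^_ : ℝ → ℕ → ℝ
x ^ zero  = 1ℝ
x ^ suc n = x * x ^ n

------------------------------------------------------------------------
-- Square root.  The n-th approximation to √ q is the largest
-- k / (n + 1) whose square does not exceed q (and 0 if q < 0, so that
-- √ x ≈ 0 for negative x).

searchDown : (n : ℕ) → ℚ → ℕ → ℚ
searchDown n q zero    = 0ℚ
searchDown n q (suc k) =
  if does ((+ suc k / suc n) ℚ.* (+ suc k / suc n) ℚ.≤? q)
  then + suc k / suc n
  else searchDown n q k

-- The starting point of the search is at least 1 + ∣ ↥ q ∣, so its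
-- square is larger than q.
√approx : ℕ → ℚ → ℚ
√approx n q = searchDown n q (suc n ℕ.* suc ℤ.∣ ↥ q ∣)

record Approximates (s h q : ℚ) : Set where
  field
    nonNeg : 0ℚ ℚ.≤ s
    lower  : s ℚ.* s ℚ.≤ q ⊎ s ≡ 0ℚ
    upper  : q ℚ.< (s ℚ.+ h) ℚ.* (s ℚ.+ h)

/-suc : ∀ n k → + suc k / suc n ≡ (+ k / suc n) ℚ.+ (+ 1 / suc n)
/-suc n k = ℚ.toℚᵘ-injective (begin
  ℚ.toℚᵘ (+ suc k / suc n)                        ≈⟨ ℚ.toℚᵘ-fromℚᵘ (ℚᵘ.mkℚᵘ (+ suc k) n) ⟩
  ℚᵘ.mkℚᵘ (+ suc k) n                             ≈⟨ ℚᵘ.*≡* identity ⟩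
  ℚᵘ.mkℚᵘ (+ k) n ℚᵘ.+ ℚᵘ.mkℚᵘ (+ 1) n            ≈⟨ ℚᵘ.+-cong (ℚ.toℚᵘ-fromℚᵘ (ℚᵘ.mkℚᵘ (+ k) n))
                                                              (ℚ.toℚᵘ-fromℚᵘ (ℚᵘ.mkℚᵘ (+ 1) n)) ⟨
  ℚ.toℚᵘ (+ k / suc n) ℚᵘ.+ ℚ.toℚᵘ (+ 1 / suc n)  ≈⟨ ℚ.toℚᵘ-homo-+ (+ k / suc n) (+ 1 / suc n) ⟨
  ℚ.toℚᵘ ((+ k / suc n) ℚ.+ (+ 1 / suc n))        ∎)
  where
  open ℚᵘ.≃-Reasoning
  d = + suc n
  identity : + suc k ℤ.* (d ℤ.* d) ≡ (+ k ℤ.* d ℤ.+ + 1 ℤ.* d) ℤ.* d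
  identity = trans (sym (ℤ.*-assoc (+ suc k) d d))
    (cong (ℤ._* d)
      (trans (cong (ℤ._* d) (cong +_ (ℕ.+-comm 1 k)))
             (ℤ.*-distribʳ-+ d (+ k) (+ 1))))

/-nonNeg : ∀ n k → 0ℚ ℚ.≤ + k / suc n
/-nonNeg n k = ℚ.nonNegative⁻¹ (+ k / suc n) {{ℚ.normalize-nonNeg k (suc n)}}

if-Dec : ∀ {A P : Set} (Q : A → Set) {a b} (P? : Dec P) →
         (P → Q a) → (¬ P → Q b) → Q (if does P? then a else b)
if-Dec Q (yes p) f g = f p
if-Dec Q (no ¬p) f g = g ¬p

searchDown-correct : ∀ n q k →
  q ℚ.< (+ suc k / suc n) ℚ.* (+ suc k / suc n) →
  Approximates (searchDown n q k) (+ 1 / suc n) q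
searchDown-correct n q zero q< = record
  { nonNeg = ℚ.≤-refl
  ; lower  = inj₂ refl
  ; upper  = subst (λ z → q ℚ.< z ℚ.* z) (sym (ℚ.+-identityˡ (+ 1 / suc n))) q<
  }
searchDown-correct n q (suc k) q< =
  if-Dec (λ s → Approximates s (+ 1 / suc n) q)
    ((+ suc k / suc n) ℚ.* (+ suc k / suc n) ℚ.≤? q)
    (λ ≤q → record
      { nonNeg = /-nonNeg n (suc k)
      ; lower  = inj₁ ≤q
      ; upper  = subst (λ z → q ℚ.< z ℚ.* z) (/-suc n (suc k)) q<
      })
    (λ ≰q → searchDown-correct n q k (ℚ.≰⇒> ≰q))

start-large : ∀ n q → let K = suc n ℕ.* suc ℤ.∣ ↥ q ∣ in
  q ℚ.< (+ suc K / suc n) ℚ.* (+ suc K / suc n)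
start-large n q@(mkℚ z d _) = begin-strict
  q              ≤⟨ q≤g ⟩
  g              ≡⟨ ℚ.*-identityʳ g ⟨
  g ℚ.* 1ℚ       ≤⟨ *-mono-≤ 0≤g 0≤g ℚ.≤-refl 1≤g ⟩
  g ℚ.* g        ≤⟨ *-mono-≤ 0≤g 0≤g+h ℚ.≤-refl (ℚ.<⇒≤ g<g+h) ⟩
  g ℚ.* g+h      <⟨ ℚ.*-monoˡ-<-pos g+h {{ℚ.positive (ℚ.≤-<-trans 0≤g g<g+h)}} g<g+h ⟩
  g+h ℚ.* g+h    ≡⟨ cong (λ w → w ℚ.* w) (/-suc n K) ⟨
  (+ suc K / suc n) ℚ.* (+ suc K / suc n) ∎
  where
  open ℚ.≤-Reasoning
  K = suc n ℕ.* suc ℤ.∣ z ∣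
  g = + K / suc n
  g+h = g ℚ.+ (+ 1 / suc n)
  0≤g = /-nonNeg n K
  g<g+h : g ℚ.< g+h
  g<g+h = subst (ℚ._< g+h) (ℚ.+-identityʳ g)
    (ℚ.+-monoʳ-< g (ℚ.positive⁻¹ (+ 1 / suc n) {{ℚ.normalize-pos 1 (suc n)}}))
  0≤g+h = ℚ.≤-trans 0≤g (ℚ.<⇒≤ g<g+h)
  g≃ = ℚ.toℚᵘ-fromℚᵘ (ℚᵘ.mkℚᵘ (+ K) n)
  z≤∣z∣ : ∀ i → i ℤ.≤ + ℤ.∣ i ∣
  z≤∣z∣ (+ _)      = ℤ.≤-refl
  z≤∣z∣ (-[1+ _ ]) = ℤ.-≤+
  natural : ℤ.∣ z ∣ ℕ.* suc n ℕ.≤ K ℕ.* suc d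
  natural = ℕ.≤-trans
    (ℕ.≤-trans (ℕ.≤-reflexive (ℕ.*-comm ℤ.∣ z ∣ (suc n)))
               (ℕ.*-monoʳ-≤ (suc n) (ℕ.n≤1+n ℤ.∣ z ∣)))
    (ℕ.m≤m*n K (suc d))
  q≤g : q ℚ.≤ g
  q≤g = ℚ.toℚᵘ-cancel-≤ (ℚᵘ.≤-respʳ-≃ (ℚᵘ.≃-sym g≃) (ℚᵘ.*≤*
    (ℤ.≤-trans (ℤ.*-monoʳ-≤-nonNeg (+ suc n) (z≤∣z∣ z))
      (subst₂ ℤ._≤_ (ℤ.pos-* ℤ.∣ z ∣ (suc n)) (ℤ.pos-* K (suc d)) (ℤ.+≤+ natural)))))
  1≤g : 1ℚ ℚ.≤ g
  1≤g = ℚ.toℚᵘ-cancel-≤ (ℚᵘ.≤-respʳ-≃ (ℚᵘ.≃-sym g≃) (ℚᵘ.*≤*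
    (subst₂ ℤ._≤_ (sym (ℤ.*-identityˡ (+ suc n))) (sym (ℤ.*-identityʳ (+ K)))
      (ℤ.+≤+ (ℕ.m≤m*n (suc n) (suc ℤ.∣ z ∣))))))

√approx-correct : ∀ n q → Approximates (√approx n q) (+ 1 / suc n) q
√approx-correct n q = searchDown-correct n q (suc n ℕ.* suc ℤ.∣ ↥ q ∣) (start-large n q)

archimedean : ∀ e → 0ℚ ℚ.< e → ∃[ N ] ∀ n → N ℕ.≤ n → + 1 / suc n ℚ.< e
archimedean e@(mkℚ (+ suc p) d _) _ = suc d , λ n d<n →
  ℚ.toℚᵘ-cancel-< (ℚᵘ.<-respˡ-≃ (ℚᵘ.≃-sym (ℚ.toℚᵘ-fromℚᵘ (ℚᵘ.mkℚᵘ (+ 1) n)))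
    (ℚᵘ.*<* (subst₂ ℤ._<_ (ℤ.pos-* 1 (suc d)) (ℤ.pos-* (suc p) (suc n))
      (ℤ.+<+ (ℕ.≤-trans
        (ℕ.s≤s (ℕ.≤-trans (ℕ.≤-reflexive (ℕ.*-identityˡ (suc d))) d<n))
        (ℕ.m≤n*m (suc n) (suc p)))))))
archimedean (mkℚ (+ zero) _ _)     (*<* (ℤ.+<+ ()))
archimedean (mkℚ -[1+ _ ] _ _)     (*<* ())

approx-close : ∀ {s t h h′ a b e} → 0ℚ ℚ.< e →
  Approximates s h a → 0ℚ ℚ.≤ h → h ℚ.≤ e → Approximates t h′ b →
  b ℚ.- a ℚ.< e ℚ.* e → t ℚ.< s ℚ.+ (e ℚ.+ e)
approx-close {s} {t} {h} {h′} {a} {b} {e} 0<e A 0≤h h≤e B b-a<e²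
  with t ℚ.<? s ℚ.+ (e ℚ.+ e)
... | yes t< = t<
... | no t≮ = contradiction loop (ℚ.<-irrefl refl)
  where
  module A = Approximates A
  module B = Approximates B
  s+2e≤t = ℚ.≮⇒≥ t≮
  0≤e = ℚ.<⇒≤ 0<e
  0<2e = ℚ.<-≤-trans 0<e (≤-by-pos {e} 0≤e)
  0≤s+e = ℚ.≤-trans A.nonNeg (≤-by-pos 0≤e)
  0≤s+h = ℚ.≤-trans A.nonNeg (≤-by-pos 0≤h)
  0<s+2e : 0ℚ ℚ.< s ℚ.+ (e ℚ.+ e)
  0<s+2e = subst (ℚ._< s ℚ.+ (e ℚ.+ e)) (ℚ.+-identityˡ 0ℚ)
             (ℚ.+-mono-≤-< A.nonNeg 0<2e)
  t²≤b : t ℚ.* t ℚ.≤ b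
  t²≤b with B.lower
  ... | inj₁ le  = le
  ... | inj₂ t≡0 = contradiction
    (subst (0ℚ ℚ.<_) t≡0 (ℚ.<-≤-trans 0<s+2e s+2e≤t)) (ℚ.<-irrefl refl)
  open ℚ.≤-Reasoning
  s+2e = s ℚ.+ (e ℚ.+ e)
  loop : s+2e ℚ.* s+2e ℚ.< s+2e ℚ.* s+2e
  loop = begin-strict
    s+2e ℚ.* s+2e
      ≤⟨ *-mono-≤ (ℚ.<⇒≤ 0<s+2e) B.nonNeg s+2e≤t s+2e≤t ⟩
    t ℚ.* t
      ≤⟨ t²≤b ⟩
    b
      ≡⟨ split b a ⟩
    (b ℚ.- a) ℚ.+ a
      <⟨ ℚ.+-mono-< b-a<e² A.upper ⟩
    e ℚ.* e ℚ.+ (s ℚ.+ h) ℚ.* (s ℚ.+ h)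
      ≤⟨ ℚ.+-monoʳ-≤ (e ℚ.* e)
           (*-mono-≤ 0≤s+h 0≤s+e (ℚ.+-monoʳ-≤ s h≤e) (ℚ.+-monoʳ-≤ s h≤e)) ⟩
    e ℚ.* e ℚ.+ (s ℚ.+ e) ℚ.* (s ℚ.+ e)
      ≡⟨ ℚ.+-comm (e ℚ.* e) _ ⟩
    (s ℚ.+ e) ℚ.* (s ℚ.+ e) ℚ.+ e ℚ.* e
      ≤⟨ ≤-by-pos (*-nonNeg (ℚ.<⇒≤ 0<2e) 0≤s+e) ⟩
    ((s ℚ.+ e) ℚ.* (s ℚ.+ e) ℚ.+ e ℚ.* e) ℚ.+ (e ℚ.+ e) ℚ.* (s ℚ.+ e)
      ≡⟨ square-gap s e ⟨
    s+2e ℚ.* s+2e ∎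

≤∣∣ : ∀ p → p ℚ.≤ ℚ.∣ p ∣
≤∣∣ p with ℚ.≤-total 0ℚ p
... | inj₁ 0≤p = ℚ.≤-reflexive (sym (ℚ.0≤p⇒∣p∣≡p 0≤p))
... | inj₂ p≤0 = ℚ.≤-trans p≤0 (ℚ.0≤∣p∣ p)

∣-∣-< : ∀ {s t r} → t ℚ.< s ℚ.+ r → s ℚ.< t ℚ.+ r → ℚ.∣ s ℚ.- t ∣ ℚ.< r
∣-∣-< {s} {t} {r} t<s+r s<t+r with ℚ.∣p∣≡p∨∣p∣≡-p (s ℚ.- t)
... | inj₁ eq = subst (ℚ._< r) (sym eq) (shift s<t+r)
  where
  open +-*-Solver
  shift : s ℚ.< t ℚ.+ r → s ℚ.- t ℚ.< r
  shift lt = subst (s ℚ.- t ℚ.<_)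
    (solve 2 (λ t r → (t :+ r) :- t := r) refl t r) (ℚ.+-monoˡ-< (ℚ.- t) lt)
... | inj₂ eq = subst (ℚ._< r) (sym (trans eq (sym (flip- s t)))) (shift t<s+r)
  where
  open +-*-Solver
  shift : t ℚ.< s ℚ.+ r → t ℚ.- s ℚ.< r
  shift lt = subst (t ℚ.- s ℚ.<_)
    (solve 2 (λ s r → (s :+ r) :- s := r) refl s r) (ℚ.+-monoˡ-< (ℚ.- s) lt)

√-cauchy : ∀ x → IsCauchy x → IsCauchy (λ n → √approx n (x n))
√-cauchy x cx ε 0<ε = result
  where
  e = ½ ℚ.* ε
  0<e = half-pos 0<ε
  0<e² : 0ℚ ℚ.< e ℚ.* e
  0<e² = subst (ℚ._< e ℚ.* e) (ℚ.*-zeroʳ e)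
           (ℚ.*-monoʳ-<-pos e {{ℚ.positive 0<e}} 0<e)
  N₁ = proj₁ (cx (e ℚ.* e) 0<e²)
  N₂ = proj₁ (archimedean e 0<e)
  N  = N₁ ℕ.⊔ N₂
  one-side : ∀ m n → N ℕ.≤ m → N ℕ.≤ n →
    √approx n (x n) ℚ.< √approx m (x m) ℚ.+ ε
  one-side m n N≤m N≤n =
    subst (λ r → √approx n (x n) ℚ.< √approx m (x m) ℚ.+ r) (halves ε)
      (approx-close 0<e
        (√approx-correct m (x m)) (/-nonNeg m 1)
        (ℚ.<⇒≤ (proj₂ (archimedean e 0<e) m (ℕ.m⊔n≤o⇒n≤o N₁ N₂ N≤m)))
        (√approx-correct n (x n))
        (ℚ.≤-<-trans (≤∣∣ (x n ℚ.- x m))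
          (proj₂ (cx (e ℚ.* e) 0<e²) n m
            (ℕ.m⊔n≤o⇒m≤o N₁ N₂ N≤n) (ℕ.m⊔n≤o⇒m≤o N₁ N₂ N≤m))))
  result : ∃[ N ] ∀ m n → N ℕ.≤ m → N ℕ.≤ n →
    ℚ.∣ √approx m (x m) ℚ.- √approx n (x n) ∣ ℚ.< ε
  result = N , λ m n N≤m N≤n →
    ∣-∣-< (one-side m n N≤m N≤n) (one-side n m N≤n N≤m)

√_ : ℝ → ℝ
√ x = mkℝ (λ n → √approx n (seq x n)) (√-cauchy (seq x) (cauchy x))

------------------------------------------------------------------------
-- Suprema, series, and the numbers cos θ and π

IsSup : (ℝ → Set) → ℝ → Set
IsSup S s = (∀ t → S t → t ≤ s) × (∀ b → (∀ t → S t → t ≤ b) → s ≤ b)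

partialSum : (ℕ → ℝ) → ℕ → ℝ
partialSum a zero    = 0ℝ
partialSum a (suc n) = partialSum a n + a n

HasSum : (ℕ → ℝ) → ℝ → Set
HasSum a s = ∀ ε → 0ℝ < ε →
  ∃[ N ] ∀ n → N ℕ.≤ n → (s - ε < partialSum a n) × (partialSum a n < s + ε)

-- (-1)ᵏ x²ᵏ / (2k)!
cosTerm : ℝ → ℕ → ℝ
cosTerm x k = fromℚ (((ℤ.- 1ℤ) ℤ.^ k / (2 ℕ.* k) !) {{(2 ℕ.* k) ℕ.!≢0}}) * x ^ (2 ℕ.* k)

-- "cos x = c".  A relation, so that no convergence proof is needed here.
IsCos : ℝ → ℝ → Set
IsCos x c = HasSum (cosTerm x) c

-- "p = π": p / 2 is the first positive zero of the cosine.
IsPi : ℝ → Set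
IsPi p = 0ℝ < p
       × IsCos (fromℚ ½ * p) 0ℝ
       × (∀ x c → 0ℝ ≤ x → x < fromℚ ½ * p → IsCos x c → 0ℝ < c)

------------------------------------------------------------------------
-- Euclidean space

Point : ℕ → Set
Point d = Vector ℝ d

infix  4 _≈ₚ_
infixl 6 _+ₚ_ _-ₚ_
infixl 7 _·ₚ_ _∙_

_≈ₚ_ : ∀ {d} → Point d → Point d → Set
x ≈ₚ y = ∀ i → x i ≈ y i

_+ₚ_ _-ₚ_ : ∀ {d} → Point d → Point d → Point d
_+ₚ_ = zipWith _+_
_-ₚ_ = zipWith _-_

_·ₚ_ : ∀ {d} → ℝ → Point d → Point d
t ·ₚ x = map (t *_) x

_∙_ : ∀ {d} → Point d → Point d → ℝ
x ∙ y = foldr _+_ 0ℝ (zipWith _*_ x y)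

‖_‖ : ∀ {d} → Point d → ℝ
‖ x ‖ = √ (x ∙ x)

dist : ∀ {d} → Point d → Point d → ℝ
dist x y = ‖ x -ₚ y ‖

-- A set of k distinct points in ℝᵈ.
record PointSet (d k : ℕ) : Set where
  field
    point    : Fin k → Point d
    distinct : Injective _≡_ _≈ₚ_ point

open PointSet public

IsDiameter : ∀ {d k} → PointSet d k → ℝ → Set
IsDiameter P = IsSup (λ t → ∃[ i ] ∃[ j ] t ≈ dist (point P i) (point P j))

-- diam P = diam Q.  (The empty set has no supremum of distances in ℝ.)
SameDiameter : ∀ {d e k l} → PointSet d k → PointSet e l → Set
SameDiameter P Q = ∃[ D ] IsDiameter P D × IsDiameter Q D

-- Both families are understood to consist of pairwise distinct points, so
-- that bijections of the index sets are bijections of the point sets.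
Congruent : ∀ {d e} {I J : Set} → (I → Point d) → (J → Point e) → Set
Congruent {I = I} {J} P Q = Σ[ f ∈ I ⤖ J ]
  (∀ i i′ → dist (P i) (P i′) ≈ dist (Q (Bijection.to f i)) (Q (Bijection.to f i′)))

-- Subsets of P are given by sets of indices.
restrict : ∀ {d k} → PointSet d k → (S : Subset k) → (∃[ i ] i ∈ S) → Point d
restrict P S (i , _) = point P i

Monochromatic : ∀ {k r} → (Fin k → Fin r) → Subset k → Set
Monochromatic χ S = ∀ i j → i ∈ S → j ∈ S → χ i ≡ χ j

DiameterRamsey : ∀ {d k} → PointSet d k → Set
DiameterRamsey A =
  ∀ (r : ℕ) → .{{ℕ.NonZero r}} →
  ∃[ n ] ℕ.NonZero n ×
  (∃[ m ] Σ[ B ∈ PointSet n m ]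
    SameDiameter B A ×
    (∀ (χ : Fin m → Fin r) →
      ∃[ S ] Monochromatic χ S × Congruent (restrict B S) (point A)))

------------------------------------------------------------------------
-- Triangles and their angles

Collinear : ∀ {d k} → PointSet d k → Set
Collinear {d} P = Σ[ p ∈ Point d ] Σ[ v ∈ Point d ]
  (∀ i → ∃[ t ] point P i ≈ₚ p +ₚ t ·ₚ v)

-- The angle at y between the segments yx and yz measures α degrees:
-- 0 ≤ α ≤ 180 and cos (α π / 180) = ⟨x - y, z - y⟩ / (‖x - y‖ ‖z - y‖).
AngleDegrees : ∀ {d} → Point d → Point d → Point d → ℝ → Set
AngleDegrees x y z α =
  0ℝ ≤ α × α ≤ fromℚ (+ 180 / 1) ×
  (∃[ π ] IsPi π × (∃[ c ] IsCos (α * (fromℚ (+ 1 / 180) * π)) c ×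
    c * (‖ x -ₚ y ‖ * ‖ z -ₚ y ‖) ≈ (x -ₚ y) ∙ (z -ₚ y)))

HasAngleLargerThan : ∀ {d} → ℝ → PointSet d 3 → Set
HasAngleLargerThan β T =
  ∃[ i ] ∃[ j ] ∃[ k ] i ≢ j × j ≢ k × i ≢ k ×
  (∃[ α ] AngleDegrees (point T i) (point T j) (point T k) α × β < α)

module Submission where

open import Defs
open import Data.Empty using (⊥; ⊥-elim)
open import Data.Fin.Base using (Fin; zero; suc; toℕ; fromℕ; inject₁)
open import Data.Fin.Properties using (all?; _≟_; toℕ-fromℕ; toℕ-inject₁)
open import Data.Fin.Subset using (_∈_)
open import Data.Integer.Base using (+_)
import Data.Integer.Base as ℤ
import Data.Integer.Properties as ℤ
open import Data.Nat.Base as ℕ using (ℕ; zero; suc; _!)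
import Data.Nat.Properties as ℕ
open import Data.Product.Base using (Σ-syntax; ∃; ∃-syntax; _×_; _,_; proj₁; proj₂)
open import Data.Rational as ℚ using (ℚ; 0ℚ; 1ℚ; ½)
open import Data.Rational.Base using (_/_)
import Data.Rational.Properties as ℚ
open import Data.Rational.Solver using (module +-*-Solver)
import Data.Rational.Unnormalised.Base as ℚᵘ
import Data.Rational.Unnormalised.Properties as ℚᵘ
open import Data.Sum.Base using (_⊎_; inj₁; inj₂)
open import Data.Vec.Functional using (foldr; zipWith)
open import Function.Base using (_∘_)
open import Function.Bundles using (module Bijection)
open import Relation.Binary.PropositionalEquality
open import Relation.Nullary using (¬_; yes; no; _⊎-dec_)
open import Relation.Nullary.Decidable using (from-yes)
open +-*-Solver using (Polynomial; solve; con; _:=_; _:+_; _:*_; _:-_; :-_)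

-- Write y for the vertex of the large angle, u = x - y, v = z - y, p = ∣u∣²,
-- q = ∣v∣² and s = ⟨u , v⟩.  The angle condition says s < 0 and 2 s² > p q,
-- i.e. that the circumradius of T exceeds diam T / √2 (here diam T = ∣x - z∣).
-- A finite set B of the same diameter lies, up to ε, in a ball of radius
-- diam T / √2 by Jung's theorem.  Colour its points by their distance to the
-- centre of that ball, in thin shells; the number of colours depends only on
-- T.  A copy of T inside one shell is almost equidistant from the centre, so
-- its circumradius would be at most about diam T / √2.
--
-- The cosine enters through cos (x + y) + cos (x - y) = 2 cos x cos y only,
-- which is a Cauchy product.

-- The order on Cauchy reals is not decidable, and this shapes the proof. An inequality is proved by
-- writing the difference of its sides as a combination of nonnegative reals, an identity of
-- rational polynomials at every index; a contradiction is a positive real plus nonnegative ones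
-- with total 0. Squared distances are polynomials in the coordinates, so geometry takes this form
-- as well. Neither the smallest enclosing ball nor an exact shell is available: the centre is
-- computed up to an error, and the shells overlap. All these errors are of size ε and are absorbed
-- by the strictness of 2 s² > p q; ε is fixed from T before B is known. The factor 1/√2 is the
-- limit of Jung's constant √(n / (2n + 2)), hence valid in every dimension at once. The
-- circumradius ∣x - z∣ / (2 sin α) of an obtuse triangle reaches ∣x - z∣ / √2 exactly at α = 135°.
-- On the side of the cosine, only its positivity on [0, π/2) is given by `IsPi`; it is applied at
-- 180° - α and at twice that angle.

p≤q⇒0≤q-p : ∀ {p q} → p ℚ.≤ q → 0ℚ ℚ.≤ q ℚ.- p
p≤q⇒0≤q-p {p} {q} p≤q =
  subst (ℚ._≤ q ℚ.- p) (ℚ.+-inverseʳ p) (ℚ.+-monoˡ-≤ (ℚ.- p) p≤q)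

0≤q-p⇒p≤q : ∀ {p q} → 0ℚ ℚ.≤ q ℚ.- p → p ℚ.≤ q
0≤q-p⇒p≤q {p} {q} 0≤ =
  subst₂ ℚ._≤_ (ℚ.+-identityˡ p) (sym (split q p)) (ℚ.+-monoˡ-≤ p 0≤)

+-nonNeg : ∀ {p q} → 0ℚ ℚ.≤ p → 0ℚ ℚ.≤ q → 0ℚ ℚ.≤ p ℚ.+ q
+-nonNeg {p} {q} 0≤p 0≤q = ℚ.≤-trans 0≤p (≤-by-pos 0≤q)

+-pos : ∀ {p q} → 0ℚ ℚ.< p → 0ℚ ℚ.< q → 0ℚ ℚ.< p ℚ.+ q
+-pos {p} {q} 0<p 0<q = ℚ.<-≤-trans 0<p (≤-by-pos (ℚ.<⇒≤ 0<q))

*-pos : ∀ {p q} → 0ℚ ℚ.< p → 0ℚ ℚ.< q → 0ℚ ℚ.< p ℚ.* q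
*-pos {p} {q} 0<p 0<q =
  ℚ.positive⁻¹ (p ℚ.* q) {{ℚ.pos*pos⇒pos p {{ℚ.positive 0<p}} q {{ℚ.positive 0<q}}}}

neg-nonNeg : ∀ {p} → p ℚ.≤ 0ℚ → 0ℚ ℚ.≤ ℚ.- p
neg-nonNeg = ℚ.neg-antimono-≤

square-nonNeg : ∀ p → 0ℚ ℚ.≤ p ℚ.* p
square-nonNeg p with ℚ.≤-total 0ℚ p
... | inj₁ 0≤p = *-nonNeg 0≤p 0≤p
... | inj₂ p≤0 = subst (0ℚ ℚ.≤_)
  (solve 1 (λ p → (:- p) :* (:- p) := p :* p) refl p)
  (*-nonNeg (neg-nonNeg p≤0) (neg-nonNeg p≤0))

∣-∣-<⁻¹ : ∀ s t {r} → ℚ.∣ s ℚ.- t ∣ ℚ.< r → (s ℚ.< t ℚ.+ r) × (t ℚ.< s ℚ.+ r)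
∣-∣-<⁻¹ s t {r} lt = bound s t lt , bound t s
  (subst (ℚ._< r) (trans (sym (ℚ.∣-p∣≡∣p∣ (s ℚ.- t))) (cong ℚ.∣_∣ (sym (flip- s t)))) lt)
  where
  bound : ∀ a b → ℚ.∣ a ℚ.- b ∣ ℚ.< r → a ℚ.< b ℚ.+ r
  bound a b lt = subst₂ ℚ._<_ (sym (split a b)) (ℚ.+-comm r b)
    (ℚ.+-monoˡ-< b (ℚ.≤-<-trans (≤∣∣ (a ℚ.- b)) lt))

∣∣≤⇒≤ : ∀ {p r} → ℚ.∣ p ∣ ℚ.≤ r → p ℚ.≤ r
∣∣≤⇒≤ {p} = ℚ.≤-trans (≤∣∣ p)

∣∣≤⇒-≤ : ∀ {p r} → ℚ.∣ p ∣ ℚ.≤ r → ℚ.- p ℚ.≤ r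
∣∣≤⇒-≤ {p} {r} le = ∣∣≤⇒≤ (subst (ℚ._≤ r) (sym (ℚ.∣-p∣≡∣p∣ p)) le)

≤⇒∣∣≤ : ∀ {p r} → p ℚ.≤ r → ℚ.- p ℚ.≤ r → ℚ.∣ p ∣ ℚ.≤ r
≤⇒∣∣≤ {p} {r} p≤r -p≤r with ℚ.∣p∣≡p∨∣p∣≡-p p
... | inj₁ eq = subst (ℚ._≤ r) (sym eq) p≤r
... | inj₂ eq = subst (ℚ._≤ r) (sym eq) -p≤r

-- Real numbers

eventually₂ : ∀ {P Q R : ℕ → Set} → (∀ n → P n → Q n → R n) →
  (∃[ N ] ∀ n → N ℕ.≤ n → P n) → (∃[ N ] ∀ n → N ℕ.≤ n → Q n) →
  ∃[ N ] ∀ n → N ℕ.≤ n → R n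
eventually₂ f (M , p) (N , q) = M ℕ.⊔ N , λ n le →
  f n (p n (ℕ.m⊔n≤o⇒m≤o M N le)) (q n (ℕ.m⊔n≤o⇒n≤o M N le))

eventually-× : ∀ {P Q : ℕ → Set} →
  (∃[ N ] ∀ n → N ℕ.≤ n → P n) → (∃[ N ] ∀ n → N ℕ.≤ n → Q n) →
  ∃[ N ] ∀ n → N ℕ.≤ n → P n × Q n
eventually-× = eventually₂ (λ _ p q → p , q)

eventually : ∀ {P Q : ℕ → Set} → (∀ n → P n → Q n) →
  (∃[ N ] ∀ n → N ℕ.≤ n → P n) → ∃[ N ] ∀ n → N ℕ.≤ n → Q n
eventually f (N , p) = N , λ n le → f n (p n le)

pointwise : ∀ {x y} → (∀ n → seq x n ≡ seq y n) → x ≈ y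
pointwise {x} eq ε 0<ε = 0 , λ n _ → subst (ℚ._< ε)
  (sym (cong ℚ.∣_∣ (trans (cong (λ z → seq x n ℚ.- z) (sym (eq n))) (ℚ.+-inverseʳ (seq x n)))))
  0<ε

nonneg-pointwise : ∀ {x} → (∀ n → 0ℚ ℚ.≤ seq x n) → 0ℝ ≤ x
nonneg-pointwise 0≤x ε 0<ε = 0 , λ n _ → +-nonNeg (0≤x n) (ℚ.<⇒≤ 0<ε)

nonneg-const : ∀ {q} → 0ℚ ℚ.≤ q → 0ℝ ≤ fromℚ q
nonneg-const {q} 0≤q = nonneg-pointwise {fromℚ q} (λ _ → 0≤q)

nonneg-square : ∀ x → 0ℝ ≤ x * x
nonneg-square x = nonneg-pointwise {x * x} (λ n → square-nonNeg (seq x n))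

≈-nonneg : ∀ {x y} → x ≈ y → 0ℝ ≤ x → 0ℝ ≤ y
≈-nonneg {x} {y} x≈y 0≤x ε 0<ε = eventually₂ step
  (x≈y (½ ℚ.* ε) (half-pos 0<ε)) (0≤x (½ ℚ.* ε) (half-pos 0<ε))
  where
  step : ∀ n → ℚ.∣ seq x n ℚ.- seq y n ∣ ℚ.< ½ ℚ.* ε → 0ℚ ℚ.≤ seq x n ℚ.+ ½ ℚ.* ε →
         0ℚ ℚ.≤ seq y n ℚ.+ ε
  step n close le = begin
    0ℚ                                   ≤⟨ le ⟩
    seq x n ℚ.+ ½ ℚ.* ε                  ≤⟨ ℚ.+-monoˡ-≤ (½ ℚ.* ε) (ℚ.<⇒≤ (proj₁ (∣-∣-<⁻¹ (seq x n) (seq y n) close))) ⟩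
    (seq y n ℚ.+ ½ ℚ.* ε) ℚ.+ ½ ℚ.* ε    ≡⟨ ℚ.+-assoc (seq y n) _ _ ⟩
    seq y n ℚ.+ (½ ℚ.* ε ℚ.+ ½ ℚ.* ε)    ≡⟨ cong (seq y n ℚ.+_) (halves ε) ⟩
    seq y n ℚ.+ ε                        ∎
    where open ℚ.≤-Reasoning

nonneg-+ : ∀ {x y} → 0ℝ ≤ x → 0ℝ ≤ y → 0ℝ ≤ x + y
nonneg-+ {x} {y} 0≤x 0≤y ε 0<ε = eventually₂
  (λ n a b → subst (0ℚ ℚ.≤_) (eq (seq x n) (seq y n)) (+-nonNeg a b))
  (0≤x (½ ℚ.* ε) (half-pos 0<ε)) (0≤y (½ ℚ.* ε) (half-pos 0<ε))
  where
  eq : ∀ a b → (a ℚ.+ ½ ℚ.* ε) ℚ.+ (b ℚ.+ ½ ℚ.* ε) ≡ (a ℚ.+ b) ℚ.+ ε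
  eq a b = solve 3 (λ a b e →
    (a :+ con ½ :* e) :+ (b :+ con ½ :* e) := (a :+ b) :+ e) refl a b ε

-- If y ≥ 0 then xy ≥ -ηy, and otherwise ∣y∣ ≤ η.
*-almost-nonNeg : ∀ {x y A B η} → 0ℚ ℚ.≤ A → 0ℚ ℚ.≤ B → 0ℚ ℚ.≤ η →
  ℚ.∣ x ∣ ℚ.≤ A → ℚ.∣ y ∣ ℚ.≤ B → 0ℚ ℚ.≤ x ℚ.+ η → 0ℚ ℚ.≤ y ℚ.+ η →
  0ℚ ℚ.≤ x ℚ.* y ℚ.+ (A ℚ.+ B) ℚ.* η
*-almost-nonNeg {x} {y} {A} {B} {η} 0≤A 0≤B 0≤η ∣x∣≤A ∣y∣≤B 0≤x+η 0≤y+η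
  with ℚ.≤-total 0ℚ y
... | inj₁ 0≤y = subst (0ℚ ℚ.≤_)
  (solve 5 (λ x y A B η →
     ((x :+ η) :* y :+ η :* (B :- y)) :+ A :* η := x :* y :+ (A :+ B) :* η)
   refl x y A B η)
  (+-nonNeg (+-nonNeg (*-nonNeg 0≤x+η 0≤y) (*-nonNeg 0≤η (p≤q⇒0≤q-p (∣∣≤⇒≤ ∣y∣≤B))))
            (*-nonNeg 0≤A 0≤η))
... | inj₂ y≤0 = subst (0ℚ ℚ.≤_)
  (solve 5 (λ x y A B η →
     ((A :- x) :* (:- y) :+ A :* (y :+ η)) :+ B :* η := x :* y :+ (A :+ B) :* η)
   refl x y A B η)
  (+-nonNeg (+-nonNeg (*-nonNeg (p≤q⇒0≤q-p (∣∣≤⇒≤ ∣x∣≤A)) (neg-nonNeg y≤0))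
                      (*-nonNeg 0≤A 0≤y+η))
            (*-nonNeg 0≤B 0≤η))

nonneg-* : ∀ {x y} → 0ℝ ≤ x → 0ℝ ≤ y → 0ℝ ≤ x * y
nonneg-* {x} {y} 0≤x 0≤y ε 0<ε =
  combine (bounded (seq x) (cauchy x)) (bounded (seq y) (cauchy y))
  where
  combine : ∃[ A ] 0ℚ ℚ.< A × (∃[ N ] ∀ n → N ℕ.≤ n → ℚ.∣ seq x n ∣ ℚ.≤ A) →
            ∃[ B ] 0ℚ ℚ.< B × (∃[ N ] ∀ n → N ℕ.≤ n → ℚ.∣ seq y n ∣ ℚ.≤ B) →
            ∃[ N ] ∀ n → N ℕ.≤ n → 0ℚ ℚ.≤ seq x n ℚ.* seq y n ℚ.+ ε
  combine (A , 0<A , boundˣ) (B , 0<B , boundʸ) = eventually₂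
    (λ n (a , b) (c , d) →
      subst (λ e → 0ℚ ℚ.≤ seq x n ℚ.* seq y n ℚ.+ e) (proj₂ (proj₂ η-scale))
        (*-almost-nonNeg {seq x n} {seq y n} {A} {B} {η}
          (ℚ.<⇒≤ 0<A) (ℚ.<⇒≤ 0<B) (ℚ.<⇒≤ 0<η) a b c d))
    (eventually-× boundˣ boundʸ)
    (eventually-× (0≤x η 0<η) (0≤y η 0<η))
    where
    η-scale = scale (+-pos 0<A 0<B) 0<ε
    η = proj₁ η-scale
    0<η = proj₁ (proj₂ η-scale)

≤⇒nonneg : ∀ {x y} → x ≤ y → 0ℝ ≤ y - x
≤⇒nonneg {x} {y} x≤y ε 0<ε = eventually
  (λ n le → subst (0ℚ ℚ.≤_)
    (solve 3 (λ x y e → (y :+ e) :- x := (y :- x) :+ e) refl (seq x n) (seq y n) ε)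
    (p≤q⇒0≤q-p le))
  (x≤y ε 0<ε)

nonneg⇒≤ : ∀ {x y} → 0ℝ ≤ y - x → x ≤ y
nonneg⇒≤ {x} {y} 0≤ ε 0<ε = eventually
  (λ n le → 0≤q-p⇒p≤q (subst (0ℚ ℚ.≤_)
    (solve 3 (λ x y e → (y :- x) :+ e := (y :+ e) :- x) refl (seq x n) (seq y n) ε) le))
  (0≤ ε 0<ε)

≤-antisym : ∀ {x y} → x ≤ y → y ≤ x → x ≈ y
≤-antisym {x} {y} x≤y y≤x ε 0<ε = eventually₂
  (λ n a b → ∣-∣-< {seq x n} {seq y n} (strict (seq x n) b) (strict (seq y n) a))
  (x≤y (½ ℚ.* ε) (half-pos 0<ε)) (y≤x (½ ℚ.* ε) (half-pos 0<ε))
  where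
  ½ε<ε : ½ ℚ.* ε ℚ.< ε
  ½ε<ε = subst (½ ℚ.* ε ℚ.<_) (halves ε)
    (subst (ℚ._< ½ ℚ.* ε ℚ.+ ½ ℚ.* ε) (ℚ.+-identityʳ _)
      (ℚ.+-monoʳ-< (½ ℚ.* ε) (half-pos 0<ε)))
  strict : ∀ {a} b → a ℚ.≤ b ℚ.+ ½ ℚ.* ε → a ℚ.< b ℚ.+ ε
  strict b le = ℚ.≤-<-trans le (ℚ.+-monoʳ-< b ½ε<ε)

≈-refl : ∀ {x} → x ≈ x
≈-refl {x} = pointwise {x} {x} (λ _ → refl)

≈⇒≤ : ∀ {x y} → x ≈ y → x ≤ y
≈⇒≤ {x} {y} x≈y ε 0<ε =
  eventually (λ n close → ℚ.<⇒≤ (proj₁ (∣-∣-<⁻¹ (seq x n) (seq y n) close))) (x≈y ε 0<ε)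

≈⇒≥ : ∀ {x y} → x ≈ y → y ≤ x
≈⇒≥ {x} {y} x≈y ε 0<ε =
  eventually (λ n close → ℚ.<⇒≤ (proj₂ (∣-∣-<⁻¹ (seq x n) (seq y n) close))) (x≈y ε 0<ε)

≈-sym : ∀ {x y} → x ≈ y → y ≈ x
≈-sym {x} {y} x≈y = ≤-antisym {y} {x} (≈⇒≥ {x} {y} x≈y) (≈⇒≤ {x} {y} x≈y)

-- Certificates: z is a combination of nonnegative reals that equals y - x by a
-- ring identity at every index.
certify : ∀ {x y z} → 0ℝ ≤ z → (∀ n → seq z n ≡ seq y n ℚ.- seq x n) → x ≤ y
certify {x} {y} {z} 0≤z eq =
  nonneg⇒≤ {x} {y} (≈-nonneg {z} {y - x} (pointwise {z} {y - x} eq) 0≤z)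

≤-trans : ∀ {x y z} → x ≤ y → y ≤ z → x ≤ z
≤-trans {x} {y} {z} x≤y y≤z = certify {x} {z} {(y - x) + (z - y)}
  (nonneg-+ {y - x} {z - y} (≤⇒nonneg {x} {y} x≤y) (≤⇒nonneg {y} {z} y≤z))
  (λ n → solve 3 (λ x y z → (y :- x) :+ (z :- y) := z :- x) refl (seq x n) (seq y n) (seq z n))

≈-trans : ∀ {x y z} → x ≈ y → y ≈ z → x ≈ z
≈-trans {x} {y} {z} x≈y y≈z = ≤-antisym {x} {z}
  (≤-trans {x} {y} {z} (≈⇒≤ {x} {y} x≈y) (≈⇒≤ {y} {z} y≈z))
  (≤-trans {z} {y} {x} (≈⇒≥ {y} {z} y≈z) (≈⇒≥ {x} {y} x≈y))

+-mono : ∀ {x y z w} → x ≤ y → z ≤ w → x + z ≤ y + w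
+-mono {x} {y} {z} {w} x≤y z≤w = certify {x + z} {y + w} {(y - x) + (w - z)}
  (nonneg-+ {y - x} {w - z} (≤⇒nonneg {x} {y} x≤y) (≤⇒nonneg {z} {w} z≤w))
  (λ n → solve 4 (λ x y z w → (y :- x) :+ (w :- z) := (y :+ w) :- (x :+ z)) refl
    (seq x n) (seq y n) (seq z n) (seq w n))

+-cong : ∀ {x y z w} → x ≈ y → z ≈ w → x + z ≈ y + w
+-cong {x} {y} {z} {w} x≈y z≈w = ≤-antisym {x + z} {y + w}
  (+-mono {x} {y} {z} {w} (≈⇒≤ {x} {y} x≈y) (≈⇒≤ {z} {w} z≈w))
  (+-mono {y} {x} {w} {z} (≈⇒≥ {x} {y} x≈y) (≈⇒≥ {z} {w} z≈w))

neg-cong : ∀ {x y} → x ≈ y → - x ≈ - y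
neg-cong {x} {y} x≈y ε 0<ε = eventually
  (λ n close → subst (ℚ._< ε)
    (sym (trans (cong ℚ.∣_∣ (neg-rearrange (seq x n) (seq y n))) (ℚ.∣-p∣≡∣p∣ (seq x n ℚ.- seq y n))))
    close)
  (x≈y ε 0<ε)

*-congˡ : ∀ w {x y} → x ≈ y → w * x ≈ w * y
*-congˡ w {x} {y} x≈y ε 0<ε = combine (bounded (seq w) (cauchy w))
  where
  combine : ∃[ M ] 0ℚ ℚ.< M × (∃[ N ] ∀ n → N ℕ.≤ n → ℚ.∣ seq w n ∣ ℚ.≤ M) →
            ∃[ N ] ∀ n → N ℕ.≤ n → ℚ.∣ seq w n ℚ.* seq x n ℚ.- seq w n ℚ.* seq y n ∣ ℚ.< ε
  combine (M , 0<M , bound) = eventually₂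
    (λ n b close → subst (ℚ._< ε)
      (cong ℚ.∣_∣ (solve 3 (λ w x y → w :* (x :- y) := w :* x :- w :* y) refl
        (seq w n) (seq x n) (seq y n)))
      (*-small (seq w n) (seq x n ℚ.- seq y n) 0<M (proj₂ (proj₂ δ-scale)) b close))
    bound (x≈y (proj₁ δ-scale) (proj₁ (proj₂ δ-scale)))
    where
    δ-scale = scale 0<M 0<ε

*-cong : ∀ {x y z w} → x ≈ y → z ≈ w → x * z ≈ y * w
*-cong {x} {y} {z} {w} x≈y z≈w =
  ≈-trans {x * z} {x * w} {y * w} (*-congˡ x {z} {w} z≈w)
    (≈-trans {x * w} {w * x} {y * w} (comm x w)
      (≈-trans {w * x} {w * y} {y * w} (*-congˡ w {x} {y} x≈y) (comm w y)))
  where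
  comm : ∀ a b → a * b ≈ b * a
  comm a b = pointwise {a * b} {b * a} (λ n → ℚ.*-comm (seq a n) (seq b n))

≈-pos : ∀ {x y} → x ≈ y → 0ℝ < x → 0ℝ < y
≈-pos {x} {y} x≈y (ε , 0<ε , ev) = ½ ℚ.* ε , half-pos 0<ε , eventually₂
  (λ n a close → 0≤q-p⇒p≤q (subst (0ℚ ℚ.≤_)
    (solve 3 (λ x y e → (x :- (con 0ℚ :+ e)) :+ ((y :+ con ½ :* e) :- x) :=
                        y :- (con 0ℚ :+ con ½ :* e)) refl (seq x n) (seq y n) ε)
    (+-nonNeg (p≤q⇒0≤q-p a) (p≤q⇒0≤q-p (ℚ.<⇒≤ (proj₁ (∣-∣-<⁻¹ (seq x n) (seq y n) close)))))))
  ev (x≈y (½ ℚ.* ε) (half-pos 0<ε))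

pos⇒nonneg : ∀ {x} → 0ℝ < x → 0ℝ ≤ x
pos⇒nonneg {x} (ε , 0<ε , N , le) δ 0<δ = N , λ n N≤n →
  +-nonNeg (ℚ.≤-trans (ℚ.≤-trans (ℚ.<⇒≤ 0<ε) (ℚ.≤-reflexive (sym (ℚ.+-identityˡ ε)))) (le n N≤n))
           (ℚ.<⇒≤ 0<δ)

pos-const : ∀ {q} → 0ℚ ℚ.< q → 0ℝ < fromℚ q
pos-const {q} 0<q = q , 0<q , 0 , λ _ _ → ℚ.≤-reflexive (ℚ.+-identityˡ q)

pos+nonneg : ∀ {x y} → 0ℝ < x → 0ℝ ≤ y → 0ℝ < x + y
pos+nonneg {x} {y} (ε , 0<ε , ev) 0≤y = ½ ℚ.* ε , half-pos 0<ε , eventually₂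
  (λ n a b → 0≤q-p⇒p≤q (subst (0ℚ ℚ.≤_)
    (solve 3 (λ x y e → (x :- (con 0ℚ :+ e)) :+ (y :+ con ½ :* e) :=
                        (x :+ y) :- (con 0ℚ :+ con ½ :* e)) refl (seq x n) (seq y n) ε)
    (+-nonNeg (p≤q⇒0≤q-p a) b)))
  ev (0≤y (½ ℚ.* ε) (half-pos 0<ε))

pos-* : ∀ {x y} → 0ℝ < x → 0ℝ < y → 0ℝ < x * y
pos-* {x} {y} (ε , 0<ε , ev) (δ , 0<δ , ev′) = ε ℚ.* δ , *-pos 0<ε 0<δ , eventually₂
  (λ n a b → subst (ℚ._≤ seq x n ℚ.* seq y n) (sym (ℚ.+-identityˡ (ε ℚ.* δ)))
    (*-mono-≤ (ℚ.<⇒≤ 0<ε) (ℚ.≤-trans (ℚ.<⇒≤ 0<δ) (drop b)) (drop a) (drop b)))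
  ev ev′
  where
  drop : ∀ {e q} → 0ℚ ℚ.+ e ℚ.≤ q → e ℚ.≤ q
  drop {e} {q} = subst (ℚ._≤ q) (ℚ.+-identityˡ e)

<⇒pos : ∀ {x y} → x < y → 0ℝ < y - x
<⇒pos {x} {y} (ε , 0<ε , ev) = ε , 0<ε , eventually
  (λ n a → 0≤q-p⇒p≤q (subst (0ℚ ℚ.≤_)
    (solve 3 (λ x y e → y :- (x :+ e) := (y :- x) :- (con 0ℚ :+ e)) refl (seq x n) (seq y n) ε)
    (p≤q⇒0≤q-p a)))
  ev

pos⇒< : ∀ {x y} → 0ℝ < y - x → x < y
pos⇒< {x} {y} (ε , 0<ε , ev) = ε , 0<ε , eventually
  (λ n a → 0≤q-p⇒p≤q (subst (0ℚ ℚ.≤_)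
    (solve 3 (λ x y e → (y :- x) :- (con 0ℚ :+ e) := y :- (x :+ e)) refl (seq x n) (seq y n) ε)
    (p≤q⇒0≤q-p a)))
  ev

-- The way in which certificates end in a contradiction: a positive real plus nonnegative ones, with
-- a sum that vanishes identically.
pos-irrefl : ∀ {x} → (∀ n → seq x n ≡ 0ℚ) → ¬ 0ℝ < x
pos-irrefl {x} x≡0 (ε , 0<ε , N , le) = ℚ.<-irrefl refl (ℚ.<-≤-trans 0<ε
  (subst₂ ℚ._≤_ (ℚ.+-identityˡ ε) (x≡0 N) (le N ℕ.≤-refl)))

-- At one index `N` beyond which the sequence varies by less than ε/2, the rational `seq x N` is
-- compared with ε/2. Either the tail stays below ε, or it stays above the positive rational
-- `seq x N` - ε/2.
¬pos⇒≤0 : ∀ {x} → ¬ 0ℝ < x → x ≤ 0ℝ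
¬pos⇒≤0 {x} ¬0<x ε 0<ε with cauchy x (½ ℚ.* ε) (half-pos 0<ε)
... | N , close with seq x N ℚ.≤? ½ ℚ.* ε
... | yes le = N , λ n N≤n → begin
    seq x n                      ≤⟨ ℚ.<⇒≤ (proj₁ (∣-∣-<⁻¹ (seq x n) (seq x N) (close n N N≤n ℕ.≤-refl))) ⟩
    seq x N ℚ.+ ½ ℚ.* ε          ≤⟨ ℚ.+-monoˡ-≤ (½ ℚ.* ε) le ⟩
    ½ ℚ.* ε ℚ.+ ½ ℚ.* ε          ≡⟨ halves ε ⟩
    ε                            ≡⟨ ℚ.+-identityˡ ε ⟨
    0ℚ ℚ.+ ε                     ∎
  where open ℚ.≤-Reasoning
... | no ≰ = ⊥-elim (¬0<x (gap , 0<gap , N , λ n N≤n → 0≤q-p⇒p≤q (subst (0ℚ ℚ.≤_)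
    (solve 3 (λ a b e → (b :+ con ½ :* e) :- a := b :- (con 0ℚ :+ (a :- con ½ :* e))) refl
      (seq x N) (seq x n) ε)
    (p≤q⇒0≤q-p (ℚ.<⇒≤ (proj₁ (∣-∣-<⁻¹ (seq x N) (seq x n) (close N n ℕ.≤-refl N≤n))))))))
  where
  gap = seq x N ℚ.- ½ ℚ.* ε
  0<gap : 0ℚ ℚ.< gap
  0<gap = subst (ℚ._< gap) (ℚ.+-inverseʳ (½ ℚ.* ε))
    (ℚ.+-monoˡ-< (ℚ.- (½ ℚ.* ε)) (ℚ.≰⇒> ≰))

-- The substitute for a comparison of reals: one approximation, accurate to half of b - a, is
-- compared with the midpoint. It selects the far point in `frank-wolfe` and the colours in
-- `window`.
≤-or-≥ : ∀ x {a b} → a ℚ.< b → x ≤ fromℚ b ⊎ fromℚ a ≤ x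
≤-or-≥ x {a} {b} a<b with cauchy x (½ ℚ.* (b ℚ.- a)) (half-pos 0<b-a)
  where
  0<b-a : 0ℚ ℚ.< b ℚ.- a
  0<b-a = subst (ℚ._< b ℚ.- a) (ℚ.+-inverseʳ a) (ℚ.+-monoˡ-< (ℚ.- a) a<b)
... | N , close with ℚ.≤-total (seq x N) (½ ℚ.* (a ℚ.+ b))
... | inj₁ le = inj₁ λ ε 0<ε → N , λ n N≤n → 0≤q-p⇒p≤q (subst (0ℚ ℚ.≤_)
    (solve 5 (λ m n a b e →
        ((con ½ :* (a :+ b) :- m) :+ ((m :+ con ½ :* (b :- a)) :- n)) :+ e := (b :+ e) :- n)
      refl (seq x N) (seq x n) a b ε)
    (+-nonNeg (+-nonNeg (p≤q⇒0≤q-p le)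
        (p≤q⇒0≤q-p (ℚ.<⇒≤ (proj₁ (∣-∣-<⁻¹ (seq x n) (seq x N) (close n N N≤n ℕ.≤-refl))))))
      (ℚ.<⇒≤ 0<ε)))
... | inj₂ ge = inj₂ λ ε 0<ε → N , λ n N≤n → 0≤q-p⇒p≤q (subst (0ℚ ℚ.≤_)
    (solve 5 (λ m n a b e →
        ((m :- con ½ :* (a :+ b)) :+ ((n :+ con ½ :* (b :- a)) :- m)) :+ e := (n :+ e) :- a)
      refl (seq x N) (seq x n) a b ε)
    (+-nonNeg (+-nonNeg (p≤q⇒0≤q-p ge)
        (p≤q⇒0≤q-p (ℚ.<⇒≤ (proj₁ (∣-∣-<⁻¹ (seq x N) (seq x n) (close N n ℕ.≤-refl N≤n))))))
      (ℚ.<⇒≤ 0<ε)))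

upper-bound : ∀ x → ∃[ M ] 0ℚ ℚ.< M × x ≤ fromℚ M
upper-bound x = combine (bounded (seq x) (cauchy x))
  where
  combine : ∃[ M ] 0ℚ ℚ.< M × (∃[ N ] ∀ n → N ℕ.≤ n → ℚ.∣ seq x n ∣ ℚ.≤ M) →
            ∃[ M ] 0ℚ ℚ.< M × x ≤ fromℚ M
  combine (M , 0<M , bound) = M , 0<M , λ ε 0<ε → eventually
    (λ n b → ℚ.≤-trans (∣∣≤⇒≤ b) (≤-by-pos (ℚ.<⇒≤ 0<ε))) bound

-- The cosine series

-- The coefficients of a product of power series; splitting off `f 0` replaces the index n - i by
-- structural recursion.
conv : (ℕ → ℚ) → (ℕ → ℚ) → ℕ → ℚ
conv f g zero    = f 0 ℚ.* g 0
conv f g (suc n) = f 0 ℚ.* g (suc n) ℚ.+ conv (f ∘ suc) g n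

conv-cong : ∀ {f f′ g g′} → (∀ i → f i ≡ f′ i) → (∀ i → g i ≡ g′ i) →
            ∀ n → conv f g n ≡ conv f′ g′ n
conv-cong f≡ g≡ zero    = cong₂ ℚ._*_ (f≡ 0) (g≡ 0)
conv-cong f≡ g≡ (suc n) = cong₂ ℚ._+_ (cong₂ ℚ._*_ (f≡ 0) (g≡ (suc n)))
                                      (conv-cong (f≡ ∘ suc) g≡ n)

conv-+ˡ : ∀ f f′ g n →
  conv (λ i → f i ℚ.+ f′ i) g n ≡ conv f g n ℚ.+ conv f′ g n
conv-+ˡ f f′ g zero    = ℚ.*-distribʳ-+ (g 0) (f 0) (f′ 0)
conv-+ˡ f f′ g (suc n) = trans
  (cong ((f 0 ℚ.+ f′ 0) ℚ.* g (suc n) ℚ.+_) (conv-+ˡ (f ∘ suc) (f′ ∘ suc) g n))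
  (solve 5 (λ a b c d e → (a :+ b) :* c :+ (d :+ e) := (a :* c :+ d) :+ (b :* c :+ e)) refl
    (f 0) (f′ 0) (g (suc n)) (conv (f ∘ suc) g n) (conv (f′ ∘ suc) g n))

conv-*ˡ : ∀ c f g n → conv (λ i → c ℚ.* f i) g n ≡ c ℚ.* conv f g n
conv-*ˡ c f g zero    = ℚ.*-assoc c (f 0) (g 0)
conv-*ˡ c f g (suc n) = trans
  (cong ((c ℚ.* f 0) ℚ.* g (suc n) ℚ.+_) (conv-*ˡ c (f ∘ suc) g n))
  (solve 4 (λ c a b d → (c :* a) :* b :+ c :* d := c :* (a :* b :+ d)) refl
    c (f 0) (g (suc n)) (conv (f ∘ suc) g n))

conv-+ʳ : ∀ f g g′ n →
  conv f (λ i → g i ℚ.+ g′ i) n ≡ conv f g n ℚ.+ conv f g′ n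
conv-+ʳ f g g′ zero    = ℚ.*-distribˡ-+ (f 0) (g 0) (g′ 0)
conv-+ʳ f g g′ (suc n) = trans
  (cong (f 0 ℚ.* (g (suc n) ℚ.+ g′ (suc n)) ℚ.+_) (conv-+ʳ (f ∘ suc) g g′ n))
  (solve 5 (λ a b c d e → a :* (b :+ c) :+ (d :+ e) := (a :* b :+ d) :+ (a :* c :+ e)) refl
    (f 0) (g (suc n)) (g′ (suc n)) (conv (f ∘ suc) g n) (conv (f ∘ suc) g′ n))

conv-*ʳ : ∀ c f g n → conv f (λ i → c ℚ.* g i) n ≡ c ℚ.* conv f g n
conv-*ʳ c f g zero    = solve 3 (λ c a b → a :* (c :* b) := c :* (a :* b)) refl c (f 0) (g 0)
conv-*ʳ c f g (suc n) = trans
  (cong (f 0 ℚ.* (c ℚ.* g (suc n)) ℚ.+_) (conv-*ʳ c (f ∘ suc) g n))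
  (solve 4 (λ c a b d → a :* (c :* b) :+ c :* d := c :* (a :* b :+ d)) refl
    c (f 0) (g (suc n)) (conv (f ∘ suc) g n))

conv-shiftˡ : ∀ f g n → f 0 ≡ 0ℚ → conv f g (suc n) ≡ conv (f ∘ suc) g n
conv-shiftˡ f g n f0≡0 = trans
  (cong (λ z → z ℚ.* g (suc n) ℚ.+ conv (f ∘ suc) g n) f0≡0)
  (solve 2 (λ a b → con 0ℚ :* a :+ b := b) refl (g (suc n)) (conv (f ∘ suc) g n))

conv-shiftʳ : ∀ f g n → g 0 ≡ 0ℚ → conv f g (suc n) ≡ conv f (g ∘ suc) n
conv-shiftʳ f g zero    g0≡0 = trans
  (cong (λ z → f 0 ℚ.* g 1 ℚ.+ f 1 ℚ.* z) g0≡0)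
  (solve 2 (λ a b → a :+ b :* con 0ℚ := a) refl (f 0 ℚ.* g 1) (f 1))
conv-shiftʳ f g (suc n) g0≡0 =
  cong (f 0 ℚ.* g (suc (suc n)) ℚ.+_) (conv-shiftʳ (f ∘ suc) g n g0≡0)

ι : ℕ → ℚ
ι zero    = 0ℚ
ι (suc n) = 1ℚ ℚ.+ ι n

-- The Leibniz rule for f ↦ (i f(i))ᵢ, the Euler operator on power series.
leibniz : ∀ f g n → ι n ℚ.* conv f g n ≡
  conv (λ i → ι i ℚ.* f i) g n ℚ.+ conv f (λ i → ι i ℚ.* g i) n
leibniz f g zero    = solve 2 (λ a b →
  con 0ℚ :* (a :* b) := (con 0ℚ :* a) :* b :+ a :* (con 0ℚ :* b)) refl (f 0) (g 0)
leibniz f g (suc n) = begin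
  (1ℚ ℚ.+ m) ℚ.* (a ℚ.* b ℚ.+ c)
    ≡⟨ solve 4 (λ m a b c → (con 1ℚ :+ m) :* (a :* b :+ c) :=
                 (m :* c :+ c) :+ a :* ((con 1ℚ :+ m) :* b)) refl m a b c ⟩
  (m ℚ.* c ℚ.+ c) ℚ.+ ab′
    ≡⟨ cong (λ z → (z ℚ.+ c) ℚ.+ ab′) (leibniz (f ∘ suc) g n) ⟩
  ((d ℚ.+ e) ℚ.+ c) ℚ.+ ab′
    ≡⟨ solve 4 (λ d e c h → ((d :+ e) :+ c) :+ h := (d :+ c) :+ (h :+ e)) refl d e c ab′ ⟩
  (d ℚ.+ c) ℚ.+ (ab′ ℚ.+ e)
    ≡⟨ cong (ℚ._+ (ab′ ℚ.+ e)) (trans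
         (sym (conv-+ˡ (λ i → ι i ℚ.* f (suc i)) (f ∘ suc) g n))
         (conv-cong (λ i → solve 2 (λ m x → m :* x :+ x := (con 1ℚ :+ m) :* x) refl
                             (ι i) (f (suc i))) (λ _ → refl) n)) ⟩
  conv (λ i → ι (suc i) ℚ.* f (suc i)) g n ℚ.+ (ab′ ℚ.+ e)
    ≡⟨ cong (ℚ._+ (ab′ ℚ.+ e)) (sym (conv-shiftˡ (λ i → ι i ℚ.* f i) g n (ℚ.*-zeroˡ a))) ⟩
  conv (λ i → ι i ℚ.* f i) g (suc n) ℚ.+ (ab′ ℚ.+ e) ∎
  where
  open ≡-Reasoning
  m = ι n
  a = f 0
  b = g (suc n)
  c = conv (f ∘ suc) g n
  d = conv (λ i → ι i ℚ.* f (suc i)) g n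
  e = conv (f ∘ suc) (λ i → ι i ℚ.* g i) n
  ab′ = a ℚ.* ((1ℚ ℚ.+ m) ℚ.* b)

inv : ℕ → ℚ
inv n = + 1 / suc n

ι-inv : ∀ n → ι (suc n) ℚ.* inv n ≡ 1ℚ
ι-inv n = trans (sym (multiple (suc n))) one
  where
  multiple : ∀ k → + k / suc n ≡ ι k ℚ.* inv n
  multiple zero    = trans (ℚ.0/n≡0 (suc n)) (sym (ℚ.*-zeroˡ (inv n)))
  multiple (suc k) = trans (/-suc n k) (trans (cong (ℚ._+ inv n) (multiple k))
    (solve 2 (λ a b → a :* b :+ b := (con 1ℚ :+ a) :* b) refl (ι k) (inv n)))
  one : + suc n / suc n ≡ 1ℚ
  one = ℚ.fromℚᵘ-cong {ℚᵘ.mkℚᵘ (+ suc n) n} {ℚᵘ.mkℚᵘ (+ 1) 0} (ℚᵘ.*≡* (ℤ.*-comm (+ suc n) (+ 1)))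

-- xⁿ / n!
γ : ℚ → ℕ → ℚ
γ x zero    = 1ℚ
γ x (suc n) = (x ℚ.* γ x n) ℚ.* inv n

γ-suc : ∀ x n → ι (suc n) ℚ.* γ x (suc n) ≡ x ℚ.* γ x n
γ-suc x n = trans
  (solve 3 (λ m a i → m :* (a :* i) := (m :* i) :* a) refl (ι (suc n)) (x ℚ.* γ x n) (inv n))
  (trans (cong (ℚ._* (x ℚ.* γ x n)) (ι-inv n)) (ℚ.*-identityˡ (x ℚ.* γ x n)))

-- The binomial theorem without binomial coefficients: by `leibniz` and `γ-suc`, both sides satisfy
-- (n + 1) a(n + 1) = (x + y) a(n).
γ-+ : ∀ x y n → γ (x ℚ.+ y) n ≡ conv (γ x) (γ y) n
γ-+ x y zero    = refl
γ-+ x y (suc n) = begin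
  ((x ℚ.+ y) ℚ.* γ (x ℚ.+ y) n) ℚ.* i
    ≡⟨ cong (λ z → ((x ℚ.+ y) ℚ.* z) ℚ.* i) (γ-+ x y n) ⟩
  ((x ℚ.+ y) ℚ.* c) ℚ.* i
    ≡⟨ cong (ℚ._* i) (ℚ.*-distribʳ-+ c x y) ⟩
  (x ℚ.* c ℚ.+ y ℚ.* c) ℚ.* i
    ≡⟨ cong (ℚ._* i) (sym (cong₂ ℚ._+_ left right)) ⟩
  (conv (λ i → ι i ℚ.* γ x i) (γ y) (suc n) ℚ.+ conv (γ x) (λ i → ι i ℚ.* γ y i) (suc n)) ℚ.* i
    ≡⟨ cong (ℚ._* i) (sym (leibniz (γ x) (γ y) (suc n))) ⟩
  (ι (suc n) ℚ.* s) ℚ.* i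
    ≡⟨ solve 3 (λ m s i → (m :* s) :* i := (m :* i) :* s) refl (ι (suc n)) s i ⟩
  (ι (suc n) ℚ.* i) ℚ.* s
    ≡⟨ cong (ℚ._* s) (ι-inv n) ⟩
  1ℚ ℚ.* s
    ≡⟨ ℚ.*-identityˡ s ⟩
  s ∎
  where
  open ≡-Reasoning
  i = inv n
  c = conv (γ x) (γ y) n
  s = conv (γ x) (γ y) (suc n)
  left : conv (λ i → ι i ℚ.* γ x i) (γ y) (suc n) ≡ x ℚ.* c
  left = trans (conv-shiftˡ (λ i → ι i ℚ.* γ x i) (γ y) n refl)
    (trans (conv-cong (γ-suc x) (λ _ → refl) n) (conv-*ˡ x (γ x) (γ y) n))
  right : conv (γ x) (λ i → ι i ℚ.* γ y i) (suc n) ≡ y ℚ.* c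
  right = trans (conv-shiftʳ (γ x) (λ i → ι i ℚ.* γ y i) n refl)
    (trans (conv-cong {γ x} (λ _ → refl) (γ-suc y) n) (conv-*ʳ y (γ x) (γ y) n))

-- Even powers, signs, and the product formula for the cosine terms

dbl : ℕ → ℕ
dbl zero    = zero
dbl (suc n) = suc (suc (dbl n))

dbl≡2* : ∀ n → dbl n ≡ 2 ℕ.* n
dbl≡2* zero    = refl
dbl≡2* (suc n) = cong suc (trans (cong suc (dbl≡2* n)) (sym (ℕ.+-suc n (n ℕ.+ 0))))

-- At the even index 2n, an odd index of `f` is paired with an odd index of `h`, where `h` vanishes.
conv-even : ∀ f h → (∀ j → h (suc (dbl j)) ≡ 0ℚ) →
  ∀ n → conv f h (dbl n) ≡ conv (f ∘ dbl) (h ∘ dbl) n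
conv-even f h odd zero    = refl
conv-even f h odd (suc n) = cong (f 0 ℚ.* h (dbl (suc n)) ℚ.+_) (begin
  f 1 ℚ.* h (suc (dbl n)) ℚ.+ c   ≡⟨ cong (λ z → f 1 ℚ.* z ℚ.+ c) (odd n) ⟩
  f 1 ℚ.* 0ℚ ℚ.+ c                ≡⟨ solve 2 (λ a c → a :* con 0ℚ :+ c := c) refl (f 1) c ⟩
  c                               ≡⟨ conv-even (λ i → f (suc (suc i))) h odd n ⟩
  conv (λ i → f (suc (suc (dbl i)))) (h ∘ dbl) n ∎)
  where
  open ≡-Reasoning
  c = conv (λ i → f (suc (suc i))) h (dbl n)

γ-neg-even : ∀ y j → γ (ℚ.- y) (dbl j) ≡ γ y (dbl j)
γ-neg-odd  : ∀ y j → γ (ℚ.- y) (suc (dbl j)) ≡ ℚ.- γ y (suc (dbl j))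
γ-neg-even y zero    = refl
γ-neg-even y (suc j) = trans
  (cong (λ z → (ℚ.- y ℚ.* z) ℚ.* inv (suc (dbl j))) (γ-neg-odd y j))
  (solve 3 (λ y z i → (:- y :* :- z) :* i := (y :* z) :* i) refl
    y (γ y (suc (dbl j))) (inv (suc (dbl j))))
γ-neg-odd y j = trans
  (cong (λ z → (ℚ.- y ℚ.* z) ℚ.* inv (dbl j)) (γ-neg-even y j))
  (solve 3 (λ y z i → (:- y :* z) :* i := :- ((y :* z) :* i)) refl
    y (γ y (dbl j)) (inv (dbl j)))

sgn : ℕ → ℚ
sgn zero    = 1ℚ
sgn (suc n) = ℚ.- sgn n

conv-sgn : ∀ f g n →
  conv (λ i → sgn i ℚ.* f i) (λ i → sgn i ℚ.* g i) n ≡ sgn n ℚ.* conv f g n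
conv-sgn f g zero    = solve 2 (λ a b →
  (con 1ℚ :* a) :* (con 1ℚ :* b) := con 1ℚ :* (a :* b)) refl (f 0) (g 0)
conv-sgn f g (suc n) = begin
  a′b′ ℚ.+ conv (λ i → sgn (suc i) ℚ.* f (suc i)) sg n
    ≡⟨ cong (a′b′ ℚ.+_) (trans
         (conv-cong (λ i → solve 2 (λ s x → :- s :* x := con (ℚ.- 1ℚ) :* (s :* x)) refl
                             (sgn i) (f (suc i))) (λ _ → refl) n)
         (conv-*ˡ (ℚ.- 1ℚ) (λ i → sgn i ℚ.* f (suc i)) sg n)) ⟩
  a′b′ ℚ.+ ℚ.- 1ℚ ℚ.* conv (λ i → sgn i ℚ.* f (suc i)) sg n
    ≡⟨ cong (λ z → a′b′ ℚ.+ ℚ.- 1ℚ ℚ.* z) (conv-sgn (f ∘ suc) g n) ⟩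
  a′b′ ℚ.+ ℚ.- 1ℚ ℚ.* (sgn n ℚ.* conv (f ∘ suc) g n)
    ≡⟨ solve 4 (λ s a b c → (con 1ℚ :* a) :* (:- s :* b) :+ con (ℚ.- 1ℚ) :* (s :* c) :=
                 :- s :* (a :* b :+ c)) refl (sgn n) (f 0) (g (suc n)) (conv (f ∘ suc) g n) ⟩
  sgn (suc n) ℚ.* (f 0 ℚ.* g (suc n) ℚ.+ conv (f ∘ suc) g n) ∎
  where
  open ≡-Reasoning
  sg = λ i → sgn i ℚ.* g i
  a′b′ = (1ℚ ℚ.* f 0) ℚ.* (ℚ.- sgn n ℚ.* g (suc n))

-- The terms of the cosine series, on ℚ.
τ : ℚ → ℕ → ℚ
τ x n = sgn n ℚ.* γ x (dbl n)

-- Adding the expansions for y and -y cancels the odd powers of y and doubles the even ones, so the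
-- sine series never appears.
τ-product : ∀ x y n →
  τ (x ℚ.+ y) n ℚ.+ τ (x ℚ.- y) n ≡ (1ℚ ℚ.+ 1ℚ) ℚ.* conv (τ x) (τ y) n
τ-product x y n = begin
  s ℚ.* γ (x ℚ.+ y) (dbl n) ℚ.+ s ℚ.* γ (x ℚ.- y) (dbl n)
    ≡⟨ cong₂ (λ a b → s ℚ.* a ℚ.+ s ℚ.* b) (γ-+ x y (dbl n)) (γ-+ x (ℚ.- y) (dbl n)) ⟩
  s ℚ.* conv (γ x) (γ y) (dbl n) ℚ.+ s ℚ.* conv (γ x) (γ (ℚ.- y)) (dbl n)
    ≡⟨ sym (ℚ.*-distribˡ-+ s _ _) ⟩
  s ℚ.* (conv (γ x) (γ y) (dbl n) ℚ.+ conv (γ x) (γ (ℚ.- y)) (dbl n))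
    ≡⟨ cong (s ℚ.*_) (sym (conv-+ʳ (γ x) (γ y) (γ (ℚ.- y)) (dbl n))) ⟩
  s ℚ.* conv (γ x) h (dbl n)
    ≡⟨ cong (s ℚ.*_) (conv-even (γ x) h
         (λ j → trans (cong (γ y (suc (dbl j)) ℚ.+_) (γ-neg-odd y j))
                      (ℚ.+-inverseʳ (γ y (suc (dbl j))))) n) ⟩
  s ℚ.* conv (γ x ∘ dbl) (h ∘ dbl) n
    ≡⟨ cong (s ℚ.*_) (trans
         (conv-cong {γ x ∘ dbl} (λ _ → refl) (λ j → trans (cong (γ y (dbl j) ℚ.+_) (γ-neg-even y j))
           (solve 1 (λ z → z :+ z := con (1ℚ ℚ.+ 1ℚ) :* z) refl (γ y (dbl j)))) n)
         (conv-*ʳ (1ℚ ℚ.+ 1ℚ) (γ x ∘ dbl) (γ y ∘ dbl) n)) ⟩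
  s ℚ.* ((1ℚ ℚ.+ 1ℚ) ℚ.* c)
    ≡⟨ solve 2 (λ s c → s :* (con (1ℚ ℚ.+ 1ℚ) :* c) := con (1ℚ ℚ.+ 1ℚ) :* (s :* c)) refl s c ⟩
  (1ℚ ℚ.+ 1ℚ) ℚ.* (s ℚ.* c)
    ≡⟨ cong ((1ℚ ℚ.+ 1ℚ) ℚ.*_) (sym (conv-sgn (γ x ∘ dbl) (γ y ∘ dbl) n)) ⟩
  (1ℚ ℚ.+ 1ℚ) ℚ.* conv (τ x) (τ y) n ∎
  where
  open ≡-Reasoning
  s = sgn n
  h = λ j → γ y j ℚ.+ γ (ℚ.- y) j
  c = conv (γ x ∘ dbl) (γ y ∘ dbl) n

-- Comparison of `τ` with the factorial form of the cosine terms

/-* : ∀ a b m n → (a ℤ.* b) / (suc m ℕ.* suc n) ≡ (a / suc m) ℚ.* (b / suc n)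
/-* a b m n = ℚ.toℚᵘ-injective (begin
  ℚ.toℚᵘ ((a ℤ.* b) / (suc m ℕ.* suc n))            ≈⟨ ℚ.toℚᵘ-fromℚᵘ (p ℚᵘ.* q) ⟩
  p ℚᵘ.* q                                          ≈⟨ ℚᵘ.*-cong (ℚ.toℚᵘ-fromℚᵘ p) (ℚ.toℚᵘ-fromℚᵘ q) ⟨
  ℚ.toℚᵘ (a / suc m) ℚᵘ.* ℚ.toℚᵘ (b / suc n)        ≈⟨ ℚ.toℚᵘ-homo-* (a / suc m) (b / suc n) ⟨
  ℚ.toℚᵘ ((a / suc m) ℚ.* (b / suc n))              ∎)
  where
  open ℚᵘ.≃-Reasoning
  p = ℚᵘ.mkℚᵘ a m
  q = ℚᵘ.mkℚᵘ b n

1/-* : ∀ m n .{{_ : ℕ.NonZero m}} .{{_ : ℕ.NonZero n}} .{{_ : ℕ.NonZero (m ℕ.* n)}} →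
       + 1 / (m ℕ.* n) ≡ (+ 1 / m) ℚ.* (+ 1 / n)
1/-* (suc m) (suc n) = /-* (+ 1) (+ 1) m n

sgn-/ : ∀ k n .{{_ : ℕ.NonZero n}} → ((ℤ.- ℤ.1ℤ) ℤ.^ k / n) ≡ sgn k ℚ.* (+ 1 / n)
sgn-/ k (suc n) = trans
  (ℚ./-cong {q₂ = 1 ℕ.* suc n} (sym (ℤ.*-identityʳ ((ℤ.- ℤ.1ℤ) ℤ.^ k))) (sym (ℕ.*-identityˡ (suc n))))
  (trans (/-* ((ℤ.- ℤ.1ℤ) ℤ.^ k) (+ 1) 0 n) (cong (ℚ._* (+ 1 / suc n)) (integral k)))
  where
  integral : ∀ k → (ℤ.- ℤ.1ℤ) ℤ.^ k / 1 ≡ sgn k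
  integral zero    = refl
  integral (suc k) = trans (/-* (ℤ.- ℤ.1ℤ) ((ℤ.- ℤ.1ℤ) ℤ.^ k) 0 0)
    (trans (cong ((ℤ.- ℤ.1ℤ / 1) ℚ.*_) (integral k))
           (solve 1 (λ s → con (ℤ.- ℤ.1ℤ / 1) :* s := :- s) refl (sgn k)))

power-γ : ∀ x j n → seq (x ^ j) n ℚ.* ((+ 1 / (j !)) {{j ℕ.!≢0}}) ≡ γ (seq x n) j
power-γ x zero    n = refl
power-γ x (suc j) n = begin
  (a ℚ.* b) ℚ.* ((+ 1 / (suc j !)) {{suc j ℕ.!≢0}})
    ≡⟨ cong ((a ℚ.* b) ℚ.*_) (1/-* (suc j) (j !) {{_}} {{j ℕ.!≢0}} {{suc j ℕ.!≢0}}) ⟩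
  (a ℚ.* b) ℚ.* (inv j ℚ.* f)
    ≡⟨ solve 4 (λ a b i f → (a :* b) :* (i :* f) := (a :* (b :* f)) :* i) refl a b (inv j) f ⟩
  (a ℚ.* (b ℚ.* f)) ℚ.* inv j
    ≡⟨ cong (λ z → (a ℚ.* z) ℚ.* inv j) (power-γ x j n) ⟩
  γ a (suc j) ∎
  where
  open ≡-Reasoning
  a = seq x n
  b = seq (x ^ j) n
  f = (+ 1 / (j !)) {{j ℕ.!≢0}}

cosTerm-τ : ∀ x k n → seq (cosTerm x k) n ≡ τ (seq x n) k
cosTerm-τ x k n = begin
  ((ℤ.- ℤ.1ℤ) ℤ.^ k / (2 ℕ.* k) !) {{(2 ℕ.* k) ℕ.!≢0}} ℚ.* b
    ≡⟨ cong (ℚ._* b) (sgn-/ k ((2 ℕ.* k) !) {{(2 ℕ.* k) ℕ.!≢0}}) ⟩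
  (sgn k ℚ.* f) ℚ.* b
    ≡⟨ solve 3 (λ s f b → (s :* f) :* b := s :* (b :* f)) refl (sgn k) f b ⟩
  sgn k ℚ.* (b ℚ.* f)
    ≡⟨ cong (sgn k ℚ.*_) (power-γ x (2 ℕ.* k) n) ⟩
  sgn k ℚ.* γ (seq x n) (2 ℕ.* k)
    ≡⟨ cong (λ j → sgn k ℚ.* γ (seq x n) j) (sym (dbl≡2* k)) ⟩
  τ (seq x n) k ∎
  where
  open ≡-Reasoning
  b = seq (x ^ (2 ℕ.* k)) n
  f = (+ 1 / ((2 ℕ.* k) !)) {{(2 ℕ.* k) ℕ.!≢0}}

-- Partial sums, geometric bounds, and the error of a Cauchy product

sum : (ℕ → ℚ) → ℕ → ℚ
sum f zero    = 0ℚ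
sum f (suc n) = sum f n ℚ.+ f n

partialSum-τ : ∀ x K n → seq (partialSum (cosTerm x) K) n ≡ sum (τ (seq x n)) K
partialSum-τ x zero    n = refl
partialSum-τ x (suc K) n = cong₂ ℚ._+_ (partialSum-τ x K n) (cosTerm-τ x K n)

sum-head : ∀ f n → sum f (suc n) ≡ f 0 ℚ.+ sum (f ∘ suc) n
sum-head f zero    = ℚ.+-comm 0ℚ (f 0)
sum-head f (suc n) = trans (cong (ℚ._+ f (suc n)) (sum-head f n))
  (ℚ.+-assoc (f 0) (sum (f ∘ suc) n) (f (suc n)))

sum-cong : ∀ {f g} → (∀ i → f i ≡ g i) → ∀ n → sum f n ≡ sum g n
sum-cong f≡g zero    = refl
sum-cong f≡g (suc n) = cong₂ ℚ._+_ (sum-cong f≡g n) (f≡g n)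

sum-+ : ∀ f g n → sum (λ i → f i ℚ.+ g i) n ≡ sum f n ℚ.+ sum g n
sum-+ f g zero    = refl
sum-+ f g (suc n) = trans (cong (ℚ._+ (f n ℚ.+ g n)) (sum-+ f g n))
  (solve 4 (λ a b c d → (a :+ b) :+ (c :+ d) := (a :+ c) :+ (b :+ d)) refl
    (sum f n) (sum g n) (f n) (g n))

sum-* : ∀ c f n → sum (λ i → c ℚ.* f i) n ≡ c ℚ.* sum f n
sum-* c f zero    = sym (ℚ.*-zeroʳ c)
sum-* c f (suc n) = trans (cong (ℚ._+ c ℚ.* f n) (sum-* c f n))
  (sym (ℚ.*-distribˡ-+ c (sum f n) (f n)))

sum-conv : ∀ f g n → sum (conv f g) (suc n) ≡
  f 0 ℚ.* sum g (suc n) ℚ.+ sum (conv (f ∘ suc) g) n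
sum-conv f g zero    = solve 2 (λ a b →
  con 0ℚ :+ a :* b := a :* (con 0ℚ :+ b) :+ con 0ℚ) refl (f 0) (g 0)
sum-conv f g (suc n) = trans
  (cong (ℚ._+ conv f g (suc n)) (sum-conv f g n))
  (solve 5 (λ a s r b c → (a :* s :+ r) :+ (a :* b :+ c) := a :* (s :+ b) :+ (r :+ c)) refl
    (f 0) (sum g (suc n)) (sum (conv (f ∘ suc) g) n) (g (suc n)) (conv (f ∘ suc) g n))

2⁻ : ℕ → ℚ
2⁻ zero    = 1ℚ
2⁻ (suc n) = ½ ℚ.* 2⁻ n

0≤½ : 0ℚ ℚ.≤ ½
0≤½ = ℚ.nonNegative⁻¹ ½

0≤2⁻ : ∀ n → 0ℚ ℚ.≤ 2⁻ n
0≤2⁻ zero    = ℚ.nonNegative⁻¹ 1ℚ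
0≤2⁻ (suc n) = *-nonNeg 0≤½ (0≤2⁻ n)

2⁻≤1 : ∀ n → 2⁻ n ℚ.≤ 1ℚ
2⁻≤1 zero    = ℚ.≤-refl
2⁻≤1 (suc n) = *-mono-≤ {½} {1ℚ} 0≤½ (ℚ.nonNegative⁻¹ 1ℚ) (ℚ.≤ᵇ⇒≤ _) (2⁻≤1 n)

2⁻-dbl : ∀ n → 2⁻ (dbl n) ≡ 2⁻ n ℚ.* 2⁻ n
2⁻-dbl zero    = refl
2⁻-dbl (suc n) = trans (cong (λ z → ½ ℚ.* (½ ℚ.* z)) (2⁻-dbl n))
  (solve 1 (λ a → con ½ :* (con ½ :* (a :* a)) := (con ½ :* a) :* (con ½ :* a)) refl (2⁻ n))

inv-mono : ∀ n → ½ ℚ.* inv n ℚ.≤ inv (suc n)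
inv-mono n = subst₂ ℚ._≤_ refl one-half
  (ℚ.*-monoˡ-≤-nonNeg ½ (p+p≤ n))
  where
  i = inv (suc n)
  1≤ι : ∀ n → 1ℚ ℚ.≤ ι (suc n)
  1≤ι zero    = ℚ.≤-refl
  1≤ι (suc n) = ℚ.≤-trans (1≤ι n) (subst (ℚ._≤ ι (suc (suc n))) (ℚ.+-identityˡ (ι (suc n)))
    (ℚ.+-monoˡ-≤ (ι (suc n)) (ℚ.nonNegative⁻¹ 1ℚ)))
  p+p≤ : ∀ n → inv n ℚ.≤ inv (suc n) ℚ.+ inv (suc n)
  -- With m = n + 1, a = 1/m and b = 1/(m + 1), the nonnegative number (m - 1) a b equals 2 (m a) b
  -- - a ((m + 1) b) = 2 b - a.
  p+p≤ n = 0≤q-p⇒p≤q (subst (0ℚ ℚ.≤_)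
    (trans (solve 3 (λ m a b → (m :- con 1ℚ) :* (a :* b) :=
                       (m :* a) :* b :+ b :* ((m :* a)) :- a :* ((con 1ℚ :+ m) :* b))
              refl (ι (suc n)) (inv n) (inv (suc n)))
      (trans (cong₂ (λ y z → y ℚ.* inv (suc n) ℚ.+ inv (suc n) ℚ.* y ℚ.- inv n ℚ.* z)
                (ι-inv n) (ι-inv (suc n)))
             (solve 2 (λ a b → con 1ℚ :* b :+ b :* con 1ℚ :- a :* con 1ℚ := (b :+ b) :- a) refl
               (inv n) (inv (suc n)))))
    (*-nonNeg (p≤q⇒0≤q-p (1≤ι n)) (*-nonNeg (/-nonNeg n 1) (/-nonNeg (suc n) 1))))
  one-half : ½ ℚ.* (i ℚ.+ i) ≡ i
  one-half = solve 1 (λ i → con ½ :* (i :+ i) := i) refl i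

2⁻≤inv : ∀ n → 2⁻ n ℚ.≤ inv n
2⁻≤inv zero    = ℚ.≤-refl
2⁻≤inv (suc n) = ℚ.≤-trans (ℚ.*-monoˡ-≤-nonNeg ½ (2⁻≤inv n)) (inv-mono n)

2⁻-vanishes : ∀ {A ε} → 0ℚ ℚ.< A → 0ℚ ℚ.< ε → ∃[ N ] ∀ n → N ℕ.≤ n → A ℚ.* 2⁻ n ℚ.< ε
2⁻-vanishes {A} {ε} 0<A 0<ε = eventually
  (λ n small → subst (A ℚ.* 2⁻ n ℚ.<_) (proj₂ (proj₂ δ-scale))
    (ℚ.*-monoʳ-<-pos A {{ℚ.positive 0<A}} (ℚ.≤-<-trans (2⁻≤inv n) small)))
  (archimedean (proj₁ δ-scale) (proj₁ (proj₂ δ-scale)))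
  where δ-scale = scale 0<A 0<ε

∣+∣-mono : ∀ {p q a b} → ℚ.∣ p ∣ ℚ.≤ a → ℚ.∣ q ∣ ℚ.≤ b → ℚ.∣ p ℚ.+ q ∣ ℚ.≤ a ℚ.+ b
∣+∣-mono {p} {q} p≤a q≤b = ℚ.≤-trans (ℚ.∣p+q∣≤∣p∣+∣q∣ p q) (ℚ.+-mono-≤ p≤a q≤b)

∣*∣-mono : ∀ {p q a b} → ℚ.∣ p ∣ ℚ.≤ a → ℚ.∣ q ∣ ℚ.≤ b → ℚ.∣ p ℚ.* q ∣ ℚ.≤ a ℚ.* b
∣*∣-mono {p} {q} {a} {b} p≤a q≤b = subst (ℚ._≤ a ℚ.* b) (sym (ℚ.∣p*q∣≡∣p∣*∣q∣ p q))
  (*-mono-≤ (ℚ.0≤∣p∣ p) (ℚ.≤-trans (ℚ.0≤∣p∣ q) q≤b) p≤a q≤b)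

sum-tail : ∀ {f A} → (∀ i → ℚ.∣ f i ∣ ℚ.≤ A ℚ.* 2⁻ i) → 0ℚ ℚ.≤ A →
  ∀ m n → m ℕ.≤ n → ℚ.∣ sum f n ℚ.- sum f m ∣ ℚ.≤ (A ℚ.+ A) ℚ.* 2⁻ m
sum-tail {f} {A} bound 0≤A m n m≤n =
  subst (λ n → ℚ.∣ sum f n ℚ.- sum f m ∣ ℚ.≤ (A ℚ.+ A) ℚ.* 2⁻ m) (ℕ.m∸n+n≡m m≤n)
    (ℚ.≤-trans (sharp (n ℕ.∸ m)) (0≤q-p⇒p≤q (subst (0ℚ ℚ.≤_)
      (solve 2 (λ a b → b := a :- (a :- b)) refl
        ((A ℚ.+ A) ℚ.* 2⁻ m) ((A ℚ.+ A) ℚ.* 2⁻ ((n ℕ.∸ m) ℕ.+ m)))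
      (*-nonNeg (+-nonNeg 0≤A 0≤A) (0≤2⁻ ((n ℕ.∸ m) ℕ.+ m))))))
  where
  -- The subtracted term makes the induction close: the next summand is at most A 2^-(j+m), which is
  -- exactly the decrease of 2A 2^-(j+m) from j to j + 1.
  sharp : ∀ j → ℚ.∣ sum f (j ℕ.+ m) ℚ.- sum f m ∣ ℚ.≤
                (A ℚ.+ A) ℚ.* 2⁻ m ℚ.- (A ℚ.+ A) ℚ.* 2⁻ (j ℕ.+ m)
  sharp zero = ℚ.≤-reflexive (trans (cong ℚ.∣_∣ (ℚ.+-inverseʳ (sum f m)))
    (sym (ℚ.+-inverseʳ ((A ℚ.+ A) ℚ.* 2⁻ m))))
  sharp (suc j) = subst₂ ℚ._≤_
    (cong ℚ.∣_∣ (solve 3 (λ s t a → (s :- t) :+ a := (s :+ a) :- t) refl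
      (sum f (j ℕ.+ m)) (sum f m) (f (j ℕ.+ m))))
    (solve 3 (λ A p q → ((A :+ A) :* p :- (A :+ A) :* q) :+ A :* q :=
                        (A :+ A) :* p :- (A :+ A) :* (con ½ :* q)) refl A (2⁻ m) (2⁻ (j ℕ.+ m)))
    (∣+∣-mono {sum f (j ℕ.+ m) ℚ.- sum f m} {f (j ℕ.+ m)} (sharp j) (bound (j ℕ.+ m)))

-- The error is the sum of f(i) (G - `sum g` (N - i)), each summand at most A 4^-i B 2^-(N-i). The
-- decay 4^-i of `f` against 2^-K for the tails of `g` leaves a geometric series in i, hence 2AB
-- 2^-N without a factor N. In the induction, shifting `f` divides `A` by 4.
sum-product : ∀ f g A B G N → 0ℚ ℚ.≤ A → 0ℚ ℚ.≤ B →
  (∀ i → ℚ.∣ f i ∣ ℚ.≤ A ℚ.* (2⁻ i ℚ.* 2⁻ i)) →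
  (∀ K → K ℕ.≤ N → ℚ.∣ G ℚ.- sum g K ∣ ℚ.≤ B ℚ.* 2⁻ K) →
  ℚ.∣ sum f N ℚ.* G ℚ.- sum (conv f g) N ∣ ℚ.≤ ((A ℚ.+ A) ℚ.* B) ℚ.* 2⁻ N
sum-product f g A B G zero 0≤A 0≤B boundᶠ boundᴳ = subst (ℚ._≤ ((A ℚ.+ A) ℚ.* B) ℚ.* 1ℚ)
  (cong ℚ.∣_∣ (solve 1 (λ G → con 0ℚ := con 0ℚ :* G :- con 0ℚ) refl G))
  (*-nonNeg (*-nonNeg (+-nonNeg 0≤A 0≤A) 0≤B) (0≤2⁻ 0))
sum-product f g A B G (suc N) 0≤A 0≤B boundᶠ boundᴳ = subst₂ ℚ._≤_
  (cong ℚ.∣_∣ (sym (begin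
    sum f (suc N) ℚ.* G ℚ.- sum (conv f g) (suc N)
      ≡⟨ cong₂ (λ y z → y ℚ.* G ℚ.- z) (sum-head f N) (sum-conv f g N) ⟩
    (f 0 ℚ.+ s) ℚ.* G ℚ.- (f 0 ℚ.* t ℚ.+ r)
      ≡⟨ solve 5 (λ a s G t r → (a :+ s) :* G :- (a :* t :+ r) :=
                                a :* (G :- t) :+ (s :* G :- r)) refl (f 0) s G t r ⟩
    f 0 ℚ.* (G ℚ.- t) ℚ.+ (s ℚ.* G ℚ.- r) ∎)))
  (solve 3 (λ A B p → (A :* (con 1ℚ :* con 1ℚ)) :* (B :* (con ½ :* p)) :+
                ((con ½ :* (con ½ :* A) :+ con ½ :* (con ½ :* A)) :* B) :* p :=
                ((A :+ A) :* B) :* (con ½ :* p)) refl A B (2⁻ N))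
  (∣+∣-mono {f 0 ℚ.* (G ℚ.- t)} {s ℚ.* G ℚ.- r}
    (∣*∣-mono {f 0} {G ℚ.- t} (boundᶠ 0) (boundᴳ (suc N) ℕ.≤-refl))
    (sum-product (f ∘ suc) g (½ ℚ.* (½ ℚ.* A)) B G N
      (*-nonNeg 0≤½ (*-nonNeg 0≤½ 0≤A)) 0≤B
      (λ i → subst (ℚ.∣ f (suc i) ∣ ℚ.≤_)
        (solve 2 (λ A p → A :* ((con ½ :* p) :* (con ½ :* p)) :=
                          (con ½ :* (con ½ :* A)) :* (p :* p)) refl A (2⁻ i))
        (boundᶠ (suc i)))
      (λ K K≤N → boundᴳ K (ℕ.m≤n⇒m≤1+n K≤N))))
  where
  open ≡-Reasoning
  s = sum (f ∘ suc) N
  t = sum g (suc N)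
  r = sum (conv (f ∘ suc) g) N

γ-nonNeg : ∀ {x} → 0ℚ ℚ.≤ x → ∀ n → 0ℚ ℚ.≤ γ x n
γ-nonNeg 0≤x zero    = ℚ.nonNegative⁻¹ 1ℚ
γ-nonNeg 0≤x (suc n) = *-nonNeg (*-nonNeg 0≤x (γ-nonNeg 0≤x n)) (/-nonNeg n 1)

∣γ∣≤ : ∀ {x M} → ℚ.∣ x ∣ ℚ.≤ M → ∀ n → ℚ.∣ γ x n ∣ ℚ.≤ γ M n
∣γ∣≤ x≤M zero    = ℚ.≤-refl
∣γ∣≤ {x} x≤M (suc n) = ∣*∣-mono {x ℚ.* γ x n} {inv n}
  (∣*∣-mono {x} {γ x n} x≤M (∣γ∣≤ x≤M n))
  (ℚ.≤-reflexive (ℚ.0≤p⇒∣p∣≡p (/-nonNeg n 1)))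

-- Turns a mere bound on the terms for 2x into geometric decay of the terms for x.
γ-half : ∀ x n → γ x n ≡ γ (x ℚ.+ x) n ℚ.* 2⁻ n
γ-half x zero    = refl
γ-half x (suc n) = trans (cong (λ z → (x ℚ.* z) ℚ.* inv n) (γ-half x n))
  (solve 4 (λ x g p i → (x :* (g :* p)) :* i := (((x :+ x) :* g) :* i) :* (con ½ :* p)) refl
    x (γ (x ℚ.+ x) n) (2⁻ n) (inv n))

eventually-decreasing⇒bounded : ∀ N (f : ℕ → ℚ) → (∀ n → N ℕ.≤ n → f (suc n) ℚ.≤ f n) →
  ∃[ A ] ∀ n → f n ℚ.≤ A
eventually-decreasing⇒bounded zero f dec = f 0 , bound
  where
  bound : ∀ n → f n ℚ.≤ f 0
  bound zero    = ℚ.≤-refl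
  bound (suc n) = ℚ.≤-trans (dec n ℕ.z≤n) (bound n)
eventually-decreasing⇒bounded (suc N) f dec =
  f 0 ℚ.⊔ A , λ { zero → ℚ.p≤p⊔q (f 0) A ; (suc n) → ℚ.≤-trans (bound n) (ℚ.p≤q⊔p (f 0) A) }
  where
  tail = eventually-decreasing⇒bounded N (f ∘ suc) (λ n N≤n → dec (suc n) (ℕ.s≤s N≤n))
  A = proj₁ tail
  bound = proj₂ tail

-- The ratio of consecutive terms is x / (n + 1), eventually at most 1.
γ-bounded : ∀ {x} → 0ℚ ℚ.< x → ∃[ A ] ∀ n → γ x n ℚ.≤ A
γ-bounded {x} 0<x = eventually-decreasing⇒bounded (proj₁ small) (γ x) (λ n N≤n →
  subst₂ ℚ._≤_
    (solve 3 (λ x g i → (x :* i) :* g := (x :* g) :* i) refl x (γ x n) (inv n))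
    (ℚ.*-identityˡ (γ x n))
    (ℚ.*-monoʳ-≤-nonNeg (γ x n) {{ℚ.nonNegative (γ-nonNeg (ℚ.<⇒≤ 0<x) n)}}
      (subst (x ℚ.* inv n ℚ.≤_) (proj₂ (proj₂ δ-scale))
        (ℚ.*-monoˡ-≤-nonNeg x {{ℚ.nonNegative (ℚ.<⇒≤ 0<x)}} (ℚ.<⇒≤ (proj₂ small n N≤n))))))
  where
  δ-scale = scale 0<x (ℚ.positive⁻¹ 1ℚ)
  small = archimedean (proj₁ δ-scale) (proj₁ (proj₂ δ-scale))

∣sgn∣≡1 : ∀ n → ℚ.∣ sgn n ∣ ≡ 1ℚ
∣sgn∣≡1 zero    = refl
∣sgn∣≡1 (suc n) = trans (ℚ.∣-p∣≡∣p∣ (sgn n)) (∣sgn∣≡1 n)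

-- The bound is uniform in x because a real argument is given by varying rationals. The n-th cosine
-- term is a power of degree 2n, so the factor 2^-(2n) from `γ-half` yields the rate 4^-n that
-- `sum-product` asks for.
τ-bounded : ∀ {M} → 0ℚ ℚ.< M → ∃[ A ] 0ℚ ℚ.< A ×
  (∀ x → ℚ.∣ x ∣ ℚ.≤ M → ∀ n → ℚ.∣ τ x n ∣ ℚ.≤ A ℚ.* (2⁻ n ℚ.* 2⁻ n))
-- At index 0 the bound reads 1 ≤ `A`, whence `A` is positive.
τ-bounded {M} 0<M = A , ℚ.<-≤-trans (ℚ.positive⁻¹ 1ℚ) (bound 0) , λ x x≤M n → begin
    ℚ.∣ τ x n ∣
      ≡⟨ ℚ.∣p*q∣≡∣p∣*∣q∣ (sgn n) (γ x (dbl n)) ⟩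
    ℚ.∣ sgn n ∣ ℚ.* ℚ.∣ γ x (dbl n) ∣
      ≡⟨ cong (ℚ._* ℚ.∣ γ x (dbl n) ∣) (∣sgn∣≡1 n) ⟩
    1ℚ ℚ.* ℚ.∣ γ x (dbl n) ∣
      ≡⟨ ℚ.*-identityˡ ℚ.∣ γ x (dbl n) ∣ ⟩
    ℚ.∣ γ x (dbl n) ∣
      ≤⟨ ∣γ∣≤ x≤M (dbl n) ⟩
    γ M (dbl n)
      ≡⟨ γ-half M (dbl n) ⟩
    γ (M ℚ.+ M) (dbl n) ℚ.* 2⁻ (dbl n)
      ≤⟨ ℚ.*-monoʳ-≤-nonNeg (2⁻ (dbl n)) {{ℚ.nonNegative (0≤2⁻ (dbl n))}} (bound (dbl n)) ⟩
    A ℚ.* 2⁻ (dbl n)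
      ≡⟨ cong (A ℚ.*_) (2⁻-dbl n) ⟩
    A ℚ.* (2⁻ n ℚ.* 2⁻ n) ∎
  where
  open ℚ.≤-Reasoning
  γ-bound = γ-bounded (+-pos 0<M 0<M)
  A = proj₁ γ-bound
  bound = proj₂ γ-bound

weaken-bound : ∀ {a A} → 0ℚ ℚ.≤ A → ∀ n → a ℚ.≤ A ℚ.* (2⁻ n ℚ.* 2⁻ n) → a ℚ.≤ A ℚ.* 2⁻ n
weaken-bound {a} {A} 0≤A n le = ℚ.≤-trans le
  (ℚ.*-monoˡ-≤-nonNeg A {{ℚ.nonNegative 0≤A}}
    (subst (2⁻ n ℚ.* 2⁻ n ℚ.≤_) (ℚ.*-identityʳ (2⁻ n))
      (ℚ.*-monoˡ-≤-nonNeg (2⁻ n) {{ℚ.nonNegative (0≤2⁻ n)}} (2⁻≤1 n))))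

½< : ∀ {ε} → 0ℚ ℚ.< ε → ½ ℚ.* ε ℚ.< ε
½< {ε} 0<ε = subst₂ ℚ._<_ (ℚ.+-identityʳ (½ ℚ.* ε)) (halves ε)
  (ℚ.+-monoʳ-< (½ ℚ.* ε) (half-pos 0<ε))

∣-∣-trans : ∀ {p r} a b c → ℚ.∣ a ℚ.- b ∣ ℚ.≤ p → ℚ.∣ b ℚ.- c ∣ ℚ.≤ r → ℚ.∣ a ℚ.- c ∣ ℚ.≤ p ℚ.+ r
∣-∣-trans {p} {r} a b c a-b b-c = subst (ℚ._≤ p ℚ.+ r)
  (cong ℚ.∣_∣ (solve 3 (λ a b c → (a :- b) :+ (b :- c) := a :- c) refl a b c))
  (∣+∣-mono {a ℚ.- b} {b ℚ.- c} a-b b-c)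

∣-∣-sym : ∀ {r} a b → ℚ.∣ a ℚ.- b ∣ ℚ.≤ r → ℚ.∣ b ℚ.- a ∣ ℚ.≤ r
∣-∣-sym {r} a b = subst (ℚ._≤ r) (trans (sym (ℚ.∣-p∣≡∣p∣ (a ℚ.- b))) (cong ℚ.∣_∣ (sym (flip- a b))))

-- The cosine as a real number

TermsBounded : ℝ → ℚ → Set
TermsBounded x A = ∃[ N ] ∀ n → N ℕ.≤ n →
  ∀ i → ℚ.∣ τ (seq x n) i ∣ ℚ.≤ A ℚ.* (2⁻ i ℚ.* 2⁻ i)

cos-terms-bounded : ∀ x → ∃[ A ] 0ℚ ℚ.< A × TermsBounded x A
cos-terms-bounded x = combine (bounded (seq x) (cauchy x))
  where
  combine : ∃[ M ] 0ℚ ℚ.< M × (∃[ N ] ∀ n → N ℕ.≤ n → ℚ.∣ seq x n ∣ ℚ.≤ M) →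
            ∃[ A ] 0ℚ ℚ.< A × TermsBounded x A
  combine (M , 0<M , N , bound) = attach (τ-bounded 0<M)
    where
    attach : ∃[ A ] 0ℚ ℚ.< A ×
               (∀ x → ℚ.∣ x ∣ ℚ.≤ M → ∀ n → ℚ.∣ τ x n ∣ ℚ.≤ A ℚ.* (2⁻ n ℚ.* 2⁻ n)) →
             ∃[ A ] 0ℚ ℚ.< A × TermsBounded x A
    attach (A , 0<A , τ≤) = A , 0<A , N , λ n N≤n → τ≤ (seq x n) (bound n N≤n)

TailBounded : ℝ → ℚ → Set
TailBounded x A = ∃[ N ] ∀ n → N ℕ.≤ n → ∀ K → K ℕ.≤ n →
  ℚ.∣ sum (τ (seq x n)) n ℚ.- sum (τ (seq x n)) K ∣ ℚ.≤ A ℚ.* 2⁻ K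

cos-tail : ∀ x → ∃[ A ] 0ℚ ℚ.< A × TailBounded x A
cos-tail x = combine (cos-terms-bounded x)
  where
  combine : ∃[ A ] 0ℚ ℚ.< A × TermsBounded x A → ∃[ A ] 0ℚ ℚ.< A × TailBounded x A
  combine (A , 0<A , N , bound) = A ℚ.+ A , +-pos 0<A 0<A , N ,
    λ n N≤n K K≤n → sum-tail {τ (seq x n)} {A}
      (λ i → weaken-bound (ℚ.<⇒≤ 0<A) i (bound n N≤n i)) (ℚ.<⇒≤ 0<A) K n K≤n

-- The length `K` is chosen before the index n. The diagonal sum, with n terms at the n-th
-- approximation of x, can thus be replaced by a partial sum of fixed length, which is a real
-- number.
cos-tail-small : ∀ x η → 0ℚ ℚ.< η → ∃[ K₀ ] ∀ K → K₀ ℕ.≤ K → ∃[ N ] ∀ n → N ℕ.≤ n →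
  ℚ.∣ sum (τ (seq x n)) n ℚ.- sum (τ (seq x n)) K ∣ ℚ.≤ η
cos-tail-small x η 0<η = combine (cos-tail x)
  where
  combine : ∃[ A ] 0ℚ ℚ.< A × TailBounded x A →
    ∃[ K₀ ] ∀ K → K₀ ℕ.≤ K → ∃[ N ] ∀ n → N ℕ.≤ n →
      ℚ.∣ sum (τ (seq x n)) n ℚ.- sum (τ (seq x n)) K ∣ ℚ.≤ η
  combine (A , 0<A , N , tail) = proj₁ small , λ K K₀≤K → N ℕ.⊔ K , λ n le →
    ℚ.≤-trans (tail n (ℕ.m⊔n≤o⇒m≤o N K le) K (ℕ.m⊔n≤o⇒n≤o N K le))
              (ℚ.<⇒≤ (proj₂ small K K₀≤K))
    where small = 2⁻-vanishes 0<A 0<η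

-- Three errors of at most ε/4 each: from the diagonal to the partial sum of fixed length `K` at m,
-- from there to the same partial sum at n, and back to the diagonal.
cos-cauchy : ∀ x → IsCauchy (λ n → sum (τ (seq x n)) n)
cos-cauchy x ε 0<ε = N₁ ℕ.⊔ N₂ , λ m n le le′ →
  ℚ.≤-<-trans
    (∣-∣-trans (c m) (P m) (c n) (tail m (ℕ.m⊔n≤o⇒m≤o N₁ N₂ le))
      (∣-∣-trans (P m) (P n) (c n)
        (subst₂ (λ a b → ℚ.∣ a ℚ.- b ∣ ℚ.≤ η) (partialSum-τ x K m) (partialSum-τ x K n)
          (ℚ.<⇒≤ (close m n (ℕ.m⊔n≤o⇒n≤o N₁ N₂ le) (ℕ.m⊔n≤o⇒n≤o N₁ N₂ le′))))
        (∣-∣-sym (c n) (P n) (tail n (ℕ.m⊔n≤o⇒m≤o N₁ N₂ le′)))))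
    3η<ε
  where
  η = ½ ℚ.* (½ ℚ.* ε)
  0<η = half-pos (half-pos 0<ε)
  small = cos-tail-small x η 0<η
  K = proj₁ small
  N₁ = proj₁ (proj₂ small K ℕ.≤-refl)
  tail = proj₂ (proj₂ small K ℕ.≤-refl)
  P-cauchy = cauchy (partialSum (cosTerm x) K) η 0<η
  N₂ = proj₁ P-cauchy
  close = proj₂ P-cauchy
  c = λ n → sum (τ (seq x n)) n
  P = λ n → sum (τ (seq x n)) K
  3η<ε : η ℚ.+ (η ℚ.+ η) ℚ.< ε
  3η<ε = subst₂ ℚ._<_ (ℚ.+-identityˡ _)
    (solve 1 (λ e → con ½ :* (con ½ :* e) :+ (con ½ :* (con ½ :* e) :+
      (con ½ :* (con ½ :* e) :+ con ½ :* (con ½ :* e))) := e) refl ε)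
    (ℚ.+-monoˡ-< (η ℚ.+ (η ℚ.+ η)) 0<η)

cosℝ : ℝ → ℝ
cosℝ x = mkℝ (λ n → sum (τ (seq x n)) n) (cos-cauchy x)

-- The positivity clause of `IsPi` speaks of numbers related by `IsCos`; this supplies them for the
-- new arguments 180° - α and 2 (180° - α).
isCos-cosℝ : ∀ x → IsCos x (cosℝ x)
isCos-cosℝ x ε (e , 0<e , ev) = proj₁ small , λ K K₀≤K →
  (½ ℚ.* e , half-pos 0<e , eventually₂ (lower K) ev (proj₂ small K K₀≤K)) ,
  (½ ℚ.* e , half-pos 0<e , eventually₂ (upper K) ev (proj₂ small K K₀≤K))
  where
  small = cos-tail-small x (½ ℚ.* e) (half-pos 0<e)
  c = λ n → sum (τ (seq x n)) n
  P = λ K n → sum (τ (seq x n)) K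
  lower : ∀ K n → 0ℚ ℚ.+ e ℚ.≤ seq ε n → ℚ.∣ c n ℚ.- P K n ∣ ℚ.≤ ½ ℚ.* e →
    (c n ℚ.- seq ε n) ℚ.+ ½ ℚ.* e ℚ.≤ seq (partialSum (cosTerm x) K) n
  lower K n e≤ε close = subst ((c n ℚ.- seq ε n) ℚ.+ ½ ℚ.* e ℚ.≤_) (sym (partialSum-τ x K n))
    (0≤q-p⇒p≤q (subst (0ℚ ℚ.≤_)
      (solve 4 (λ c P ε e → (con ½ :* e :- (c :- P)) :+ (ε :- (con 0ℚ :+ e)) :=
                            P :- ((c :- ε) :+ con ½ :* e)) refl (c n) (P K n) (seq ε n) e)
      (+-nonNeg (p≤q⇒0≤q-p (∣∣≤⇒≤ close)) (p≤q⇒0≤q-p e≤ε))))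
  upper : ∀ K n → 0ℚ ℚ.+ e ℚ.≤ seq ε n → ℚ.∣ c n ℚ.- P K n ∣ ℚ.≤ ½ ℚ.* e →
    seq (partialSum (cosTerm x) K) n ℚ.+ ½ ℚ.* e ℚ.≤ c n ℚ.+ seq ε n
  upper K n e≤ε close = subst (λ z → z ℚ.+ ½ ℚ.* e ℚ.≤ c n ℚ.+ seq ε n) (sym (partialSum-τ x K n))
    (0≤q-p⇒p≤q (subst (0ℚ ℚ.≤_)
      (solve 4 (λ c P ε e → (con ½ :* e :- (:- (c :- P))) :+ (ε :- (con 0ℚ :+ e)) :=
                            (c :+ ε) :- (P :+ con ½ :* e)) refl (c n) (P K n) (seq ε n) e)
      (+-nonNeg (p≤q⇒0≤q-p (∣∣≤⇒-≤ close)) (p≤q⇒0≤q-p e≤ε))))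

-- Carries identities for `cosℝ` over to the cosine values given by `AngleDegrees` and `IsPi`.
isCos-unique : ∀ x {c} → IsCos x c → c ≈ cosℝ x
isCos-unique x {c} isCos ε 0<ε = eventually₂
  (λ n (near₁ , near₂) tail → ℚ.≤-<-trans
    (subst (ℚ.∣ seq c n ℚ.- seq (cosℝ x) n ∣ ℚ.≤_) (halves (½ ℚ.* ε))
      (∣-∣-trans (seq c n) (sum (τ (seq x n)) K) (seq (cosℝ x) n)
        (subst (λ z → ℚ.∣ seq c n ℚ.- z ∣ ℚ.≤ η) (partialSum-τ x K n)
          (≤⇒∣∣≤ (below n near₁) (above n near₂)))
        (∣-∣-sym (seq (cosℝ x) n) (sum (τ (seq x n)) K) tail)))
    (½< 0<ε))
  (eventually-× (proj₂ (proj₂ (proj₁ near))) (proj₂ (proj₂ (proj₂ near))))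
  (proj₂ small K (ℕ.m≤n⊔m N (proj₁ small)))
  where
  η = ½ ℚ.* (½ ℚ.* ε)
  0<η = half-pos (half-pos 0<ε)
  small = cos-tail-small x η 0<η
  summable = isCos (fromℚ η) (pos-const 0<η)
  N = proj₁ summable
  K = N ℕ.⊔ proj₁ small
  near = proj₂ summable K (ℕ.m≤m⊔n N (proj₁ small))
  P = seq (partialSum (cosTerm x) K)
  below : ∀ n → (seq c n ℚ.- η) ℚ.+ proj₁ (proj₁ near) ℚ.≤ P n → seq c n ℚ.- P n ℚ.≤ η
  below n le = 0≤q-p⇒p≤q (subst (0ℚ ℚ.≤_)
    (solve 4 (λ c η e P → (P :- ((c :- η) :+ e)) :+ e := η :- (c :- P)) refl
      (seq c n) η (proj₁ (proj₁ near)) (P n))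
    (+-nonNeg (p≤q⇒0≤q-p le) (ℚ.<⇒≤ (proj₁ (proj₂ (proj₁ near))))))
  above : ∀ n → P n ℚ.+ proj₁ (proj₂ near) ℚ.≤ seq c n ℚ.+ η → ℚ.- (seq c n ℚ.- P n) ℚ.≤ η
  above n le = 0≤q-p⇒p≤q (subst (0ℚ ℚ.≤_)
    (solve 4 (λ c η e P → ((c :+ η) :- (P :+ e)) :+ e := η :- (:- (c :- P))) refl
      (seq c n) η (proj₁ (proj₂ near)) (P n))
    (+-nonNeg (p≤q⇒0≤q-p le) (ℚ.<⇒≤ (proj₁ (proj₂ (proj₂ near))))))

-- At index n all three cosines are sums of n rational terms. By `τ-product` the left side is
-- exactly twice the partial sum of the Cauchy product, so the two sides differ by twice the error
-- in `sum-product`, which tends to 0.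
cos-product : ∀ x y → cosℝ (x + y) + cosℝ (x - y) ≈ fromℚ (1ℚ ℚ.+ 1ℚ) * (cosℝ x * cosℝ y)
cos-product x y ε 0<ε = combine (cos-terms-bounded x) (cos-terms-bounded y)
  where
  combine : ∃[ A ] 0ℚ ℚ.< A × TermsBounded x A → ∃[ B ] 0ℚ ℚ.< B × TermsBounded y B →
    ∃[ N ] ∀ n → N ℕ.≤ n → ℚ.∣ seq (cosℝ (x + y) + cosℝ (x - y)) n ℚ.-
      seq (fromℚ (1ℚ ℚ.+ 1ℚ) * (cosℝ x * cosℝ y)) n ∣ ℚ.< ε
  combine (A , 0<A , evˣ) (B , 0<B , evʸ) = eventually₂
    (λ n (boundˣ , boundʸ) small → ℚ.≤-<-trans (estimate n boundˣ boundʸ) small)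
    (eventually-× evˣ evʸ)
    (2⁻-vanishes {E ℚ.+ E} (+-pos 0<E 0<E) 0<ε)
    where
    E = (A ℚ.+ A) ℚ.* (B ℚ.+ B)
    0<E = *-pos (+-pos 0<A 0<A) (+-pos 0<B 0<B)
    estimate : ∀ n →
      (∀ i → ℚ.∣ τ (seq x n) i ∣ ℚ.≤ A ℚ.* (2⁻ i ℚ.* 2⁻ i)) →
      (∀ i → ℚ.∣ τ (seq y n) i ∣ ℚ.≤ B ℚ.* (2⁻ i ℚ.* 2⁻ i)) →
      ℚ.∣ seq (cosℝ (x + y) + cosℝ (x - y)) n ℚ.-
          seq (fromℚ (1ℚ ℚ.+ 1ℚ) * (cosℝ x * cosℝ y)) n ∣ ℚ.≤ (E ℚ.+ E) ℚ.* 2⁻ n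
    estimate n boundˣ boundʸ = subst₂ ℚ._≤_
      (trans (sym (ℚ.∣-p∣≡∣p∣ (d ℚ.+ d))) (cong ℚ.∣_∣ (sym (begin
        (sum (τ (a ℚ.+ b)) n ℚ.+ sum (τ (a ℚ.- b)) n) ℚ.- (1ℚ ℚ.+ 1ℚ) ℚ.* (s ℚ.* t)
          ≡⟨ cong (ℚ._- (1ℚ ℚ.+ 1ℚ) ℚ.* (s ℚ.* t)) (trans
               (sym (sum-+ (τ (a ℚ.+ b)) (τ (a ℚ.- b)) n))
               (trans (sum-cong (τ-product a b) n) (sum-* (1ℚ ℚ.+ 1ℚ) (conv (τ a) (τ b)) n))) ⟩
        (1ℚ ℚ.+ 1ℚ) ℚ.* r ℚ.- (1ℚ ℚ.+ 1ℚ) ℚ.* (s ℚ.* t)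
          ≡⟨ solve 3 (λ r s t → con (1ℚ ℚ.+ 1ℚ) :* r :- con (1ℚ ℚ.+ 1ℚ) :* (s :* t) :=
                       :- ((s :* t :- r) :+ (s :* t :- r))) refl r s t ⟩
        ℚ.- (d ℚ.+ d) ∎))))
      (sym (ℚ.*-distribʳ-+ (2⁻ n) E E))
      (∣+∣-mono {d} {d} bound bound)
      where
      open ≡-Reasoning
      a = seq x n
      b = seq y n
      s = sum (τ a) n
      t = sum (τ b) n
      r = sum (conv (τ a) (τ b)) n
      d = s ℚ.* t ℚ.- r
      bound : ℚ.∣ d ∣ ℚ.≤ E ℚ.* 2⁻ n
      bound = sum-product (τ a) (τ b) A (B ℚ.+ B) t n (ℚ.<⇒≤ 0<A) (ℚ.<⇒≤ (+-pos 0<B 0<B)) boundˣ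
        (λ K K≤n → sum-tail {τ b} {B} (λ i → weaken-bound (ℚ.<⇒≤ 0<B) i (boundʸ i))
                     (ℚ.<⇒≤ 0<B) K n K≤n)

-- Supplementary and double angles

cosℝ-cong : ∀ {x y} → (∀ n → seq x n ≡ seq y n) → cosℝ x ≈ cosℝ y
cosℝ-cong {x} {y} eq = pointwise {cosℝ x} {cosℝ y} (λ n → cong (λ z → sum (τ z) n) (eq n))

cosℝ-0 : ∀ {x} → (∀ n → seq x n ≡ 0ℚ) → cosℝ x ≈ 1ℝ
-- Index 0 is skipped: the partial sum there is empty, with value 0 instead of 1.
cosℝ-0 {x} x≡0 ε 0<ε = 1 , λ { (suc n) _ → subst (ℚ._< ε)
  (sym (cong (λ z → ℚ.∣ z ℚ.- 1ℚ ∣) (trans (cong (λ z → sum (τ z) (suc n)) (x≡0 (suc n))) (at-0 n))))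
  0<ε }
  where
  at-0 : ∀ n → sum (τ 0ℚ) (suc n) ≡ 1ℚ
  at-0 zero    = refl
  at-0 (suc n) = trans (cong (ℚ._+ τ 0ℚ (suc n)) (at-0 n))
    (solve 3 (λ s g i → con 1ℚ :+ s :* ((con 0ℚ :* g) :* i) := con 1ℚ) refl
      (sgn (suc n)) (γ 0ℚ (suc (dbl n))) (inv (suc (dbl n))))

-- The product formula at h and h - θ, whose sum is 2h - θ and whose difference is θ; the right side
-- contains the factor cos h = 0.
cos-supplement : ∀ {h θ c} → IsCos h 0ℝ → IsCos θ c → cosℝ (h + (h - θ)) ≈ - c
cos-supplement {h} {θ} {c} cos-h≡0 isCos = cosφ≈-c
  where
  two = fromℚ (1ℚ ℚ.+ 1ℚ)
  φ = h + (h - θ)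
  θ′ = h - (h - θ)

  c≈cosθ′ : c ≈ cosℝ θ′
  c≈cosθ′ = ≈-trans {c} {cosℝ θ} {cosℝ θ′} (isCos-unique θ {c} isCos)
    (cosℝ-cong {θ} {θ′} (λ n → solve 2 (λ h t → t := h :- (h :- t)) refl (seq h n) (seq θ n)))

  sum≈0 : cosℝ φ + cosℝ θ′ ≈ 0ℝ
  sum≈0 = ≈-trans {cosℝ φ + cosℝ θ′} {two * (cosℝ h * cosℝ (h - θ))} {0ℝ} (cos-product h (h - θ))
    (≈-trans {two * (cosℝ h * cosℝ (h - θ))} {two * (0ℝ * cosℝ (h - θ))} {0ℝ}
      (*-congˡ two {cosℝ h * cosℝ (h - θ)} {0ℝ * cosℝ (h - θ)}
        (*-cong {cosℝ h} {0ℝ} {cosℝ (h - θ)} {cosℝ (h - θ)}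
          (≈-sym {0ℝ} {cosℝ h} (isCos-unique h {0ℝ} cos-h≡0)) (≈-refl {cosℝ (h - θ)})))
      (pointwise {two * (0ℝ * cosℝ (h - θ))} {0ℝ} (λ n → solve 1
        (λ z → con (1ℚ ℚ.+ 1ℚ) :* (con 0ℚ :* z) := con 0ℚ) refl (seq (cosℝ (h - θ)) n))))

  cosφ≈-c : cosℝ φ ≈ - c
  cosφ≈-c = ≈-trans {cosℝ φ} {(cosℝ φ + cosℝ θ′) - cosℝ θ′} { - c}
    (pointwise {cosℝ φ} {(cosℝ φ + cosℝ θ′) - cosℝ θ′} (λ n → solve 2
      (λ a b → a := (a :+ b) :- b) refl (seq (cosℝ φ) n) (seq (cosℝ θ′) n)))
    (≈-trans {(cosℝ φ + cosℝ θ′) - cosℝ θ′} {0ℝ - c} { - c}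
      (+-cong {cosℝ φ + cosℝ θ′} {0ℝ} { - cosℝ θ′} { - c} sum≈0
        (neg-cong {cosℝ θ′} {c} (≈-sym {c} {cosℝ θ′} c≈cosθ′)))
      (pointwise {0ℝ - c} { - c} (λ n → ℚ.+-identityˡ (ℚ.- seq c n))))

cos-double : ∀ {φ c} → cosℝ φ ≈ - c → cosℝ (φ + φ) ≈ (c * c + c * c) - 1ℝ
cos-double {φ} {c} cosφ≈-c =
  (≈-trans {cosℝ (φ + φ)} {(cosℝ (φ + φ) + cosℝ (φ - φ)) - cosℝ (φ - φ)} {(c * c + c * c) - 1ℝ}
    (pointwise {cosℝ (φ + φ)} {(cosℝ (φ + φ) + cosℝ (φ - φ)) - cosℝ (φ - φ)} (λ n → solve 2
      (λ a b → a := (a :+ b) :- b) refl (seq (cosℝ (φ + φ)) n) (seq (cosℝ (φ - φ)) n)))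
    (+-cong {cosℝ (φ + φ) + cosℝ (φ - φ)} {c * c + c * c} { - cosℝ (φ - φ)} { - 1ℝ}
      (≈-trans {cosℝ (φ + φ) + cosℝ (φ - φ)} {two * (cosℝ φ * cosℝ φ)} {c * c + c * c}
        (cos-product φ φ)
        (≈-trans {two * (cosℝ φ * cosℝ φ)} {two * ((- c) * (- c))} {c * c + c * c}
          (*-congˡ two {cosℝ φ * cosℝ φ} {(- c) * (- c)}
            (*-cong {cosℝ φ} { - c} {cosℝ φ} { - c} cosφ≈-c cosφ≈-c))
          (pointwise {two * ((- c) * (- c))} {c * c + c * c} (λ n → solve 1
            (λ c → con (1ℚ ℚ.+ 1ℚ) :* (:- c :* :- c) := c :* c :+ c :* c) refl (seq c n)))))
      (neg-cong {cosℝ (φ - φ)} {1ℝ} (cosℝ-0 {φ - φ} (λ n → ℚ.+-inverseʳ (seq φ n))))))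
  where two = fromℚ (1ℚ ℚ.+ 1ℚ)

-- With h = π / 2 and φ = π - θ, the product formula gives cos φ = - cos θ
-- and cos 2φ = 2 cos² θ - 1, and both φ and 2φ lie in [0, h).
cos-beyond-135° : ∀ {h θ c} → 0ℝ ≤ h + (h - θ) → 0ℝ < h - ((h + (h - θ)) + (h + (h - θ))) →
  IsCos h 0ℝ → (∀ x c → 0ℝ ≤ x → x < h → IsCos x c → 0ℝ < c) →
  IsCos θ c → 0ℝ < - c × 0ℝ < (c * c + c * c) - 1ℝ
cos-beyond-135° {h} {θ} {c} 0≤φ 0<h-2φ cos-h≡0 cos-pos isCos =
  ≈-pos {cosℝ φ} { - c} cosφ≈-c
    (cos-pos φ (cosℝ φ) 0≤φ (pos⇒< {φ} {h} 0<h-φ) (isCos-cosℝ φ)) ,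
  ≈-pos {cosℝ (φ + φ)} {(c * c + c * c) - 1ℝ} (cos-double {φ} {c} cosφ≈-c)
    (cos-pos (φ + φ) (cosℝ (φ + φ)) (nonneg-+ {φ} {φ} 0≤φ 0≤φ) (pos⇒< {φ + φ} {h} 0<h-2φ)
      (isCos-cosℝ (φ + φ)))
  where
  φ = h + (h - θ)
  cosφ≈-c : cosℝ φ ≈ - c
  cosφ≈-c = cos-supplement {h} {θ} {c} cos-h≡0 isCos
  0<h-φ : 0ℝ < h - φ
  0<h-φ = ≈-pos {(h - (φ + φ)) + φ} {h - φ}
    (pointwise {(h - (φ + φ)) + φ} {h - φ} (λ n → solve 2
      (λ h t → (h :- (t :+ t)) :+ t := h :- t) refl (seq h n) (seq φ n)))
    (pos+nonneg {h - (φ + φ)} {φ} 0<h-2φ 0≤φ)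

cos-obtuse : ∀ {α π c} → α ≤ fromℚ (+ 180 / 1) → fromℚ (+ 135 / 1) < α → IsPi π →
  IsCos (α * (fromℚ (+ 1 / 180) * π)) c → 0ℝ < - c × 0ℝ < (c * c + c * c) - 1ℝ
cos-obtuse {α} {π} {c} α≤180 135<α (0<π , cos-h≡0 , cos-pos) =
  cos-beyond-135° {fromℚ ½ * π} {α * (fromℚ (+ 1 / 180) * π)} {c} 0≤φ 0<h-2φ cos-h≡0 cos-pos
  where
  d = fromℚ (+ 1 / 180) * π
  h = fromℚ ½ * π
  φ = h + (h - α * d)

  0<d : 0ℝ < d
  0<d = pos-* {fromℚ (+ 1 / 180)} {π} (pos-const (ℚ.positive⁻¹ (+ 1 / 180))) 0<π

  -- `d` is one degree in radians, and `φ` is (180 - α) `d`.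
  0≤φ : 0ℝ ≤ φ
  0≤φ = ≈-nonneg {(fromℚ (+ 180 / 1) - α) * d} {φ}
    (pointwise {(fromℚ (+ 180 / 1) - α) * d} {φ} (λ n → solve 2
      (λ a p → (con (+ 180 / 1) :- a) :* (con (+ 1 / 180) :* p) :=
               con ½ :* p :+ (con ½ :* p :- a :* (con (+ 1 / 180) :* p)))
      refl (seq α n) (seq π n)))
    (nonneg-* {fromℚ (+ 180 / 1) - α} {d} (≤⇒nonneg {α} {fromℚ (+ 180 / 1)} α≤180)
      (pos⇒nonneg {d} 0<d))

  -- In degrees, 90 - 2 (180 - α) = 2 (α - 135): here the bound of 135 degrees enters.
  0<h-2φ : 0ℝ < h - (φ + φ)
  0<h-2φ = ≈-pos {(fromℚ (+ 2 / 1) * (α - fromℚ (+ 135 / 1))) * d} {h - (φ + φ)}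
    (pointwise {(fromℚ (+ 2 / 1) * (α - fromℚ (+ 135 / 1))) * d} {h - (φ + φ)} (λ n → solve 2
      (λ a p → let t = con ½ :* p :+ (con ½ :* p :- a :* (con (+ 1 / 180) :* p)) in
        (con (+ 2 / 1) :* (a :- con (+ 135 / 1))) :* (con (+ 1 / 180) :* p) :=
        con ½ :* p :- (t :+ t))
      refl (seq α n) (seq π n)))
    (pos-* {fromℚ (+ 2 / 1) * (α - fromℚ (+ 135 / 1))} {d}
      (pos-* {fromℚ (+ 2 / 1)} {α - fromℚ (+ 135 / 1)}
        (pos-const (ℚ.positive⁻¹ (+ 2 / 1))) (<⇒pos {fromℚ (+ 135 / 1)} {α} 135<α))
      0<d)

-- Squared distances

sqdist : ∀ {d} → Point d → Point d → ℝ
sqdist x y = (x -ₚ y) ∙ (x -ₚ y)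

∑ : ∀ {d} → (Fin d → ℚ) → ℚ
∑ = foldr ℚ._+_ 0ℚ

seq-foldr : ∀ {d} (v : Fin d → ℝ) n → seq (foldr _+_ 0ℝ v) n ≡ ∑ (λ i → seq (v i) n)
seq-foldr {zero}  v n = refl
seq-foldr {suc d} v n = cong (seq (v zero) n ℚ.+_) (seq-foldr (v ∘ suc) n)

sqdistℚ : ∀ {d} → (Fin d → ℚ) → (Fin d → ℚ) → ℚ
sqdistℚ x y = ∑ (λ i → (x i ℚ.- y i) ℚ.* (x i ℚ.- y i))

at : ∀ {d} → Point d → ℕ → Fin d → ℚ
at x n i = seq (x i) n

seq-sqdist : ∀ {d} (x y : Point d) n → seq (sqdist x y) n ≡ sqdistℚ (at x n) (at y n)
seq-sqdist x y n = seq-foldr (zipWith _*_ (x -ₚ y) (x -ₚ y)) n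

sqdistℚ-nonNeg : ∀ {d} (x y : Fin d → ℚ) → 0ℚ ℚ.≤ sqdistℚ x y
sqdistℚ-nonNeg {zero}  x y = ℚ.≤-refl
sqdistℚ-nonNeg {suc d} x y =
  +-nonNeg (square-nonNeg (x zero ℚ.- y zero)) (sqdistℚ-nonNeg (x ∘ suc) (y ∘ suc))

-- Stewart's theorem
sqdistℚ-segment : ∀ {d} t (b x y : Fin d → ℚ) →
  sqdistℚ b (λ i → (1ℚ ℚ.- t) ℚ.* x i ℚ.+ t ℚ.* y i) ≡
  ((1ℚ ℚ.- t) ℚ.* sqdistℚ b x ℚ.+ t ℚ.* sqdistℚ b y) ℚ.- (t ℚ.* (1ℚ ℚ.- t)) ℚ.* sqdistℚ y x
sqdistℚ-segment {zero} t b x y = solve 1 (λ t →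
  con 0ℚ := ((con 1ℚ :- t) :* con 0ℚ :+ t :* con 0ℚ) :- (t :* (con 1ℚ :- t)) :* con 0ℚ) refl t
sqdistℚ-segment {suc d} t b x y = trans
  (cong (λ z → (b zero ℚ.- s) ℚ.* (b zero ℚ.- s) ℚ.+ z)
    (sqdistℚ-segment t (b ∘ suc) (x ∘ suc) (y ∘ suc)))
  (solve 7 (λ t b x y p q r →
    let s = (con 1ℚ :- t) :* x :+ t :* y in
    (b :- s) :* (b :- s) :+ (((con 1ℚ :- t) :* p :+ t :* q) :- (t :* (con 1ℚ :- t)) :* r) :=
    ((con 1ℚ :- t) :* ((b :- x) :* (b :- x) :+ p) :+ t :* ((b :- y) :* (b :- y) :+ q)) :-
    (t :* (con 1ℚ :- t)) :* ((y :- x) :* (y :- x) :+ r)) refl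
    t (b zero) (x zero) (y zero) (sqdistℚ (b ∘ suc) (x ∘ suc))
    (sqdistℚ (b ∘ suc) (y ∘ suc)) (sqdistℚ (y ∘ suc) (x ∘ suc)))
  where s = (1ℚ ℚ.- t) ℚ.* x zero ℚ.+ t ℚ.* y zero

-- The value of ∣k (w - y) - a (x - y) - c (z - y)∣² by the law of cosines,
-- where p, q, r, u, v, t are the squares of the distances xy, zy, xz, wy, wx, wz.
spread : (k a c p q r u v t : ℚ) → ℚ
spread k a c p q r u v t =
  ((k ℚ.* k) ℚ.* u ℚ.- (k ℚ.* a) ℚ.* ((p ℚ.+ u) ℚ.- v) ℚ.- (k ℚ.* c) ℚ.* ((q ℚ.+ u) ℚ.- t))
  ℚ.+ ((a ℚ.* a) ℚ.* p ℚ.+ (c ℚ.* c) ℚ.* q ℚ.+ (a ℚ.* c) ℚ.* ((p ℚ.+ q) ℚ.- r))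

spread-polynomial : ∀ {m} (k a c p q r u v t : Polynomial m) → Polynomial m
spread-polynomial k a c p q r u v t =
  ((k :* k) :* u :- (k :* a) :* ((p :+ u) :- v) :- (k :* c) :* ((q :+ u) :- t))
  :+ ((a :* a) :* p :+ (c :* c) :* q :+ (a :* c) :* ((p :+ q) :- r))

spread-+ : ∀ k a c p q r u v t p′ q′ r′ u′ v′ t′ →
  spread k a c p q r u v t ℚ.+ spread k a c p′ q′ r′ u′ v′ t′ ≡
  spread k a c (p ℚ.+ p′) (q ℚ.+ q′) (r ℚ.+ r′) (u ℚ.+ u′) (v ℚ.+ v′) (t ℚ.+ t′)
spread-+ = solve 15 (λ k a c p q r u v t p′ q′ r′ u′ v′ t′ →
  spread-polynomial k a c p q r u v t :+ spread-polynomial k a c p′ q′ r′ u′ v′ t′ :=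
  spread-polynomial k a c (p :+ p′) (q :+ q′) (r :+ r′) (u :+ u′) (v :+ v′) (t :+ t′)) refl

spread-square : ∀ x y z w k a c →
  let s = λ a b → (a ℚ.- b) ℚ.* (a ℚ.- b)
      e = (k ℚ.* (w ℚ.- y) ℚ.- a ℚ.* (x ℚ.- y)) ℚ.- c ℚ.* (z ℚ.- y)
  in e ℚ.* e ≡ spread k a c (s x y) (s z y) (s x z) (s w y) (s w x) (s w z)
spread-square = solve 7 (λ x y z w k a c →
  let s = λ a b → (a :- b) :* (a :- b)
      e = (k :* (w :- y) :- a :* (x :- y)) :- c :* (z :- y)
  in e :* e := spread-polynomial k a c (s x y) (s z y) (s x z) (s w y) (s w x) (s w z)) refl

-- `spread` is linear in the six squared distances, each a sum over the coordinates. It is therefore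
-- the sum of its one-dimensional values, which are squares by `spread-square`.
spread-nonNeg : ∀ {d} (x y z w : Fin d → ℚ) k a c →
  0ℚ ℚ.≤ spread k a c (sqdistℚ x y) (sqdistℚ z y) (sqdistℚ x z)
                      (sqdistℚ w y) (sqdistℚ w x) (sqdistℚ w z)
spread-nonNeg {zero} x y z w k a c = ℚ.≤-reflexive (solve 3 (λ k a c →
  con 0ℚ := spread-polynomial k a c (con 0ℚ) (con 0ℚ) (con 0ℚ) (con 0ℚ) (con 0ℚ) (con 0ℚ))
  refl k a c)
spread-nonNeg {suc d} x y z w k a c = subst (0ℚ ℚ.≤_)
  (trans (cong (ℚ._+ spread k a c P Q R U V T) (spread-square x₀ y₀ z₀ w₀ k a c))
    (spread-+ k a c (s x₀ y₀) (s z₀ y₀) (s x₀ z₀) (s w₀ y₀) (s w₀ x₀) (s w₀ z₀) P Q R U V T))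
  (+-nonNeg (square-nonNeg ((k ℚ.* (w₀ ℚ.- y₀) ℚ.- a ℚ.* (x₀ ℚ.- y₀)) ℚ.- c ℚ.* (z₀ ℚ.- y₀)))
            (spread-nonNeg (x ∘ suc) (y ∘ suc) (z ∘ suc) (w ∘ suc) k a c))
  where
  x₀ = x zero
  y₀ = y zero
  z₀ = z zero
  w₀ = w zero
  P = sqdistℚ (x ∘ suc) (y ∘ suc)
  Q = sqdistℚ (z ∘ suc) (y ∘ suc)
  R = sqdistℚ (x ∘ suc) (z ∘ suc)
  U = sqdistℚ (w ∘ suc) (y ∘ suc)
  V = sqdistℚ (w ∘ suc) (x ∘ suc)
  T = sqdistℚ (w ∘ suc) (z ∘ suc)
  s : ℚ → ℚ → ℚ
  s a b = (a ℚ.- b) ℚ.* (a ℚ.- b)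

-- Jung's theorem, up to the dimension-dependent factor and an arbitrarily
-- small error, by the Frank-Wolfe algorithm.  For a centre c = Σ λᵢ bᵢ put
-- f = Σ λᵢ ∣bᵢ - c∣²; then Σ λᵢ ∣bᵢ - x∣² = f + ∣x - c∣² for all x.  Only
-- the two consequences ∣bⱼ - c∣² + f ≤ L and 2 f ≤ L are carried along.
next : ℚ → ℝ → ℝ → ℝ
next t f v = fromℚ (1ℚ ℚ.- t) * f + fromℚ (t ℚ.* (1ℚ ℚ.- t)) * v

module _ (t : ℚ) (0≤t : 0ℚ ℚ.≤ t) (t≤1 : t ℚ.≤ 1ℚ) where

  private
    0≤1-t : 0ℚ ℚ.≤ 1ℚ ℚ.- t
    0≤1-t = p≤q⇒0≤q-p t≤1

  -- By Stewart's theorem the new squared distance contains -t(1 - t)v, which cancels the increment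
  -- in `next`. What remains is the convex combination of s + f and r with weights 1 - t and t.
  next-distance : ∀ {L f s r v s′} →
    (∀ n → seq s′ n ≡ ((1ℚ ℚ.- t) ℚ.* seq s n ℚ.+ t ℚ.* seq r n) ℚ.-
                      (t ℚ.* (1ℚ ℚ.- t)) ℚ.* seq v n) →
    s + f ≤ L → r ≤ L → s′ + next t f v ≤ L
  next-distance {L} {f} {s} {r} {v} {s′} eq s+f≤L r≤L =
    certify {s′ + next t f v} {L} {fromℚ (1ℚ ℚ.- t) * (L - (s + f)) + fromℚ t * (L - r)}
      (nonneg-+ {fromℚ (1ℚ ℚ.- t) * (L - (s + f))} {fromℚ t * (L - r)}
        (nonneg-* {fromℚ (1ℚ ℚ.- t)} {L - (s + f)} (nonneg-const 0≤1-t) (≤⇒nonneg {s + f} {L} s+f≤L))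
        (nonneg-* {fromℚ t} {L - r} (nonneg-const 0≤t) (≤⇒nonneg {r} {L} r≤L)))
      (λ n → trans
        (solve 6 (λ t L f s r v →
          (con 1ℚ :- t) :* (L :- (s :+ f)) :+ t :* (L :- r) :=
          L :- ((((con 1ℚ :- t) :* s :+ t :* r) :- (t :* (con 1ℚ :- t)) :* v) :+
                ((con 1ℚ :- t) :* f :+ (t :* (con 1ℚ :- t)) :* v))) refl
          t (seq L n) (seq f n) (seq s n) (seq r n) (seq v n))
        (cong (λ z → seq L n ℚ.- (z ℚ.+ seq (next t f v) n)) (sym (eq n))))

  -- Twice the new value is (1 - t)² (2f) + 2t(1 - t)(v + f); the weights add up to 1 - t², and t² L
  -- is left over.
  next-bound : ∀ {L f v} → 0ℝ ≤ L → f + f ≤ L → v + f ≤ L → next t f v + next t f v ≤ L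
  next-bound {L} {f} {v} 0≤L 2f≤L v+f≤L =
    certify {next t f v + next t f v} {L}
      {(fromℚ ((1ℚ ℚ.- t) ℚ.* (1ℚ ℚ.- t)) * (L - (f + f)) +
        fromℚ ((t ℚ.+ t) ℚ.* (1ℚ ℚ.- t)) * (L - (v + f))) + fromℚ (t ℚ.* t) * L}
      (nonneg-+ {fromℚ ((1ℚ ℚ.- t) ℚ.* (1ℚ ℚ.- t)) * (L - (f + f)) +
                 fromℚ ((t ℚ.+ t) ℚ.* (1ℚ ℚ.- t)) * (L - (v + f))} {fromℚ (t ℚ.* t) * L}
        (nonneg-+ {fromℚ ((1ℚ ℚ.- t) ℚ.* (1ℚ ℚ.- t)) * (L - (f + f))}
                  {fromℚ ((t ℚ.+ t) ℚ.* (1ℚ ℚ.- t)) * (L - (v + f))}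
          (nonneg-* {fromℚ ((1ℚ ℚ.- t) ℚ.* (1ℚ ℚ.- t))} {L - (f + f)}
            (nonneg-const (*-nonNeg 0≤1-t 0≤1-t)) (≤⇒nonneg {f + f} {L} 2f≤L))
          (nonneg-* {fromℚ ((t ℚ.+ t) ℚ.* (1ℚ ℚ.- t))} {L - (v + f)}
            (nonneg-const (*-nonNeg (+-nonNeg 0≤t 0≤t) 0≤1-t)) (≤⇒nonneg {v + f} {L} v+f≤L)))
        (nonneg-* {fromℚ (t ℚ.* t)} {L} (nonneg-const (*-nonNeg 0≤t 0≤t)) 0≤L))
      (λ n → solve 4 (λ t L f v →
        let g = (con 1ℚ :- t) :* f :+ (t :* (con 1ℚ :- t)) :* v in
        (((con 1ℚ :- t) :* (con 1ℚ :- t)) :* (L :- (f :+ f)) :+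
         ((t :+ t) :* (con 1ℚ :- t)) :* (L :- (v :+ f))) :+ (t :* t) :* L := L :- (g :+ g)) refl
        t (seq L n) (seq f n) (seq v n))

  -- The increase is t(1 - t)v - t f. Inserting v ≥ L/2 + e and f ≤ L/2 leaves t(1 - t)e - t² L/2,
  -- and L is replaced by its rational bound `M`.
  next-gain : ∀ {L f v e M} → f + f ≤ L → L ≤ fromℚ M → fromℚ e ≤ v - fromℚ ½ * L →
    f + fromℚ ((t ℚ.* e ℚ.- (t ℚ.* t) ℚ.* e) ℚ.- (½ ℚ.* (t ℚ.* t)) ℚ.* M) ≤ next t f v
  next-gain {L} {f} {v} {e} {M} 2f≤L L≤M e≤ =
    certify {f + fromℚ ((t ℚ.* e ℚ.- (t ℚ.* t) ℚ.* e) ℚ.- (½ ℚ.* (t ℚ.* t)) ℚ.* M)} {next t f v}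
      {(fromℚ (t ℚ.* (1ℚ ℚ.- t)) * ((v - fromℚ ½ * L) - fromℚ e) +
        fromℚ (½ ℚ.* t) * (L - (f + f))) + fromℚ (½ ℚ.* (t ℚ.* t)) * (fromℚ M - L)}
      (nonneg-+ {fromℚ (t ℚ.* (1ℚ ℚ.- t)) * ((v - fromℚ ½ * L) - fromℚ e) +
                 fromℚ (½ ℚ.* t) * (L - (f + f))} {fromℚ (½ ℚ.* (t ℚ.* t)) * (fromℚ M - L)}
        (nonneg-+ {fromℚ (t ℚ.* (1ℚ ℚ.- t)) * ((v - fromℚ ½ * L) - fromℚ e)}
                  {fromℚ (½ ℚ.* t) * (L - (f + f))}
          (nonneg-* {fromℚ (t ℚ.* (1ℚ ℚ.- t))} {(v - fromℚ ½ * L) - fromℚ e}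
            (nonneg-const (*-nonNeg 0≤t 0≤1-t)) (≤⇒nonneg {fromℚ e} {v - fromℚ ½ * L} e≤))
          (nonneg-* {fromℚ (½ ℚ.* t)} {L - (f + f)}
            (nonneg-const (*-nonNeg 0≤½ 0≤t)) (≤⇒nonneg {f + f} {L} 2f≤L)))
        (nonneg-* {fromℚ (½ ℚ.* (t ℚ.* t))} {fromℚ M - L}
          (nonneg-const (*-nonNeg 0≤½ (*-nonNeg 0≤t 0≤t))) (≤⇒nonneg {L} {fromℚ M} L≤M)))
      (λ n → solve 6 (λ t L f v e M →
        ((t :* (con 1ℚ :- t)) :* ((v :- con ½ :* L) :- e) :+ (con ½ :* t) :* (L :- (f :+ f)))
          :+ (con ½ :* (t :* t)) :* (M :- L) :=
        ((con 1ℚ :- t) :* f :+ (t :* (con 1ℚ :- t)) :* v) :-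
          (f :+ ((t :* e :- (t :* t) :* e) :- (con ½ :* (t :* t)) :* M))) refl
        t (seq L n) (seq f n) (seq v n) e M)

-- The alternatives may overlap, as those of `≤-or-≥` do.
∀-or-∃ : ∀ {m} {P Q : Fin m → Set} → (∀ i → P i ⊎ Q i) → (∀ i → P i) ⊎ ∃ Q
∀-or-∃ {zero}  P⊎Q = inj₁ (λ ())
∀-or-∃ {suc m} P⊎Q with P⊎Q zero | ∀-or-∃ (P⊎Q ∘ suc)
... | inj₂ q | _            = inj₂ (zero , q)
... | inj₁ _ | inj₂ (i , q) = inj₂ (suc i , q)
... | inj₁ p | inj₁ ps      = inj₁ λ { zero → p ; (suc i) → ps i }

segment : ∀ {d} → ℚ → Point d → Point d → Point d
segment t x y i = fromℚ (1ℚ ℚ.- t) * x i + fromℚ t * y i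

sqdist-segment : ∀ {d} t (b x y : Point d) n → seq (sqdist b (segment t x y)) n ≡
  ((1ℚ ℚ.- t) ℚ.* seq (sqdist b x) n ℚ.+ t ℚ.* seq (sqdist b y) n) ℚ.-
  (t ℚ.* (1ℚ ℚ.- t)) ℚ.* seq (sqdist y x) n
sqdist-segment t b x y n = begin
  seq (sqdist b (segment t x y)) n
    ≡⟨ seq-sqdist b (segment t x y) n ⟩
  sqdistℚ (at b n) (at (segment t x y) n)
    ≡⟨ sqdistℚ-segment t (at b n) (at x n) (at y n) ⟩
  combination (sqdistℚ (at b n) (at x n)) (sqdistℚ (at b n) (at y n)) (sqdistℚ (at y n) (at x n))
    ≡⟨ cong (λ p → combination p (sqdistℚ (at b n) (at y n)) (sqdistℚ (at y n) (at x n)))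
         (seq-sqdist b x n) ⟨
  combination (seq (sqdist b x) n) (sqdistℚ (at b n) (at y n)) (sqdistℚ (at y n) (at x n))
    ≡⟨ cong₂ (combination (seq (sqdist b x) n)) (seq-sqdist b y n) (seq-sqdist y x n) ⟨
  combination (seq (sqdist b x) n) (seq (sqdist b y) n) (seq (sqdist y x) n) ∎
  where
  open ≡-Reasoning
  combination : ℚ → ℚ → ℚ → ℚ
  combination p q r = ((1ℚ ℚ.- t) ℚ.* p ℚ.+ t ℚ.* q) ℚ.- (t ℚ.* (1ℚ ℚ.- t)) ℚ.* r

sqdist-nonneg : ∀ {d} (x y : Point d) → 0ℝ ≤ sqdist x y
sqdist-nonneg x y = nonneg-pointwise {sqdist x y} (λ n →
  subst (0ℚ ℚ.≤_) (sym (seq-sqdist x y n)) (sqdistℚ-nonNeg (at x n) (at y n)))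

-- While some point is too far from the centre, moving the centre towards it by the fixed fraction
-- `t` raises f by at least g. The last hypothesis says that the remaining fuel would lift f to `M`,
-- which f ≤ L/2 ≤ M/2 forbids, so a good centre is met before the fuel runs out. The test lies
-- between `e` and 2`e`, where the comparison of reals is possible.
frank-wolfe : ∀ {d m} (b : Fin m → Point d) L M e t → 0ℚ ℚ.≤ t → t ℚ.≤ 1ℚ →
  0ℚ ℚ.< e → 0ℚ ℚ.< M → (∀ i j → sqdist (b i) (b j) ≤ L) → L ≤ fromℚ M →
  ∀ fuel c f → (∀ j → sqdist (b j) c + f ≤ L) → f + f ≤ L →
  fromℚ M ≤ f + fromℚ (ι fuel ℚ.*
    ((t ℚ.* e ℚ.- (t ℚ.* t) ℚ.* e) ℚ.- (½ ℚ.* (t ℚ.* t)) ℚ.* M)) →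
  ∃[ C ] ∀ i → sqdist (b i) C - fromℚ ½ * L ≤ fromℚ (e ℚ.+ e)
frank-wolfe b L M e t 0≤t t≤1 0<e 0<M b≤L L≤M zero c f I₁ I₂ M≤f =
  ⊥-elim (absurd {f} {L} I₂ L≤M M≤f)
  where
  g = (t ℚ.* e ℚ.- (t ℚ.* t) ℚ.* e) ℚ.- (½ ℚ.* (t ℚ.* t)) ℚ.* M
  absurd : ∀ {f L} → f + f ≤ L → L ≤ fromℚ M → fromℚ M ≤ f + fromℚ (0ℚ ℚ.* g) → ⊥
  absurd {f} {L} 2f≤L L≤M M≤f = pos-irrefl {fromℚ M + z}
    (λ n → solve 4 (λ M f L g →
      M :+ ((((f :+ con 0ℚ :* g) :- M) :+ ((f :+ con 0ℚ :* g) :- M)) :+ ((L :- (f :+ f)) :+ (M :- L)))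
      := con 0ℚ) refl M (seq f n) (seq L n) g)
    (pos+nonneg {fromℚ M} {z} (pos-const 0<M)
      (nonneg-+ {u + u} {(L - (f + f)) + (fromℚ M - L)}
        (nonneg-+ {u} {u} 0≤u 0≤u)
        (nonneg-+ {L - (f + f)} {fromℚ M - L} (≤⇒nonneg {f + f} {L} 2f≤L)
                                              (≤⇒nonneg {L} {fromℚ M} L≤M))))
    where
    u = (f + fromℚ (0ℚ ℚ.* g)) - fromℚ M
    z = (u + u) + ((L - (f + f)) + (fromℚ M - L))
    0≤u : 0ℝ ≤ u
    0≤u = ≤⇒nonneg {fromℚ M} {f + fromℚ (0ℚ ℚ.* g)} M≤f
frank-wolfe {d} b L M e t 0≤t t≤1 0<e 0<M b≤L L≤M (suc fuel) c f I₁ I₂ M≤f =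
  decide (∀-or-∃ (λ i → ≤-or-≥ (sqdist (b i) c - fromℚ ½ * L) e<2e))
  where
  g = (t ℚ.* e ℚ.- (t ℚ.* t) ℚ.* e) ℚ.- (½ ℚ.* (t ℚ.* t)) ℚ.* M
  e<2e : e ℚ.< e ℚ.+ e
  e<2e = subst (ℚ._< e ℚ.+ e) (ℚ.+-identityʳ e) (ℚ.+-monoʳ-< e 0<e)
  refuel : ∀ {f f′} → f + fromℚ g ≤ f′ → fromℚ M ≤ f + fromℚ (ι (suc fuel) ℚ.* g) →
    fromℚ M ≤ f′ + fromℚ (ι fuel ℚ.* g)
  refuel {f} {f′} gain M≤f = certify {fromℚ M} {f′ + fromℚ (ι fuel ℚ.* g)}
    {((f + fromℚ (ι (suc fuel) ℚ.* g)) - fromℚ M) + (f′ - (f + fromℚ g))}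
    (nonneg-+ {(f + fromℚ (ι (suc fuel) ℚ.* g)) - fromℚ M} {f′ - (f + fromℚ g)}
      (≤⇒nonneg {fromℚ M} {f + fromℚ (ι (suc fuel) ℚ.* g)} M≤f)
      (≤⇒nonneg {f + fromℚ g} {f′} gain))
    (λ n → solve 5 (λ f k g M f′ →
      ((f :+ (con 1ℚ :+ k) :* g) :- M) :+ (f′ :- (f :+ g)) := (f′ :+ k :* g) :- M) refl
      (seq f n) (ι fuel) g M (seq f′ n))
  decide : (∀ i → sqdist (b i) c - fromℚ ½ * L ≤ fromℚ (e ℚ.+ e)) ⊎
           (∃[ k ] fromℚ e ≤ sqdist (b k) c - fromℚ ½ * L) →
           ∃[ C ] ∀ i → sqdist (b i) C - fromℚ ½ * L ≤ fromℚ (e ℚ.+ e)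
  decide (inj₁ done)      = c , done
  decide (inj₂ (k , far)) = frank-wolfe b L M e t 0≤t t≤1 0<e 0<M b≤L L≤M fuel
    (segment t c (b k)) (next t f (sqdist (b k) c))
    (λ j → next-distance t 0≤t t≤1 {L} {f} {sqdist (b j) c} {sqdist (b j) (b k)} {sqdist (b k) c}
      {sqdist (b j) (segment t c (b k))} (sqdist-segment t (b j) c (b k)) (I₁ j) (b≤L j k))
    (next-bound t 0≤t t≤1 {L} {f} {sqdist (b k) c}
      (≤-trans {0ℝ} {sqdist (b k) (b k)} {L} (sqdist-nonneg (b k) (b k)) (b≤L k k)) I₂ (I₁ k))
    (refuel {f} {next t f (sqdist (b k) c)}
      (next-gain t 0≤t t≤1 {L} {f} {sqdist (b k) c} {e} {M} I₂ L≤M far) M≤f)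

0≤ι : ∀ n → 0ℚ ℚ.≤ ι n
0≤ι zero    = ℚ.≤-refl
0≤ι (suc n) = +-nonNeg (ℚ.nonNegative⁻¹ 1ℚ) (0≤ι n)

multiple-exceeds : ∀ {M g} → 0ℚ ℚ.< M → 0ℚ ℚ.< g → ∃[ N ] M ℚ.≤ ι (suc N) ℚ.* g
multiple-exceeds {M} {g} 0<M 0<g = N , subst₂ ℚ._≤_
  (trans (solve 3 (λ M i k → (M :* i) :* k := M :* (k :* i)) refl M (inv N) (ι (suc N)))
    (trans (cong (M ℚ.*_) (ι-inv N)) (ℚ.*-identityʳ M)))
  (ℚ.*-comm g (ι (suc N)))
  (ℚ.*-monoʳ-≤-nonNeg (ι (suc N)) {{ℚ.nonNegative (0≤ι (suc N))}}
    (subst (M ℚ.* inv N ℚ.≤_) (proj₂ (proj₂ δ-scale))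
      (ℚ.*-monoˡ-≤-nonNeg M {{ℚ.nonNegative (ℚ.<⇒≤ 0<M)}} (ℚ.<⇒≤ (proj₂ small N ℕ.≤-refl)))))
  where
  δ-scale = scale 0<M 0<g
  small = archimedean (proj₁ δ-scale) (proj₁ (proj₂ δ-scale))
  N = proj₁ small

jung : ∀ {d m} (b : Fin m → Point d) L → (∀ i j → sqdist (b i) (b j) ≤ L) →
  ∀ ε → 0ℚ ℚ.< ε → ∃[ C ] ∀ i → sqdist (b i) C - fromℚ ½ * L ≤ fromℚ ε
jung {m = zero}  b L b≤L ε 0<ε = (λ _ → 0ℝ) , λ ()
jung {d} {suc m} b L b≤L ε 0<ε = combine (upper-bound L)
  where
  e = ½ ℚ.* ε
  0<e = half-pos 0<ε
  combine : ∃[ M ] 0ℚ ℚ.< M × L ≤ fromℚ M →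
            ∃[ C ] ∀ i → sqdist (b i) C - fromℚ ½ * L ≤ fromℚ ε
  combine (M , 0<M , L≤M) = subst
    (λ ε → ∃[ C ] ∀ i → sqdist (b i) C - fromℚ ½ * L ≤ fromℚ ε) (halves ε)
    -- All weight starts on `b zero`, whence f = 0; the fuel is a number of gains that reaches `M`.
    (frank-wolfe b L M e t (ℚ.<⇒≤ 0<t) t≤1 0<e 0<M b≤L L≤M (suc (proj₁ steps)) (b zero) 0ℝ
      (λ j → +0 {sqdist (b j) (b zero)} {L} (b≤L j zero))
      (≤-trans {0ℝ + 0ℝ} {sqdist (b zero) (b zero)} {L}
        (sqdist-nonneg (b zero) (b zero)) (b≤L zero zero))
      (nonneg⇒≤ {fromℚ M} {0ℝ + fromℚ (ι (suc (proj₁ steps)) ℚ.* g)}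
        (nonneg-const (subst (λ z → 0ℚ ℚ.≤ z ℚ.- M) (sym (ℚ.+-identityˡ (ι (suc (proj₁ steps)) ℚ.* g)))
          (p≤q⇒0≤q-p (proj₂ steps))))))
    where
    -- The step size t = e / (M + ε), with e = ε/2, turns the quadratic losses t² e + t² M/2 into
    -- half of t e, so each step gains t e / 2.
    t-scale = scale (+-pos 0<M 0<ε) 0<e
    t = proj₁ t-scale
    0<t : 0ℚ ℚ.< t
    0<t = proj₁ (proj₂ t-scale)
    [M+ε]t≡e : (M ℚ.+ ε) ℚ.* t ≡ e
    [M+ε]t≡e = proj₂ (proj₂ t-scale)
    t≤1 : t ℚ.≤ 1ℚ
    t≤1 = ℚ.*-cancelˡ-≤-pos (M ℚ.+ ε) {{ℚ.positive (+-pos 0<M 0<ε)}}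
      (subst₂ ℚ._≤_ (sym [M+ε]t≡e) (sym (ℚ.*-identityʳ (M ℚ.+ ε)))
        (ℚ.≤-trans (ℚ.<⇒≤ (½< 0<ε)) (subst (ε ℚ.≤_) (ℚ.+-comm ε M) (≤-by-pos (ℚ.<⇒≤ 0<M)))))
    g = (t ℚ.* e ℚ.- (t ℚ.* t) ℚ.* e) ℚ.- (½ ℚ.* (t ℚ.* t)) ℚ.* M
    g≡½te : g ≡ ½ ℚ.* (t ℚ.* e)
    g≡½te = trans
      (solve 3 (λ t ε M → (t :* (con ½ :* ε) :- (t :* t) :* (con ½ :* ε)) :- (con ½ :* (t :* t)) :* M
        := t :* (con ½ :* ε) :- (con ½ :* t) :* ((M :+ ε) :* t)) refl t ε M)
      (trans (cong (λ z → t ℚ.* e ℚ.- (½ ℚ.* t) ℚ.* z) [M+ε]t≡e)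
        (solve 2 (λ t e → t :* e :- (con ½ :* t) :* e := con ½ :* (t :* e)) refl t e))
    0<g : 0ℚ ℚ.< g
    0<g = subst (0ℚ ℚ.<_) (sym g≡½te) (half-pos (*-pos 0<t 0<e))
    steps = multiple-exceeds 0<M 0<g
    +0 : ∀ {x y} → x ≤ y → x + 0ℝ ≤ y
    +0 {x} {y} x≤y = ≤-trans {x + 0ℝ} {x} {y}
      (≈⇒≤ {x + 0ℝ} {x} (pointwise {x + 0ℝ} {x} (λ n → ℚ.+-identityʳ (seq x n)))) x≤y

-- Colours as overlapping windows

-- The interval from (k - 1)δ to (k + 1)δ. Neighbouring windows overlap in an interval of length δ,
-- within which `≤-or-≥` is free to choose either one.
Window : ℚ → ℕ → ℝ → Set
Window δ k x = fromℚ (ι k ℚ.* δ ℚ.- δ) ≤ x × x ≤ fromℚ (ι (suc k) ℚ.* δ)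

window : ∀ {δ} → 0ℚ ℚ.< δ → ∀ R x → 0ℝ ≤ x → x ≤ fromℚ (ι (suc R) ℚ.* δ) →
  Σ[ j ∈ Fin (suc R) ] Window δ (toℕ j) x
window {δ} 0<δ zero x 0≤x x≤ = zero , ≤-trans {fromℚ (0ℚ ℚ.* δ ℚ.- δ)} {0ℝ} {x}
  (nonneg⇒≤ {fromℚ (0ℚ ℚ.* δ ℚ.- δ)} {0ℝ} (nonneg-const (subst (0ℚ ℚ.≤_)
    (solve 1 (λ δ → δ := con 0ℚ :- (con 0ℚ :* δ :- δ)) refl δ) (ℚ.<⇒≤ 0<δ)))) 0≤x , x≤
window {δ} 0<δ (suc R) x 0≤x x≤ = decide (≤-or-≥ x below)
  where
  below : ι (suc R) ℚ.* δ ℚ.- δ ℚ.< ι (suc R) ℚ.* δ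
  below = subst (ι (suc R) ℚ.* δ ℚ.- δ ℚ.<_) (ℚ.+-identityʳ (ι (suc R) ℚ.* δ))
    (ℚ.+-monoʳ-< (ι (suc R) ℚ.* δ) (ℚ.neg-antimono-< 0<δ))
  decide : x ≤ fromℚ (ι (suc R) ℚ.* δ) ⊎ fromℚ (ι (suc R) ℚ.* δ ℚ.- δ) ≤ x →
           Σ[ j ∈ Fin (suc (suc R)) ] Window δ (toℕ j) x
  decide (inj₁ x≤′) = lift (window 0<δ R x 0≤x x≤′)
    where
    lift : Σ[ j ∈ Fin (suc R) ] Window δ (toℕ j) x → Σ[ j ∈ Fin (suc (suc R)) ] Window δ (toℕ j) x
    lift (j , w) = inject₁ j , subst (λ k → Window δ k x) (sym (toℕ-inject₁ j)) w
  decide (inj₂ ≤x) = fromℕ (suc R) ,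
    subst (λ k → Window δ k x) (sym (toℕ-fromℕ (suc R))) (≤x , x≤)

window-width : ∀ {δ} k {x y} → Window δ k x → Window δ k y → x ≤ y + fromℚ (δ ℚ.+ δ)
window-width {δ} k {x} {y} (_ , x≤) (≤y , _) = certify {x} {y + fromℚ (δ ℚ.+ δ)}
  {(fromℚ (ι (suc k) ℚ.* δ) - x) + (y - fromℚ (ι k ℚ.* δ ℚ.- δ))}
  (nonneg-+ {fromℚ (ι (suc k) ℚ.* δ) - x} {y - fromℚ (ι k ℚ.* δ ℚ.- δ)}
    (≤⇒nonneg {x} {fromℚ (ι (suc k) ℚ.* δ)} x≤) (≤⇒nonneg {fromℚ (ι k ℚ.* δ ℚ.- δ)} {y} ≤y))
  (λ n → solve 4 (λ x y k δ →
    ((con 1ℚ :+ k) :* δ :- x) :+ (y :- (k :* δ :- δ)) := (y :+ (δ :+ δ)) :- x) refl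
    (seq x n) (seq y n) (ι k) δ)

-- Square roots

√-nonneg : ∀ x → 0ℝ ≤ √ x
√-nonneg x = nonneg-pointwise {√ x} (λ n → Approximates.nonNeg (√approx-correct n (seq x n)))

-- An approximation s with s² ≤ q < (s + h)² and h ≤ 1 has squared error at most 2sh + h² ≤ (2S +
-- 1)h, where `S` bounds the approximations and h = 1/(n + 1).
√-square : ∀ {x} → (∀ n → 0ℚ ℚ.≤ seq x n) → √ x * √ x ≈ x
√-square {x} 0≤x ε 0<ε = combine (bounded (seq (√ x)) (cauchy (√ x)))
  where
  error : ∀ {s h q S} → Approximates s h q → 0ℚ ℚ.≤ q → 0ℚ ℚ.≤ h → h ℚ.≤ 1ℚ → s ℚ.≤ S →
    ℚ.∣ s ℚ.* s ℚ.- q ∣ ℚ.≤ ((S ℚ.+ S) ℚ.+ 1ℚ) ℚ.* h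
  error {s} {h} {q} {S} approx 0≤q 0≤h h≤1 s≤S = ≤⇒∣∣≤
    (0≤q-p⇒p≤q (subst (0ℚ ℚ.≤_)
      (solve 4 (λ s h q S → ((S :+ S) :+ con 1ℚ) :* h :+ (q :- s :* s) :=
                            ((S :+ S) :+ con 1ℚ) :* h :- (s :* s :- q)) refl s h q S)
      (+-nonNeg (*-nonNeg (+-nonNeg (+-nonNeg 0≤S 0≤S) (ℚ.nonNegative⁻¹ 1ℚ)) 0≤h)
                (p≤q⇒0≤q-p s²≤q))))
    (0≤q-p⇒p≤q (subst (0ℚ ℚ.≤_)
      (solve 4 (λ s h q S →
        (((s :+ h) :* (s :+ h) :- q) :+ (h :* (con 1ℚ :- h))) :+ ((h :+ h) :* (S :- s)) :=
        ((S :+ S) :+ con 1ℚ) :* h :- (:- (s :* s :- q))) refl s h q S)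
      (+-nonNeg (+-nonNeg (p≤q⇒0≤q-p (ℚ.<⇒≤ upper)) (*-nonNeg 0≤h (p≤q⇒0≤q-p h≤1)))
                (*-nonNeg (+-nonNeg 0≤h 0≤h) (p≤q⇒0≤q-p s≤S)))))
    where
    open Approximates approx
    0≤S = ℚ.≤-trans nonNeg s≤S
    s²≤q : s ℚ.* s ℚ.≤ q
    s²≤q with lower
    ... | inj₁ le  = le
    -- The default value 0 of the search still satisfies s² ≤ q, as q is nonnegative.
    ... | inj₂ s≡0 = subst (ℚ._≤ q)
      (trans (sym (ℚ.*-zeroˡ s)) (cong (ℚ._* s) (sym s≡0))) 0≤q
  combine : ∃[ S ] 0ℚ ℚ.< S × (∃[ N ] ∀ n → N ℕ.≤ n → ℚ.∣ seq (√ x) n ∣ ℚ.≤ S) →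
    ∃[ N ] ∀ n → N ℕ.≤ n → ℚ.∣ seq (√ x * √ x) n ℚ.- seq x n ∣ ℚ.< ε
  combine (S , 0<S , bound) = eventually₂
    (λ n (s≤S , small) h≤1 → ℚ.≤-<-trans
      (error {seq (√ x) n} {inv n} {seq x n} {S} (√approx-correct n (seq x n)) (0≤x n) (/-nonNeg n 1)
        (ℚ.<⇒≤ h≤1) (∣∣≤⇒≤ s≤S))
      (subst (((S ℚ.+ S) ℚ.+ 1ℚ) ℚ.* inv n ℚ.<_) (proj₂ (proj₂ δ-scale))
        (ℚ.*-monoʳ-<-pos ((S ℚ.+ S) ℚ.+ 1ℚ) {{ℚ.positive 0<2S+1}} small)))
    (eventually-× bound (archimedean (proj₁ δ-scale) (proj₁ (proj₂ δ-scale))))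
    (archimedean 1ℚ (ℚ.positive⁻¹ 1ℚ))
    where
    0<2S+1 = +-pos (+-pos 0<S 0<S) (ℚ.positive⁻¹ 1ℚ)
    δ-scale = scale 0<2S+1 0<ε

√-cancel-≤ : ∀ {x y} → (∀ n → 0ℚ ℚ.≤ seq x n) → (∀ n → 0ℚ ℚ.≤ seq y n) → √ x ≤ √ y → x ≤ y
√-cancel-≤ {x} {y} 0≤x 0≤y √x≤√y = ≤-trans {x} {√ x * √ x} {y}
  (≈⇒≥ {√ x * √ x} {x} (√-square {x} 0≤x))
  (≤-trans {√ x * √ x} {√ y * √ y} {y}
    (square-mono {√ x} {√ y} (√-nonneg x) (√-nonneg y) √x≤√y)
    (≈⇒≤ {√ y * √ y} {y} (√-square {y} 0≤y)))
  where
  square-mono : ∀ {a b} → 0ℝ ≤ a → 0ℝ ≤ b → a ≤ b → a * a ≤ b * b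
  square-mono {a} {b} 0≤a 0≤b a≤b = certify {a * a} {b * b} {(a + b) * (b - a)}
    (nonneg-* {a + b} {b - a} (nonneg-+ {a} {b} 0≤a 0≤b) (≤⇒nonneg {a} {b} a≤b))
    (λ n → solve 2 (λ a b → (a :+ b) :* (b :- a) := b :* b :- a :* a) refl (seq a n) (seq b n))

√-injective : ∀ {x y} → (∀ n → 0ℚ ℚ.≤ seq x n) → (∀ n → 0ℚ ℚ.≤ seq y n) → √ x ≈ √ y → x ≈ y
√-injective {x} {y} 0≤x 0≤y √x≈√y = ≤-antisym {x} {y}
  (√-cancel-≤ {x} {y} 0≤x 0≤y (≈⇒≤ {√ x} {√ y} √x≈√y))
  (√-cancel-≤ {y} {x} 0≤y 0≤x (≈⇒≥ {√ x} {√ y} √x≈√y))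

√-mono-≤ : ∀ {x y} → x ≤ y → √ x ≤ √ y
√-mono-≤ {x} {y} x≤y ε 0<ε = eventually₂
  (λ n x≤ h< → ℚ.<⇒≤ (subst (λ z → seq (√ x) n ℚ.< seq (√ y) n ℚ.+ z) (halves ε)
    (approx-close {seq (√ y) n} {seq (√ x) n} {inv n} {inv n} {seq y n} {seq x n} {e} 0<e
      (√approx-correct n (seq y n)) (/-nonNeg n 1) (ℚ.<⇒≤ h<)
      (√approx-correct n (seq x n)) (near n x≤))))
  (x≤y (½ ℚ.* (e ℚ.* e)) (half-pos (*-pos 0<e 0<e)))
  (archimedean e 0<e)
  where
  e = ½ ℚ.* ε
  0<e = half-pos 0<ε
  near : ∀ n → seq x n ℚ.≤ seq y n ℚ.+ ½ ℚ.* (e ℚ.* e) → seq x n ℚ.- seq y n ℚ.< e ℚ.* e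
  near n le = ℚ.≤-<-trans
    (0≤q-p⇒p≤q (subst (0ℚ ℚ.≤_)
      (solve 3 (λ x y f → (y :+ f) :- x := f :- (x :- y)) refl
        (seq x n) (seq y n) (½ ℚ.* (e ℚ.* e)))
      (p≤q⇒0≤q-p le)))
    (½< (*-pos 0<e 0<e))

-- From the angle to a strict polynomial inequality

-- Squaring c √p √q = s gives 2s² - pq = (2c² - 1)pq.
angle-gap : ∀ {p q s c} → (∀ n → 0ℚ ℚ.≤ seq p n) → (∀ n → 0ℚ ℚ.≤ seq q n) →
  0ℝ < - c → 0ℝ < (c * c + c * c) - 1ℝ → c * (√ p * √ q) ≈ s →
  0ℝ ≤ - s × (0ℝ < p → 0ℝ < q → 0ℝ < (s * s + s * s) - p * q)
angle-gap {p} {q} {s} {c} 0≤p 0≤q 0<-c 0<2c²-1 c√p√q≈s = 0≤-s , gap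
  where
  a = √ p
  b = √ q
  negate : ∀ c a b → (- c) * (a * b) ≈ - (c * (a * b))
  negate c a b = pointwise {(- c) * (a * b)} { - (c * (a * b))} (λ n →
    sym (ℚ.neg-distribˡ-* (seq c n) (seq (a * b) n)))
  0≤-s : 0ℝ ≤ - s
  0≤-s = ≈-nonneg {(- c) * (a * b)} { - s}
    (≈-trans {(- c) * (a * b)} { - (c * (a * b))} { - s} (negate c a b)
      (neg-cong {c * (a * b)} {s} c√p√q≈s))
    (nonneg-* { - c} {a * b} (pos⇒nonneg { - c} 0<-c)
      (nonneg-* {a} {b} (√-nonneg p) (√-nonneg q)))
  rearrange : ∀ {a b c p q s} → a * a ≈ p → b * b ≈ q → c * (a * b) ≈ s →
    ((c * c + c * c) - 1ℝ) * (p * q) ≈ (s * s + s * s) - p * q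
  rearrange {a} {b} {c} {p} {q} {s} a²≈p b²≈q cab≈s =
    ≈-trans {((c * c + c * c) - 1ℝ) * (p * q)} {(c * c + c * c) * (p * q) - p * q}
      {(s * s + s * s) - p * q}
      (pointwise {((c * c + c * c) - 1ℝ) * (p * q)} {(c * c + c * c) * (p * q) - p * q} (λ n →
        solve 2 (λ d z → (d :- con 1ℚ) :* z := d :* z :- z) refl
          (seq (c * c + c * c) n) (seq (p * q) n)))
      (+-cong {(c * c + c * c) * (p * q)} {s * s + s * s} { - (p * q)} { - (p * q)}
        (≈-trans {(c * c + c * c) * (p * q)} {(c * c + c * c) * ((a * a) * (b * b))} {s * s + s * s}
          (*-congˡ (c * c + c * c) {p * q} {(a * a) * (b * b)}
            (*-cong {p} {a * a} {q} {b * b} (≈-sym {a * a} {p} a²≈p) (≈-sym {b * b} {q} b²≈q)))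
          (≈-trans {(c * c + c * c) * ((a * a) * (b * b))}
            {(c * (a * b)) * (c * (a * b)) + (c * (a * b)) * (c * (a * b))} {s * s + s * s}
            (pointwise {(c * c + c * c) * ((a * a) * (b * b))}
              {(c * (a * b)) * (c * (a * b)) + (c * (a * b)) * (c * (a * b))} (λ n →
              solve 3 (λ a b c → (c :* c :+ c :* c) :* ((a :* a) :* (b :* b)) :=
                (c :* (a :* b)) :* (c :* (a :* b)) :+ (c :* (a :* b)) :* (c :* (a :* b))) refl
                (seq a n) (seq b n) (seq c n)))
            (+-cong {(c * (a * b)) * (c * (a * b))} {s * s} {(c * (a * b)) * (c * (a * b))} {s * s}
              (*-cong {c * (a * b)} {s} {c * (a * b)} {s} cab≈s cab≈s)
              (*-cong {c * (a * b)} {s} {c * (a * b)} {s} cab≈s cab≈s))))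
        (≈-refl { - (p * q)}))
  gap : 0ℝ < p → 0ℝ < q → 0ℝ < (s * s + s * s) - p * q
  gap 0<p 0<q = ≈-pos {((c * c + c * c) - 1ℝ) * (p * q)} {(s * s + s * s) - p * q}
    (rearrange {a} {b} {c} {p} {q} {s} (√-square {p} 0≤p) (√-square {q} 0≤q) c√p√q≈s)
    (pos-* {(c * c + c * c) - 1ℝ} {p * q} 0<2c²-1 (pos-* {p} {q} 0<p 0<q))

-- If e is a positive lower bound of x and `M` an upper bound of y, then ε = e / (2M) leaves at
-- least e/2. It fixes the tolerance for all errors of the geometric argument.
pos-slack : ∀ {x} → 0ℝ < x → ∀ y → ∃[ ε ] 0ℚ ℚ.< ε × 0ℝ < x - fromℚ ε * y
pos-slack {x} (e , 0<e , N , e≤x) y = combine (upper-bound y)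
  where
  combine : ∃[ M ] 0ℚ ℚ.< M × y ≤ fromℚ M → ∃[ ε ] 0ℚ ℚ.< ε × 0ℝ < x - fromℚ ε * y
  combine (M , 0<M , y≤M) = ε , 0<ε , ≈-pos {fromℚ (½ ℚ.* e) + z} {x - fromℚ ε * y}
    (pointwise {fromℚ (½ ℚ.* e) + z} {x - fromℚ ε * y} (λ n → trans
      (cong (λ f → f ℚ.+ ((seq x n ℚ.- e) ℚ.+ ε ℚ.* (M ℚ.- seq y n)))
        (solve 1 (λ e → con ½ :* e := e :- con ½ :* e) refl e))
      (trans (cong (λ f → (e ℚ.- f) ℚ.+ ((seq x n ℚ.- e) ℚ.+ ε ℚ.* (M ℚ.- seq y n)))
               (sym (proj₂ (proj₂ ε-scale))))
        (solve 5 (λ e M ε x y → (e :- M :* ε) :+ ((x :- e) :+ ε :* (M :- y)) := x :- ε :* y) refl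
          e M ε (seq x n) (seq y n)))))
    (pos+nonneg {fromℚ (½ ℚ.* e)} {z} (pos-const (half-pos 0<e))
      (nonneg-+ {x - fromℚ e} {fromℚ ε * (fromℚ M - y)}
        (≤⇒nonneg {fromℚ e} {x} (λ δ 0<δ → N , λ n N≤n → ℚ.≤-trans
          (subst (ℚ._≤ seq x n) (ℚ.+-identityˡ e) (e≤x n N≤n)) (≤-by-pos (ℚ.<⇒≤ 0<δ))))
        (nonneg-* {fromℚ ε} {fromℚ M - y} (nonneg-const (ℚ.<⇒≤ 0<ε)) (≤⇒nonneg {y} {fromℚ M} y≤M))))
    where
    ε-scale = scale 0<M (half-pos 0<e)
    ε = proj₁ ε-scale
    0<ε : 0ℚ ℚ.< ε
    0<ε = proj₁ (proj₂ ε-scale)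
    z = (x - fromℚ e) + fromℚ ε * (fromℚ M - y)

-- The circumradius inequality over the reals

spreadℝ : (k a c p q r u v t : ℝ) → ℝ
spreadℝ k a c p q r u v t =
  ((k * k) * u - (k * a) * ((p + u) - v) - (k * c) * ((q + u) - t))
  + ((a * a) * p + (c * c) * q + (a * c) * ((p + q) - r))

spreadℝ-cong : ∀ {k a c p q r p′ q′ r′ u v t} → p ≈ p′ → q ≈ q′ → r ≈ r′ →
  0ℝ ≤ spreadℝ k a c p q r u v t → 0ℝ ≤ spreadℝ k a c p′ q′ r′ u v t
spreadℝ-cong {k} {a} {c} {p} {q} {r} {p′} {q′} {r′} {u} {v} {t} p≈ q≈ r≈ 0≤ =
  ≈-nonneg {spreadℝ k a c p q r u v t + (α * (p′ - p) + (β * (q′ - q) + κ * (r - r′)))}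
           {spreadℝ k a c p′ q′ r′ u v t}
    (pointwise {spreadℝ k a c p q r u v t + (α * (p′ - p) + (β * (q′ - q) + κ * (r - r′)))}
               {spreadℝ k a c p′ q′ r′ u v t} (λ n →
      solve 12 (λ k a c p q r p′ q′ r′ u v t →
        spread-polynomial k a c p q r u v t :+
          (((a :* a :+ a :* c) :- k :* a) :* (p′ :- p) :+
          (((c :* c :+ a :* c) :- k :* c) :* (q′ :- q) :+ (a :* c) :* (r :- r′))) :=
        spread-polynomial k a c p′ q′ r′ u v t) refl
        (seq k n) (seq a n) (seq c n) (seq p n) (seq q n) (seq r n)
        (seq p′ n) (seq q′ n) (seq r′ n) (seq u n) (seq v n) (seq t n)))
    (nonneg-+ {spreadℝ k a c p q r u v t} {α * (p′ - p) + (β * (q′ - q) + κ * (r - r′))} 0≤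
      (nonneg-+ {α * (p′ - p)} {β * (q′ - q) + κ * (r - r′)}
        (vanishing α {p′} {p} (≈-sym {p} {p′} p≈))
        (nonneg-+ {β * (q′ - q)} {κ * (r - r′)}
          (vanishing β {q′} {q} (≈-sym {q} {q′} q≈)) (vanishing κ {r} {r′} r≈))))
  where
  -- The coefficients of `p`, `q` and, up to sign, `r` in the linear form `spreadℝ`.
  α = (a * a + a * c) - k * a
  β = (c * c + a * c) - k * c
  κ = a * c
  vanishing : ∀ w {x y} → x ≈ y → 0ℝ ≤ w * (x - y)
  vanishing w {x} {y} x≈y = ≈-nonneg {w * y - w * y} {w * (x - y)}
    (≈-trans {w * y - w * y} {w * x - w * y} {w * (x - y)}
      (+-cong {w * y} {w * x} { - (w * y)} { - (w * y)}
        (*-congˡ w {y} {x} (≈-sym {x} {y} x≈y)) (≈-refl { - (w * y)}))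
      (pointwise {w * x - w * y} {w * (x - y)} (λ n → solve 3
        (λ w x y → w :* x :- w :* y := w :* (x :- y)) refl (seq w n) (seq x n) (seq y n))))
    (nonneg-pointwise {w * y - w * y} (λ n → ℚ.≤-reflexive (sym (ℚ.+-inverseʳ (seq (w * y) n)))))

-- The vector (a / k)(x - y) + (c / k)(z - y) points from y towards the
-- circumcentre, 2 sin² times as far, for the angle at y; unlike the barycentric
-- coordinates of the circumcentre, a / k and c / k stay bounded as the triangle
-- degenerates.
module Weights (p q s : ℝ) where
  k a c r : ℝ
  k = p * q
  a = q * (p - s)
  c = p * (q - s)
  r = (p + q) - (s + s)

  -- The squared length `spreadℝ` takes the value -`gap` at u = v = t = r/2, a point equidistant
  -- from the vertices at distance √(r/2); `cost` is the total coefficient of ε once these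
  -- equalities hold only up to ε.
  gap cost : ℝ
  gap  = fromℚ ½ * (((p * q) * r) * ((s * s + s * s) - p * q))
  cost = (k * k + k * a) + k * c

  gap-pos : 0ℝ < p → 0ℝ < q → 0ℝ ≤ - s → 0ℝ < (s * s + s * s) - p * q → 0ℝ < gap
  gap-pos 0<p 0<q 0≤-s 0<2s²-pq =
    pos-* {fromℚ ½} {((p * q) * r) * ((s * s + s * s) - p * q)} (pos-const (ℚ.positive⁻¹ ½))
      (pos-* {(p * q) * r} {(s * s + s * s) - p * q}
        (pos-* {p * q} {r} (pos-* {p} {q} 0<p 0<q)
          (≈-pos {(p + q) + ((- s) + (- s))} {r}
            (pointwise {(p + q) + ((- s) + (- s))} {r} (λ n → solve 2
              (λ t s → t :+ ((:- s) :+ (:- s)) := t :- (s :+ s)) refl (seq (p + q) n) (seq s n)))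
            (pos+nonneg {p + q} {(- s) + (- s)} (pos+nonneg {p} {q} 0<p (pos⇒nonneg {q} 0<q))
              (nonneg-+ { - s} { - s} 0≤-s 0≤-s))))
        0<2s²-pq)

  -- The squared length `spreadℝ` would be at most ε `cost` - `gap`, which is negative. One-sided
  -- bounds on v and t suffice because they enter with the weights k a and k c, nonnegative as s ≤
  -- 0.
  no-common-shell : 0ℝ ≤ p → 0ℝ ≤ q → 0ℝ ≤ - s → ∀ ε u v t →
    0ℝ < gap - fromℚ ε * cost → u - fromℚ ½ * r ≤ fromℚ ε →
    v ≤ u + fromℚ ε → t ≤ u + fromℚ ε → 0ℝ ≤ spreadℝ k a c p q r u v t → ⊥
  no-common-shell 0≤p 0≤q 0≤-s ε u v t slack u≤ v≤ t≤ 0≤spread =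
    pos-irrefl {(gap - fromℚ ε * cost) + total}
      (λ n → solve 7 (λ p q s ε u v t →
        let k = p :* q
            a = q :* (p :- s)
            c = p :* (q :- s)
            r = (p :+ q) :- (s :+ s)
        in (con ½ :* (((p :* q) :* r) :* ((s :* s :+ s :* s) :- p :* q)) :-
             ε :* ((k :* k :+ k :* a) :+ k :* c)) :+
           (spread-polynomial k a c p q r u v t :+
             ((k :* k) :* (ε :- (u :- con ½ :* r)) :+
              ((k :* a) :* ((u :+ ε) :- v) :+ (k :* c) :* ((u :+ ε) :- t)))) := con 0ℚ) refl
        (seq p n) (seq q n) (seq s n) ε (seq u n) (seq v n) (seq t n))
      (pos+nonneg {gap - fromℚ ε * cost} {total} slack
        (nonneg-+ {spreadℝ k a c p q r u v t}
            {(k * k) * (fromℚ ε - (u - fromℚ ½ * r)) +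
             ((k * a) * ((u + fromℚ ε) - v) + (k * c) * ((u + fromℚ ε) - t))} 0≤spread
          (nonneg-+ {(k * k) * (fromℚ ε - (u - fromℚ ½ * r))}
              {(k * a) * ((u + fromℚ ε) - v) + (k * c) * ((u + fromℚ ε) - t)}
            (nonneg-* {k * k} {fromℚ ε - (u - fromℚ ½ * r)} (nonneg-square k)
              (≤⇒nonneg {u - fromℚ ½ * r} {fromℚ ε} u≤))
            (nonneg-+ {(k * a) * ((u + fromℚ ε) - v)} {(k * c) * ((u + fromℚ ε) - t)}
              (nonneg-* {k * a} {(u + fromℚ ε) - v}
                (nonneg-* {k} {a} 0≤k (nonneg-* {q} {p - s} 0≤q (nonneg-+ {p} { - s} 0≤p 0≤-s)))
                (≤⇒nonneg {v} {u + fromℚ ε} v≤))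
              (nonneg-* {k * c} {(u + fromℚ ε) - t}
                (nonneg-* {k} {c} 0≤k (nonneg-* {p} {q - s} 0≤p (nonneg-+ {q} { - s} 0≤q 0≤-s)))
                (≤⇒nonneg {t} {u + fromℚ ε} t≤))))))
    where
    total = spreadℝ k a c p q r u v t +
      ((k * k) * (fromℚ ε - (u - fromℚ ½ * r)) +
       ((k * a) * ((u + fromℚ ε) - v) + (k * c) * ((u + fromℚ ε) - t)))
    0≤k : 0ℝ ≤ k
    0≤k = nonneg-* {p} {q} 0≤p 0≤q

-- Triangles

sqdistℚ-comm : ∀ {d} (x y : Fin d → ℚ) → sqdistℚ x y ≡ sqdistℚ y x
sqdistℚ-comm {zero}  x y = refl
sqdistℚ-comm {suc d} x y = cong₂ ℚ._+_
  (solve 2 (λ x y → (x :- y) :* (x :- y) := (y :- x) :* (y :- x)) refl (x zero) (y zero))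
  (sqdistℚ-comm (x ∘ suc) (y ∘ suc))

sqdistℚ-self : ∀ {d} (x : Fin d → ℚ) → sqdistℚ x x ≡ 0ℚ
sqdistℚ-self {zero}  x = refl
sqdistℚ-self {suc d} x = trans
  (cong ((x zero ℚ.- x zero) ℚ.* (x zero ℚ.- x zero) ℚ.+_) (sqdistℚ-self (x ∘ suc)))
  (solve 1 (λ x → (x :- x) :* (x :- x) :+ con 0ℚ := con 0ℚ) refl (x zero))

law-of-cosinesℚ : ∀ {d} (x y z : Fin d → ℚ) → let s = ∑ (λ i → (x i ℚ.- y i) ℚ.* (z i ℚ.- y i)) in
  sqdistℚ x z ≡ (sqdistℚ x y ℚ.+ sqdistℚ z y) ℚ.- (s ℚ.+ s)
law-of-cosinesℚ {zero}  x y z = refl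
law-of-cosinesℚ {suc d} x y z = trans
  (cong ((x zero ℚ.- z zero) ℚ.* (x zero ℚ.- z zero) ℚ.+_)
    (law-of-cosinesℚ (x ∘ suc) (y ∘ suc) (z ∘ suc)))
  (solve 6 (λ x y z p q s →
    (x :- z) :* (x :- z) :+ ((p :+ q) :- (s :+ s)) :=
    (((x :- y) :* (x :- y) :+ p) :+ ((z :- y) :* (z :- y) :+ q)) :-
    (((x :- y) :* (z :- y) :+ s) :+ ((x :- y) :* (z :- y) :+ s))) refl
    (x zero) (y zero) (z zero) (sqdistℚ (x ∘ suc) (y ∘ suc)) (sqdistℚ (z ∘ suc) (y ∘ suc))
    (∑ (λ i → (x (suc i) ℚ.- y (suc i)) ℚ.* (z (suc i) ℚ.- y (suc i)))))

coordinate≤sqdistℚ : ∀ {d} (x y : Fin d → ℚ) i →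
  (x i ℚ.- y i) ℚ.* (x i ℚ.- y i) ℚ.≤ sqdistℚ x y
coordinate≤sqdistℚ x y zero    = ≤-by-pos (sqdistℚ-nonNeg (x ∘ suc) (y ∘ suc))
coordinate≤sqdistℚ x y (suc i) = ℚ.≤-trans (coordinate≤sqdistℚ (x ∘ suc) (y ∘ suc) i)
  (subst (ℚ._≤ sqdistℚ x y) (ℚ.+-identityˡ (sqdistℚ (x ∘ suc) (y ∘ suc)))
    (ℚ.+-monoˡ-≤ (sqdistℚ (x ∘ suc) (y ∘ suc)) (square-nonNeg (x zero ℚ.- y zero))))

sqdist-comm : ∀ {d} (x y : Point d) → sqdist x y ≈ sqdist y x
sqdist-comm x y = pointwise {sqdist x y} {sqdist y x} (λ n →
  trans (seq-sqdist x y n) (trans (sqdistℚ-comm (at x n) (at y n)) (sym (seq-sqdist y x n))))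

sqdist-seq-nonNeg : ∀ {d} (x y : Point d) n → 0ℚ ℚ.≤ seq (sqdist x y) n
sqdist-seq-nonNeg x y n = subst (0ℚ ℚ.≤_) (sym (seq-sqdist x y n)) (sqdistℚ-nonNeg (at x n) (at y n))

sqdist-self-≤ : ∀ {d} (x : Point d) {y} → 0ℝ ≤ y → sqdist x x ≤ y
sqdist-self-≤ x {y} 0≤y = ≤-trans {sqdist x x} {0ℝ} {y}
  (≈⇒≤ {sqdist x x} {0ℝ} (pointwise {sqdist x x} {0ℝ} (λ n →
    trans (seq-sqdist x x n) (sqdistℚ-self (at x n))))) 0≤y

law-of-cosines : ∀ {d} (x y z : Point d) → let s = (x -ₚ y) ∙ (z -ₚ y) in
  sqdist x z ≈ (sqdist x y + sqdist z y) - (s + s)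
law-of-cosines x y z = pointwise {sqdist x z}
  {(sqdist x y + sqdist z y) - ((x -ₚ y) ∙ (z -ₚ y) + (x -ₚ y) ∙ (z -ₚ y))} (λ n → trans
  (seq-sqdist x z n) (trans (law-of-cosinesℚ (at x n) (at y n) (at z n))
    (sym (cong₂ ℚ._-_ (cong₂ ℚ._+_ (seq-sqdist x y n) (seq-sqdist z y n))
      (cong (λ s → s ℚ.+ s) (seq-foldr (zipWith _*_ (x -ₚ y) (z -ₚ y)) n))))))

square-cancel-≤ : ∀ p {e} → 0ℚ ℚ.≤ e → p ℚ.* p ℚ.≤ e ℚ.* e → ℚ.∣ p ∣ ℚ.≤ e
square-cancel-≤ p {e} 0≤e p²≤e² with ℚ.∣ p ∣ ℚ.≤? e
... | yes ∣p∣≤e = ∣p∣≤e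
... | no ∣p∣≰e = ⊥-elim (ℚ.<-irrefl refl (begin-strict
    e ℚ.* e                ≤⟨ ℚ.*-monoˡ-≤-nonNeg e {{ℚ.nonNegative 0≤e}} (ℚ.<⇒≤ e<∣p∣) ⟩
    e ℚ.* ℚ.∣ p ∣          <⟨ ℚ.*-monoˡ-<-pos ℚ.∣ p ∣ {{ℚ.positive (ℚ.≤-<-trans 0≤e e<∣p∣)}} e<∣p∣ ⟩
    ℚ.∣ p ∣ ℚ.* ℚ.∣ p ∣    ≡⟨ ℚ.∣p*q∣≡∣p∣*∣q∣ p p ⟨
    ℚ.∣ p ℚ.* p ∣          ≡⟨ ℚ.0≤p⇒∣p∣≡p (square-nonNeg p) ⟩
    p ℚ.* p                ≤⟨ p²≤e² ⟩
    e ℚ.* e                ∎))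
  where
  open ℚ.≤-Reasoning
  e<∣p∣ = ℚ.≰⇒> ∣p∣≰e

sqdist≤0⇒≈ₚ : ∀ {d} (x y : Point d) → sqdist x y ≤ 0ℝ → x ≈ₚ y
sqdist≤0⇒≈ₚ x y ≤0 i ε 0<ε = eventually
  (λ n le → ℚ.≤-<-trans
    (square-cancel-≤ (seq (x i) n ℚ.- seq (y i) n) (ℚ.<⇒≤ 0<e)
      (ℚ.≤-trans (coordinate≤sqdistℚ (at x n) (at y n) i)
        (subst₂ ℚ._≤_ (seq-sqdist x y n) (ℚ.+-identityˡ (e ℚ.* e)) le)))
    (½< 0<ε))
  (≤0 (e ℚ.* e) (*-pos 0<e 0<e))
  where
  e = ½ ℚ.* ε
  0<e = half-pos 0<ε

spreadℝ-nonneg : ∀ {d} (x y z w : Point d) k a c →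
  0ℝ ≤ spreadℝ k a c (sqdist x y) (sqdist z y) (sqdist x z) (sqdist y w) (sqdist x w) (sqdist z w)
spreadℝ-nonneg x y z w k a c = nonneg-pointwise
  {spreadℝ k a c (sqdist x y) (sqdist z y) (sqdist x z) (sqdist y w) (sqdist x w) (sqdist z w)}
  (λ n → subst (0ℚ ℚ.≤_)
    (replace (seq k n) (seq a n) (seq c n)
      (sym (seq-sqdist x y n)) (sym (seq-sqdist z y n)) (sym (seq-sqdist x z n))
      (trans (sqdistℚ-comm (at w n) (at y n)) (sym (seq-sqdist y w n)))
      (trans (sqdistℚ-comm (at w n) (at x n)) (sym (seq-sqdist x w n)))
      (trans (sqdistℚ-comm (at w n) (at z n)) (sym (seq-sqdist z w n))))
    (spread-nonNeg (at x n) (at y n) (at z n) (at w n) (seq k n) (seq a n) (seq c n)))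
  where
  replace : ∀ k a c {p q r u v t p′ q′ r′ u′ v′ t′} →
    p ≡ p′ → q ≡ q′ → r ≡ r′ → u ≡ u′ → v ≡ v′ → t ≡ t′ →
    spread k a c p q r u v t ≡ spread k a c p′ q′ r′ u′ v′ t′
  replace k a c refl refl refl refl refl refl = refl

-- The common diameter is given only as a supremum: √ρ bounds the distances in Q, hence also the
-- least bound `D`, which bounds those in P.
diameter-≤ : ∀ {d e k l} (P : PointSet d k) (Q : PointSet e l) → SameDiameter P Q →
  ∀ {ρ} → (∀ n → 0ℚ ℚ.≤ seq ρ n) → (∀ i j → sqdist (point Q i) (point Q j) ≤ ρ) →
  ∀ i j → sqdist (point P i) (point P j) ≤ ρ
diameter-≤ P Q (D , (P≤D , _) , (_ , D-least)) {ρ} 0≤ρ Q≤ρ i j =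
  √-cancel-≤ {sqdist (point P i) (point P j)} {ρ} (sqdist-seq-nonNeg (point P i) (point P j)) 0≤ρ
    (≤-trans {dist (point P i) (point P j)} {D} {√ ρ}
      (P≤D (dist (point P i) (point P j)) (i , j , ≈-refl {dist (point P i) (point P j)}))
      (D-least (√ ρ) (λ t (l , m , t≈) → ≤-trans {t} {dist (point Q l) (point Q m)} {√ ρ}
        (≈⇒≤ {t} {dist (point Q l) (point Q m)} t≈)
        (√-mono-≤ {sqdist (point Q l) (point Q m)} {ρ} (Q≤ρ l m)))))

dist-≈⇒sqdist-≈ : ∀ {d e} (x y : Point d) (x′ y′ : Point e) → dist x y ≈ dist x′ y′ →
  sqdist x y ≈ sqdist x′ y′
dist-≈⇒sqdist-≈ x y x′ y′ = √-injective {sqdist x y} {sqdist x′ y′}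
  (sqdist-seq-nonNeg x y) (sqdist-seq-nonNeg x′ y′)

congruent-sqdist : ∀ {d e} {I J : Set} (P : I → Point d) (Q : J → Point e)
  (congruent : Congruent P Q) → let f = Bijection.to (proj₁ congruent) in
  ∀ a b → sqdist (P a) (P b) ≈ sqdist (Q (f a)) (Q (f b))
congruent-sqdist P Q (f , isometric) a b =
  dist-≈⇒sqdist-≈ (P a) (P b) (Q (Bijection.to f a)) (Q (Bijection.to f b)) (isometric a b)

Fin3-cover : ∀ (i j k l : Fin 3) → i ≢ j → j ≢ k → i ≢ k → l ≡ i ⊎ l ≡ j ⊎ l ≡ k
Fin3-cover i j k l i≢j j≢k i≢k = excluded (table i j k l)
  where
  -- The inequalities become alternatives, so that the statement is decidable and settled by
  -- enumeration.
  table : ∀ (i j k l : Fin 3) →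
    i ≡ j ⊎ j ≡ k ⊎ i ≡ k ⊎ l ≡ i ⊎ l ≡ j ⊎ l ≡ k
  table = from-yes (all? {n = 3} λ i → all? {n = 3} λ j → all? {n = 3} λ k → all? {n = 3} λ l →
    (i ≟ j) ⊎-dec ((j ≟ k) ⊎-dec ((i ≟ k) ⊎-dec ((l ≟ i) ⊎-dec ((l ≟ j) ⊎-dec (l ≟ k))))))
  excluded : i ≡ j ⊎ j ≡ k ⊎ i ≡ k ⊎ l ≡ i ⊎ l ≡ j ⊎ l ≡ k → l ≡ i ⊎ l ≡ j ⊎ l ≡ k
  excluded (inj₁ i≡j)               = ⊥-elim (i≢j i≡j)
  excluded (inj₂ (inj₁ j≡k))        = ⊥-elim (j≢k j≡k)
  excluded (inj₂ (inj₂ (inj₁ i≡k))) = ⊥-elim (i≢k i≡k)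
  excluded (inj₂ (inj₂ (inj₂ rest))) = rest

-- The colouring and the theorem

module _ {d} (T : PointSet d 3) {i j k : Fin 3}
  (cover : ∀ l → l ≡ i ⊎ l ≡ j ⊎ l ≡ k) {p q s : ℝ}
  (p≈ : sqdist (point T i) (point T j) ≈ p) (q≈ : sqdist (point T k) (point T j) ≈ q)
  (r≈ : sqdist (point T i) (point T k) ≈ Weights.r p q s)
  (0<p : 0ℝ < p) (0<q : 0ℝ < q) (0≤-s : 0ℝ ≤ - s) (0<2s²-pq : 0ℝ < (s * s + s * s) - p * q)
  where

  open Weights p q s using (r; gap; cost)

  private
    0≤p : 0ℝ ≤ p
    0≤p = pos⇒nonneg {p} 0<p
    0≤q : 0ℝ ≤ q
    0≤q = pos⇒nonneg {q} 0<q

  -- As s ≤ 0, the law of cosines makes r = p + q - 2s at least as large as p and q.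
  longest : ∀ l m → sqdist (point T l) (point T m) ≤ sqdist (point T i) (point T k)
  longest l m = cases (cover l) (cover m)
    where
    ρ = sqdist (point T i) (point T k)
    from-r : ∀ {x y} → y ≤ r → x ≈ y → x ≤ ρ
    from-r {x} {y} y≤r x≈y = ≤-trans {x} {y} {ρ} (≈⇒≤ {x} {y} x≈y)
      (≤-trans {y} {r} {ρ} y≤r (≈⇒≥ {ρ} {r} r≈))
    p≤r : p ≤ r
    p≤r = certify {p} {r} {q + ((- s) + (- s))}
      (nonneg-+ {q} {(- s) + (- s)} 0≤q (nonneg-+ { - s} { - s} 0≤-s 0≤-s))
      (λ n → solve 3 (λ p q s → q :+ ((:- s) :+ (:- s)) := ((p :+ q) :- (s :+ s)) :- p) refl
        (seq p n) (seq q n) (seq s n))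
    q≤r : q ≤ r
    q≤r = certify {q} {r} {p + ((- s) + (- s))}
      (nonneg-+ {p} {(- s) + (- s)} 0≤p (nonneg-+ { - s} { - s} 0≤-s 0≤-s))
      (λ n → solve 3 (λ p q s → p :+ ((:- s) :+ (:- s)) := ((p :+ q) :- (s :+ s)) :- q) refl
        (seq p n) (seq q n) (seq s n))
    flip : ∀ l m {y} → sqdist (point T l) (point T m) ≈ y → sqdist (point T m) (point T l) ≈ y
    flip l m {y} = ≈-trans {sqdist (point T m) (point T l)} {sqdist (point T l) (point T m)} {y}
      (sqdist-comm (point T m) (point T l))
    self : ∀ l → sqdist (point T l) (point T l) ≤ ρ
    self l = sqdist-self-≤ (point T l) {ρ} (sqdist-nonneg (point T i) (point T k))
    cases : ∀ {l m} → l ≡ i ⊎ l ≡ j ⊎ l ≡ k → m ≡ i ⊎ m ≡ j ⊎ m ≡ k →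
      sqdist (point T l) (point T m) ≤ ρ
    cases (inj₁ refl)        (inj₁ refl)        = self i
    cases (inj₁ refl)        (inj₂ (inj₁ refl)) =
      from-r {sqdist (point T i) (point T j)} {p} p≤r p≈
    cases (inj₁ refl)        (inj₂ (inj₂ refl)) = ≈⇒≤ {ρ} {ρ} (≈-refl {ρ})
    cases (inj₂ (inj₁ refl)) (inj₁ refl)        =
      from-r {sqdist (point T j) (point T i)} {p} p≤r (flip i j {p} p≈)
    cases (inj₂ (inj₁ refl)) (inj₂ (inj₁ refl)) = self j
    cases (inj₂ (inj₁ refl)) (inj₂ (inj₂ refl)) =
      from-r {sqdist (point T j) (point T k)} {q} q≤r (flip k j {q} q≈)
    cases (inj₂ (inj₂ refl)) (inj₁ refl)        =
      ≈⇒≤ {sqdist (point T k) (point T i)} {ρ} (sqdist-comm (point T k) (point T i))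
    cases (inj₂ (inj₂ refl)) (inj₂ (inj₁ refl)) =
      from-r {sqdist (point T k) (point T j)} {q} q≤r q≈
    cases (inj₂ (inj₂ refl)) (inj₂ (inj₂ refl)) = self k

  no-copy-in-shell : ∀ {n} {I : Set} (P : I → Point n) (C : Point n) {ε : ℚ} →
    (∀ a → sqdist (P a) C - fromℚ ½ * r ≤ fromℚ ε) →
    (∀ a b → sqdist (P a) C ≤ sqdist (P b) C + fromℚ ε) →
    0ℝ < gap - fromℚ ε * cost → ¬ Congruent P (point T)
  no-copy-in-shell P C {ε} near shell slack congruent@(f , _) =
    impossible (onto i) (onto j) (onto k)
    where
    onto = Bijection.strictlySurjective f
    copy : ∀ {l m} a b → Bijection.to f a ≡ l → Bijection.to f b ≡ m →
      sqdist (P a) (P b) ≈ sqdist (point T l) (point T m)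
    copy a b refl refl = congruent-sqdist P (point T) congruent a b
    impossible : (∃[ a ] Bijection.to f a ≡ i) → (∃[ a ] Bijection.to f a ≡ j) →
      (∃[ a ] Bijection.to f a ≡ k) → ⊥
    impossible (x , eqˣ) (y , eqʸ) (z , eqᶻ) =
      -- The copy `y` of the obtuse vertex is the reference point: `near` bounds its distance to the
      -- centre, and `shell` compares the other two with it.
      Weights.no-common-shell p q s 0≤p 0≤q 0≤-s ε
        (sqdist (P y) C) (sqdist (P x) C) (sqdist (P z) C) slack (near y) (shell x y) (shell z y)
        (spreadℝ-cong {Weights.k p q s} {Weights.a p q s} {Weights.c p q s}
          {sqdist (P x) (P y)} {sqdist (P z) (P y)} {sqdist (P x) (P z)} {p} {q} {r}
          {sqdist (P y) C} {sqdist (P x) C} {sqdist (P z) C}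
          (≈-trans {sqdist (P x) (P y)} {sqdist (point T i) (point T j)} {p}
            (copy x y eqˣ eqʸ) p≈)
          (≈-trans {sqdist (P z) (P y)} {sqdist (point T k) (point T j)} {q}
            (copy z y eqᶻ eqʸ) q≈)
          (≈-trans {sqdist (P x) (P z)} {sqdist (point T i) (point T k)} {r}
            (copy x z eqˣ eqᶻ) r≈)
          (spreadℝ-nonneg (P x) (P y) (P z) C (Weights.k p q s) (Weights.a p q s) (Weights.c p q s)))

  not-diameter-ramsey : ¬ DiameterRamsey T
  not-diameter-ramsey ramsey =
    with-slack (pos-slack {gap} (Weights.gap-pos p q s 0<p 0<q 0≤-s 0<2s²-pq) cost)
    where
    with-slack : (∃[ ε ] 0ℚ ℚ.< ε × 0ℝ < gap - fromℚ ε * cost) → ⊥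
    with-slack (ε , 0<ε , slack) = with-bound (upper-bound (fromℚ ½ * r + fromℚ ε))
      where
      -- A window has width 2δ, which is to be ε.
      δ = ½ ℚ.* ε
      0<δ = half-pos 0<ε
      with-bound : (∃[ K ] 0ℚ ℚ.< K × fromℚ ½ * r + fromℚ ε ≤ fromℚ K) → ⊥
      -- `K` bounds the squared radius r/2 + ε, so windows of step δ up to `K` will colour any B;
      -- their number is settled here because `ramsey` returns B only after the number of colours is
      -- given.
      with-bound (K , 0<K , ≤K) = with-colours (multiple-exceeds 0<K 0<δ)
        where
        with-colours : (∃[ R ] K ℚ.≤ ι (suc R) ℚ.* δ) → ⊥
        with-colours (R , K≤) = with-set (ramsey (suc R))
          where
          with-set : _ → ⊥
          with-set (n , _ , m , B , same , monochromatic) = with-centre (jung (point B) r B≤r ε 0<ε)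
            where
            B≤r : ∀ a b → sqdist (point B a) (point B b) ≤ r
            B≤r a b = ≤-trans {sqdist (point B a) (point B b)} {sqdist (point T i) (point T k)} {r}
              (diameter-≤ B T same {sqdist (point T i) (point T k)}
                (sqdist-seq-nonNeg (point T i) (point T k)) longest a b)
              (≈⇒≤ {sqdist (point T i) (point T k)} {r} r≈)
            with-centre : (∃[ C ] ∀ b → sqdist (point B b) C - fromℚ ½ * r ≤ fromℚ ε) → ⊥
            with-centre (C , near) = with-copy (monochromatic χ)
              where
              in-range : ∀ {x} → x - fromℚ ½ * r ≤ fromℚ ε → x ≤ fromℚ (ι (suc R) ℚ.* δ)
              in-range {x} x≤ = certify {x} {fromℚ (ι (suc R) ℚ.* δ)}
                {((fromℚ ε - (x - fromℚ ½ * r)) + (fromℚ K - (fromℚ ½ * r + fromℚ ε))) +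
                 fromℚ (ι (suc R) ℚ.* δ ℚ.- K)}
                (nonneg-+ {(fromℚ ε - (x - fromℚ ½ * r)) + (fromℚ K - (fromℚ ½ * r + fromℚ ε))}
                  {fromℚ (ι (suc R) ℚ.* δ ℚ.- K)}
                  (nonneg-+ {fromℚ ε - (x - fromℚ ½ * r)} {fromℚ K - (fromℚ ½ * r + fromℚ ε)}
                    (≤⇒nonneg {x - fromℚ ½ * r} {fromℚ ε} x≤)
                    (≤⇒nonneg {fromℚ ½ * r + fromℚ ε} {fromℚ K} ≤K))
                  (nonneg-const (p≤q⇒0≤q-p K≤)))
                (λ n → solve 5 (λ x h ε K N →
                  ((ε :- (x :- h)) :+ (K :- (h :+ ε))) :+ (N :- K) := N :- x) refl
                  (seq x n) (½ ℚ.* seq r n) ε K (ι (suc R) ℚ.* δ))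
              bin : ∀ b → Σ[ c ∈ Fin (suc R) ] Window δ (toℕ c) (sqdist (point B b) C)
              bin b = window 0<δ R (sqdist (point B b) C) (sqdist-nonneg (point B b) C)
                (in-range {sqdist (point B b) C} (near b))
              χ : Fin m → Fin (suc R)
              χ b = proj₁ (bin b)
              with-copy : (∃[ S ] Monochromatic χ S × Congruent (restrict B S) (point T)) → ⊥
              with-copy (S , mono , congruent) =
                no-copy-in-shell (restrict B S) C {ε}
                  (λ a → subst (λ x → sqdist x C - fromℚ ½ * r ≤ fromℚ ε) (as-restrict a)
                    (near (proj₁ a)))
                  (λ a b → subst₂ (λ x y → sqdist x C ≤ sqdist y C + fromℚ ε)
                    (as-restrict a) (as-restrict b)
                    (shell (proj₁ a) (proj₁ b) (proj₂ a) (proj₂ b)))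
                  slack congruent
                where
                -- Transport along this equation, rather than conversion, keeps the
                -- proofs of Cauchyness inside sqdist from being unfolded.
                as-restrict : ∀ a → point B (proj₁ a) ≡ restrict B S a
                as-restrict _ = refl
                shell : ∀ a b → a ∈ S → b ∈ S →
                  sqdist (point B a) C ≤ sqdist (point B b) C + fromℚ ε
                shell a b a∈S b∈S = subst
                  (λ z → sqdist (point B a) C ≤ sqdist (point B b) C + fromℚ z) (halves ε)
                  (window-width (toℕ (χ a)) {sqdist (point B a) C} {sqdist (point B b) C}
                    (proj₂ (bin a))
                    (subst (λ c → Window δ (toℕ c) (sqdist (point B b) C))
                      (sym (mono a b a∈S b∈S)) (proj₂ (bin b))))

corollary1p3 : (T : PointSet 2 3) → ¬ Collinear T →
    HasAngleLargerThan (fromℚ (+ 135 / 1)) T → ¬ DiameterRamsey T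
corollary1p3 T _ (i , j , k , i≢j , j≢k , i≢k , α , (_ , α≤180 , π , isPi , c , isCos , c√p√q≈s) , 135<α)
  -- Distinctness only refutes that a squared distance fails to be positive; since the goal is ⊥,
  -- positivity may be assumed all the same.
  ramsey = separated i≢j λ 0<p → separated (j≢k ∘ sym) λ 0<q →
    not-diameter-ramsey T (λ l → Fin3-cover i j k l i≢j j≢k i≢k)
      {sqdist x y} {sqdist z y} {(x -ₚ y) ∙ (z -ₚ y)}
      (≈-refl {sqdist x y}) (≈-refl {sqdist z y}) (law-of-cosines x y z)
      0<p 0<q (proj₁ gap) (proj₂ gap 0<p 0<q) ramsey
  where
  x = point T i
  y = point T j
  z = point T k
  obtuse = cos-obtuse {α} {π} {c} α≤180 135<α isPi isCos
  gap = angle-gap {sqdist x y} {sqdist z y} {(x -ₚ y) ∙ (z -ₚ y)} {c}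
    (sqdist-seq-nonNeg x y) (sqdist-seq-nonNeg z y) (proj₁ obtuse) (proj₂ obtuse) c√p√q≈s
  separated : ∀ {l m} → l ≢ m → (0ℝ < sqdist (point T l) (point T m) → ⊥) → ⊥
  separated {l} {m} l≢m ¬0<p = l≢m (distinct T (sqdist≤0⇒≈ₚ (point T l) (point T m)
    (¬pos⇒≤0 {sqdist (point T l) (point T m)} ¬0<p)))
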